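{- Let $\mu=(\mu_1\ge\cdots\ge\mu_L>0)$ be a partition and let $R=((\mu_1),\dots,(\mu_L))$ be the sequence of its parts regarded as single-rowed partitions. Then $$\mathbb{H}^{\mathrm v}_R[X;t]=\mathbb{B}^{\mathrm v}_R[X;t^2],$$ or equivalently, $K^{\mathrm v}_{\lambda;R}(t)=d_{\lambda R}(t^2)$ for all partitions $\lambda$.
   Context: $\Lambda$ is the ring of symmetric functions in $X=x_1+x_2+\cdots$ (rational coefficients, extended by auxiliary indeterminates as needed), with the scalar product for which Schur functions are orthonormal. Plethystic notation: $P[A]$ is obtained from $P\in\Lambda$ by expressing $P$ in power sums and replacing $p_k$ by $p_k[A]$, where $p_k[A]$ raises every indeterminate in $A$ (including $t$) to the $k$-th power and $p_k[A-B]=p_k[A]-p_k[B]$; $\Omega[A]=\exp(\sum_{k\ge1}p_k[A]/k)$. $P^\perp$ is the operator adjoint to multiplication by $P$ (in the $X$ variables); in particular $\Omega[XA]^\perp P[X]=P[X+A]$. The symbol $\mathrm v$ stands for the vertical domino. Put $f_{\mathrm v}=s_{(1^2)}$, $f_{\mathrm v}[tX]=t^2s_{(1^2)}[X]$, and $s^{\mathrm v}_\lambda=\Omega[-f_{\mathrm v}]^\perp s_\lambda$, a basis of $\Lambda$. Bernstein's operators $B_r\in\mathrm{End}(\Lambda)$ are defined by $\sum_{r\in\mathbb{Z}}B_rz^r=\Omega[zX]\,\Omega[-z^{ -1}X]^\perp$ (skew, then multiply), and $B^{\mathrm v}_r=\Omega[-f_{\mathrm v}]^\perp\circ B_r\circ\Omega[f_{\mathrm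 v}]^\perp$. The $t$-analogue of $V\in\mathrm{End}(\Lambda)$ is $\widetilde V(P[X])=V^Y(P[tX+(1-t)Y])|_{Y\to X}$, where $V^Y$ is $V$ acting in a second set of variables $Y$ and afterwards $Y$ is replaced by $X$. Let $\widetilde B_r,\widetilde B^{\mathrm v}_r$ be the $t$-analogues of $B_r,B^{\mathrm v}_r$, let $\widetilde B_{r,t^2}$ be $\widetilde B_r$ with $t$ replaced by $t^2$, and $$H^{\mathrm v}_r=\Omega[f_{\mathrm v}[tX]-f_{\mathrm v}[X]]^\perp\circ\widetilde B_{r,t^2}\circ\Omega[f_{\mathrm v}[X]-f_{\mathrm v}[tX]]^\perp .$$ For $R$ as in the claim, $\mathbb{B}^{\mathrm v}_R[X;t]=\widetilde B^{\mathrm v}_{\mu_1}\cdots\widetilde B^{\mathrm v}_{\mu_L}1=\sum_\lambda d_{\lambda R}(t)s^{\mathrm v}_\lambda$, $\mathbb{B}^{\mathrm v}_R[X;t^2]$ is this with $t\mapsto t^2$, and $\mathbb{H}^{\mathrm v}_R[X;t]=H^{\mathrm v}_{\mu_1}\cdots H^{\mathrm v}_{\mu_L}1=\sum_\lambda K^{\mathrm v}_{\lambda;R}(t)s^{\mathrm v}_\lambda$. -}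

module Defs where

open import Algebra.Bundles using (CommutativeRing)
open import Data.Fin.Base using (Fin; zero; suc; toℕ; punchIn)
open import Data.Integer.Base as ℤ using (ℤ; -[1+_])
open import Data.List.Base using (List; []; _∷_; _++_; map; foldr; length; lookup; cartesianProductWith)
open import Data.List.Membership.Propositional using (_∉_)
open import Data.List.Relation.Unary.All using (All; []; _∷_)
open import Data.List.Relation.Unary.Linked using (Linked; []; [-]; _∷_)
open import Data.List.Relation.Unary.Unique.Propositional using (Unique)
open import Data.Nat.Base as ℕ using (ℕ; zero; suc; NonZero; _∸_; _⊔_; _≥_; _>_; _!; z≤n; s≤s)
open import Data.Nat.Properties using (m*n≢0; _!≢0)
open import Data.Product.Base using (_×_; _,_; ∃-syntax)
open import Data.Rational.Base as ℚ using (ℚ)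
open import Data.Rational.Properties using () renaming (+-*-commutativeRing to ℚ-commutativeRing)
open import Data.Unit.Base using (⊤; tt)
open import Function.Base using (_∘_)
open import Level using (0ℓ)
open import Relation.Binary.PropositionalEquality.Core using (_≢_)

-- The polynomial ring R[I], presented as the free commutative R-algebra on I:
-- ring expressions modulo the least congruence containing the laws.
module Polynomial (R : CommutativeRing 0ℓ 0ℓ) (I : Set) where

  private module R = CommutativeRing R

  infix  4 _≈_
  infixl 6 _+_
  infixl 7 _*_
  infix  8 -_

  data Poly : Set where
    con : R.Carrier → Poly
    var : I → Poly
    _+_ : Poly → Poly → Poly
    _*_ : Poly → Poly → Poly
    -_  : Poly → Poly

  data _≈_ : Poly → Poly → Set where
    ≈-refl      : ∀ {x} → x ≈ x
    ≈-sym       : ∀ {x y} → x ≈ y → y ≈ x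
    ≈-trans     : ∀ {x y z} → x ≈ y → y ≈ z → x ≈ z
    +-cong      : ∀ {x x′ y y′} → x ≈ x′ → y ≈ y′ → x + y ≈ x′ + y′
    *-cong      : ∀ {x x′ y y′} → x ≈ x′ → y ≈ y′ → x * y ≈ x′ * y′
    -‿cong      : ∀ {x x′} → x ≈ x′ → - x ≈ - x′
    +-assoc     : ∀ x y z → (x + y) + z ≈ x + (y + z)
    +-comm      : ∀ x y → x + y ≈ y + x
    +-identityˡ : ∀ x → con R.0# + x ≈ x
    -‿inverseˡ  : ∀ x → - x + x ≈ con R.0#
    *-assoc     : ∀ x y z → (x * y) * z ≈ x * (y * z)
    *-comm      : ∀ x y → x * y ≈ y * x
    *-identityˡ : ∀ x → con R.1# * x ≈ x
    distribˡ    : ∀ x y z → x * (y + z) ≈ x * y + x * z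
    con-cong    : ∀ {a b} → a R.≈ b → con a ≈ con b
    con-+       : ∀ a b → con (a R.+ b) ≈ con a + con b
    con-*       : ∀ a b → con (a R.* b) ≈ con a * con b

  commutativeRing : CommutativeRing 0ℓ 0ℓ
  commutativeRing = record
    { Carrier = Poly ; _≈_ = _≈_ ; _+_ = _+_ ; _*_ = _*_ ; -_ = -_
    ; 0# = con R.0# ; 1# = con R.1#
    ; isCommutativeRing = record
      { isRing = record
        { +-isAbelianGroup = record
          { isGroup = record
            { isMonoid = record
              { isSemigroup = record
                { isMagma = record
                  { isEquivalence = record
                    { refl = ≈-refl ; sym = ≈-sym ; trans = ≈-trans }
                  ; ∙-cong = +-cong }
                ; assoc = +-assoc }
              ; identity = +-identityˡ
                         , λ x → ≈-trans (+-comm x _) (+-identityˡ x) }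
            ; inverse = -‿inverseˡ
                      , λ x → ≈-trans (+-comm x _) (-‿inverseˡ x)
            ; ⁻¹-cong = -‿cong }
          ; comm = +-comm }
        ; *-cong = *-cong
        ; *-assoc = *-assoc
        ; *-identity = *-identityˡ
                     , λ x → ≈-trans (*-comm x _) (*-identityˡ x)
        ; distrib = distribˡ
                  , λ x y z → ≈-trans (*-comm (y + z) x)
                                (≈-trans (distribˡ x y z)
                                  (+-cong (*-comm x y) (*-comm x z))) }
      ; *-comm = *-comm } }

  -- The ring homomorphism determined by images of coefficients and variables.
  evaluate : (R.Carrier → Poly) → (I → Poly) → Poly → Poly
  evaluate c v (con a) = c a
  evaluate c v (var i) = v i
  evaluate c v (x + y) = evaluate c v x + evaluate c v y
  evaluate c v (x * y) = evaluate c v x * evaluate c v y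
  evaluate c v (- x)   = - evaluate c v x

module K = Polynomial ℚ-commutativeRing ⊤

ℚ[t]-commutativeRing : CommutativeRing 0ℓ 0ℓ
ℚ[t]-commutativeRing = K.commutativeRing

open K public using () renaming (Poly to ℚ[t])
open import Algebra.Properties.Semiring.Exp (CommutativeRing.semiring ℚ[t]-commutativeRing)
  using () renaming (_^_ to _^ₜ_)

t t² : ℚ[t]
t  = K.var tt
t² = t ^ₜ 2

-- Λ = ℚ[t][p₁, p₂, …], where var i stands for p_{i+1}.
open Polynomial ℚ[t]-commutativeRing ℕ public using (_≈_; _+_; _*_; -_; con; var)
  renaming (Poly to Λ; commutativeRing to Λ-commutativeRing; evaluate to Λ-evaluate)

open CommutativeRing Λ-commutativeRing using (0#; 1#; _-_; semiring; +-commutativeMonoid)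
open import Algebra.Properties.Semiring.Exp semiring using (_^_)
open import Algebra.Properties.CommutativeMonoid.Sum +-commutativeMonoid using (sum)

p : (k : ℕ) .{{_ : NonZero k}} → Λ
p (suc i) = var i

X : Λ
X = p 1

Op : Set
Op = Λ → Λ

-- p_k[a] for a scalar a.
ψₜ : ℕ → ℚ[t] → ℚ[t]
ψₜ k = K.evaluate K.con (λ _ → t ^ₜ k)

-- p_k[A].
ψ : (k : ℕ) .{{_ : NonZero k}} → Op
ψ k = Λ-evaluate (con ∘ ψₜ k) (λ i → p (k ℕ.* suc i) {{m*n≢0 k (suc i)}})

-- P[A].  The scalars of the outer P are left alone; those of A are raised.
infix 9 _[_]
_[_] : Λ → Λ → Λ
P [ A ] = Λ-evaluate con (λ i → ψ (suc i) A) P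

_[t↦t²]ₜ : ℚ[t] → ℚ[t]
_[t↦t²]ₜ = K.evaluate K.con (λ _ → t²)

_[t↦t²] : Op
_[t↦t²] = Λ-evaluate (con ∘ _[t↦t²]ₜ) var

-- Power series in an auxiliary variable u.
Series : Set
Series = ℕ → Λ

oneˢ : Series
oneˢ zero    = 1#
oneˢ (suc _) = 0#

_*ˢ_ : Series → Series → Series
(a *ˢ b) n = sum {suc n} (λ i → a (toℕ i) * b (n ∸ toℕ i))

_^ˢ_ : Series → ℕ → Series
a ^ˢ zero  = oneˢ
a ^ˢ suc j = a *ˢ (a ^ˢ j)

ratio : ℕ → (d : ℕ) .{{_ : NonZero d}} → Λ
ratio n d = con (K.con (ℤ.+ n ℚ./ d))

-- Correct for a without constant term: then [uⁿ] aʲ = 0 for j > n.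
expˢ : Series → Series
expˢ a n = sum {suc n} (λ j → ratio 1 (toℕ j !) {{toℕ j !≢0}} * (a ^ˢ toℕ j) n)

logΩ : Λ → Series
logΩ A zero    = 0#
logΩ A (suc i) = ratio 1 (suc i) * ψ (suc i) A

-- Ω A n is the coefficient of uⁿ in Ω[uA], so that Ω[A] = Σ_n Ω A n.
Ω : Λ → Series
Ω A = expˢ (logΩ A)

-- The coefficients of a power series, indexed by ℤ.
coefficient : Series → ℤ → Λ
coefficient a (ℤ.+ n)  = a n
coefficient a -[1+ _ ] = 0#

h : ℤ → Λ
h = coefficient (Ω X)

-- Laplace expansion along the first row.
det : ∀ {n} → (Fin n → Fin n → Λ) → Λ
det {zero}  M = 1#
det {suc n} M = sum (λ j → (- 1#) ^ toℕ j * (M zero j * det (λ a b → M (suc a) (punchIn j b))))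

record Partition : Set where
  constructor partition
  field
    parts       : List ℕ
    .decreasing : Linked _≥_ parts
    .positive   : All (_> 0) parts
open Partition public

-- The Jacobi–Trudi determinant of h_{λᵢ - i + j}.
s : Partition → Λ
s λ′ = det {length (parts λ′)}
  (λ i j → h ((ℤ.+ lookup (parts λ′) i ℤ.- ℤ.+ toℕ i) ℤ.+ ℤ.+ toℕ j))

⟪1,1⟫ : Partition
⟪1,1⟫ = partition (1 ∷ 1 ∷ []) (s≤s z≤n ∷ [-]) (s≤s z≤n ∷ s≤s z≤n ∷ [])

f : Λ
f = s ⟪1,1⟫

f[tX] : Λ
f[tX] = f [ con t * X ]

-- As the Schur functions form a basis, there is exactly one such form up to ≈.
record ScalarProduct : Set where
  field
    ⟨_,_⟩      : Λ → Λ → ℚ[t]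
    cong       : ∀ {F F′ G G′} → F ≈ F′ → G ≈ G′ → ⟨ F , G ⟩ K.≈ ⟨ F′ , G′ ⟩
    additiveˡ  : ∀ F F′ G → ⟨ F + F′ , G ⟩ K.≈ ⟨ F , G ⟩ K.+ ⟨ F′ , G ⟩
    additiveʳ  : ∀ F G G′ → ⟨ F , G + G′ ⟩ K.≈ ⟨ F , G ⟩ K.+ ⟨ F , G′ ⟩
    scalarˡ    : ∀ a F G → ⟨ con a * F , G ⟩ K.≈ a K.* ⟨ F , G ⟩
    scalarʳ    : ∀ a F G → ⟨ F , con a * G ⟩ K.≈ a K.* ⟨ F , G ⟩
    normal     : ∀ λ′ → ⟨ s λ′ , s λ′ ⟩ K.≈ K.con ℚ.1ℚ
    orthogonal : ∀ {λ′ ν} → λ′ ≢ ν → ⟨ s λ′ , s ν ⟩ K.≈ K.con ℚ.0ℚ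

record Adjoints (S : ScalarProduct) : Set where
  open ScalarProduct S
  infix 10 _⊥
  field
    _⊥      : Λ → Op
    adjoint : ∀ P F G → ⟨ (P ⊥) F , G ⟩ K.≈ ⟨ F , P * G ⟩

-- An upper bound for the degree, where p_k has degree k.
deg : Λ → ℕ
deg (con _) = 0
deg (var i) = suc i
deg (F + G) = deg F ⊔ deg G
deg (F * G) = deg F ℕ.+ deg G
deg (- F)   = deg F

-- Σ (a , b) stands for Σ a[X] b[Y].
Λ⊗Λ : Set
Λ⊗Λ = List (Λ × Λ)

_*ᵖ_ : Λ × Λ → Λ × Λ → Λ × Λ
(a , b) *ᵖ (a′ , b′) = a * a′ , b * b′

-ᵖ_ : Λ × Λ → Λ × Λ
-ᵖ (a , b) = - a , b

-- P[qX + (1 - q)Y].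
split : ℚ[t] → Λ → Λ⊗Λ
split q (con a) = (con a , 1#) ∷ []
split q (var i) = (qᵏ * var i , 1#) ∷ (1# - qᵏ , var i) ∷ []
  where qᵏ = con (ψₜ (suc i) q)
split q (F + G) = split q F ++ split q G
split q (F * G) = cartesianProductWith _*ᵖ_ (split q F) (split q G)
split q (- F)   = map -ᵖ_ (split q F)

-- V^Y (extended linearly over the X variables), followed by Y ↦ X.
applyY : Op → Λ⊗Λ → Λ
applyY V []             = 0#
applyY V ((a , b) ∷ ts) = a * V b + applyY V ts

-- The t-analogue of V, with t replaced by q.
analogue : ℚ[t] → Op → Op
analogue q V P = applyY V (split q P)

module Domino {S : ScalarProduct} (adj : Adjoints S) where

  open Adjoints adj

  -- Ω[A]^⊥ for A without constant term: Ω A n then has no component of degree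
  -- below n, so the terms with n > deg F vanish.
  Ω[_]⊥ : Λ → Op
  Ω[ A ]⊥ F = sum {suc (deg F)} (λ n → ((Ω A (toℕ n)) ⊥) F)

  -- The coefficient of z^r in Ω[zX] Ω[-z⁻¹X]^⊥; as Ω[zX] = Σ zⁿ Ω X n and
  -- Ω[-z⁻¹X] = Σ z⁻ⁿ Ω (- X) n.
  B : ℤ → Op
  B r F = sum {suc (deg F)} (λ n →
    coefficient (Ω X) (r ℤ.+ ℤ.+ toℕ n) * ((Ω (- X) (toℕ n)) ⊥) F)

  Bᵛ : ℤ → Op
  Bᵛ r = Ω[ - f ]⊥ ∘ B r ∘ Ω[ f ]⊥

  B̃ᵛ : ℤ → Op
  B̃ᵛ r = analogue t (Bᵛ r)

  Hᵛ : ℤ → Op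
  Hᵛ r = Ω[ f[tX] - f ]⊥ ∘ analogue t² (B r) ∘ Ω[ f - f[tX] ]⊥

  𝔹ᵛ ℍᵛ : Partition → Λ
  𝔹ᵛ μ = foldr (λ m → B̃ᵛ (ℤ.+ m)) 1# (parts μ)
  ℍᵛ μ = foldr (λ m → Hᵛ (ℤ.+ m)) 1# (parts μ)

  sᵛ : Partition → Λ
  sᵛ λ′ = Ω[ - f ]⊥ (s λ′)

  -- F = Σ_λ c(λ) sᵛ_λ with c finitely supported.
  _HasExpansion_ : Λ → (Partition → ℚ[t]) → Set
  F HasExpansion c = ∃[ ls ] Unique ls
    × (∀ λ′ → λ′ ∉ ls → c λ′ K.≈ K.con ℚ.0ℚ)
    × F ≈ foldr (λ λ′ G → con (c λ′) * sᵛ λ′ + G) 0# ls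

{-# OPTIONS --safe #-}
module Submission where

-- Put k = suc i.  A family of operators V_r with V_r 1 = h_r and
--   V_r p_k = p_k V_r + x_k V_{r+k} + y_k V_{r-k}
-- is determined by the scalars x and y.  Bernstein's operators have x = -1, y = 0; conjugation by
-- Ω[A]^⊥, where p_k[A] = a_k p_k[f], adds a to y (as f[z] = 0, it keeps V_r 1 = h_r); the
-- t-analogue multiplies x and y by 1 - t^k.  Both Hᵛ_r and B̃ᵛ_r with t ↦ t² thus have
-- x_k = y_k = -(1 - t^{2k}), and they coincide.
--
-- That P^⊥ is P(∂_1, ∂_2, …) with ∂_k = k ∂/∂p_k, whatever form makes the Schur functions
-- orthonormal, is reduced to two facts about s_λ = B_{λ_1} B_{λ_2} ⋯ 1: these are orthonormal for the
-- Hall form, by the Clifford relation between B and its adjoint, and they span Λ, by straightening.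
open import Algebra.Bundles using (CommutativeRing)
import Algebra.Properties.CommutativeMonoid.Sum
import Algebra.Properties.Group
import Algebra.Properties.Semiring.Exp
import Algebra.Solver.Ring
open import Algebra.Solver.Ring.AlmostCommutativeRing using (fromCommutativeRing; _-Raw-AlmostCommutative⟶_)
open import Data.Bool.Base using (Bool; true; false)
open import Data.Fin.Base as Fin using (Fin; zero; suc; toℕ; inject₁; punchIn; punchOut)
import Data.Fin.Properties as Finₚ
open import Data.Integer.Base as ℤ using (ℤ; -[1+_])
import Data.Integer.Properties as ℤₚ
open import Data.Integer.Solver using (module +-*-Solver)
open import Data.List.Base using (List; []; _∷_; _++_; map; foldr; length; lookup; deduplicate; cartesianProductWith)
open import Data.List.Membership.Propositional using (_∈_; _∉_)
open import Data.List.Membership.Propositional.Properties using (∈-++⁺ˡ; ∈-++⁺ʳ; ∈-deduplicate⁺)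
import Data.List.Properties as Listₚ
open import Data.List.Relation.Unary.All as All using (All; []; _∷_)
open import Data.List.Relation.Unary.AllPairs using (AllPairs; []; _∷_)
open import Data.List.Relation.Unary.Any using (here; there)
open import Data.List.Relation.Unary.Linked using (Linked; []; [-]; _∷_)
open import Data.List.Relation.Unary.Linked.Properties using (Linked⇒AllPairs)
open import Data.List.Relation.Unary.Unique.Propositional using (Unique)
open import Data.Maybe.Base using (Maybe; just; nothing)
open import Data.Nat.Base as ℕ using (ℕ; zero; suc; NonZero; _∸_; _<_; _≤_; s≤s; z≤n; _!)
import Data.Nat.Properties as ℕₚ
open import Data.Product.Base using (_×_; _,_; proj₁; proj₂; ∃-syntax)
open import Data.Rational.Base as ℚ using (ℚ)
import Data.Rational.Properties as ℚₚ
import Data.Rational.Unnormalised.Base as ℚᵘ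
import Data.Rational.Unnormalised.Properties as ℚᵘₚ
open import Data.Sum.Base using (_⊎_; inj₁; inj₂)
open import Data.Unit.Base using (⊤; tt)
open import Function.Base using (_∘_)
open import Level using (0ℓ)
open import Relation.Binary.Definitions using (DecidableEquality; tri<; tri≈; tri>)
open import Relation.Binary.PropositionalEquality as ≡ using (_≡_; _≢_)
open import Relation.Nullary using (Dec; yes; no; ¬_; contradiction)
open import Relation.Nullary.Decidable using (recompute; map′; _×-dec_)

-- Elements of `Λ` are expressions modulo a generated congruence and have no normal form. A map out
-- of `Λ` is therefore a recursion on expressions together with a check of the laws, and operators
-- are compared through their values on 1 and their commutators with every p_k. Two devices keep
-- infinite sums out. A generating series Σ V_r z^r is the sequence of its coefficients, on which
-- the polynomial ring Λ[u, d] acts by shifts. And Ω[A] enters mostly through Newton's identities n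
-- a_n = Σ p_k[A] a_{n-k}, which determine it because positive integers are invertible. The
-- operators in the statement are sums cut off at `deg F`, a number that is not invariant under ≈;
-- so each of them is shown not to change when the cut-off grows. For the coefficients, Ω[f]^⊥
-- carries sᵛ_λ back to s_λ, where pairing with Schur functions reads them off.

/-homo-+ : ∀ m n → ℤ.+ (m ℕ.+ n) ℚ./ 1 ≡ (ℤ.+ m ℚ./ 1) ℚ.+ (ℤ.+ n ℚ./ 1)
/-homo-+ m n = ℚₚ.toℚᵘ-injective (begin
  ℚ.toℚᵘ (ℤ.+ (m ℕ.+ n) ℚ./ 1)                            ≈⟨ ℚₚ.toℚᵘ-fromℚᵘ (ℚᵘ.mkℚᵘ (ℤ.+ (m ℕ.+ n)) 0) ⟩
  ℚᵘ.mkℚᵘ (ℤ.+ (m ℕ.+ n)) 0                                ≈⟨ ℚᵘ.*≡* (≡.cong (ℤ._* ℤ.1ℤ) (≡.sym (≡.trans (≡.cong₂ ℤ._+_ (ℤₚ.*-identityʳ (ℤ.+ m)) (ℤₚ.*-identityʳ (ℤ.+ n))) ≡.refl))) ⟩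
  ℚᵘ.mkℚᵘ (ℤ.+ m) 0 ℚᵘ.+ ℚᵘ.mkℚᵘ (ℤ.+ n) 0                 ≈⟨ ℚᵘₚ.+-cong (ℚₚ.toℚᵘ-fromℚᵘ (ℚᵘ.mkℚᵘ (ℤ.+ m) 0)) (ℚₚ.toℚᵘ-fromℚᵘ (ℚᵘ.mkℚᵘ (ℤ.+ n) 0)) ⟨
  ℚ.toℚᵘ (ℤ.+ m ℚ./ 1) ℚᵘ.+ ℚ.toℚᵘ (ℤ.+ n ℚ./ 1)           ≈⟨ ℚₚ.toℚᵘ-homo-+ (ℤ.+ m ℚ./ 1) (ℤ.+ n ℚ./ 1) ⟨
  ℚ.toℚᵘ ((ℤ.+ m ℚ./ 1) ℚ.+ (ℤ.+ n ℚ./ 1))                 ∎)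
  where open ℚᵘₚ.≃-Reasoning

/-homo-* : ∀ m n c d .{{_ : NonZero c}} .{{_ : NonZero d}} .{{_ : NonZero (c ℕ.* d)}} →
  (ℤ.+ m ℚ./ c) ℚ.* (ℤ.+ n ℚ./ d) ≡ ℤ.+ (m ℕ.* n) ℚ./ (c ℕ.* d)
/-homo-* m n (suc c) (suc d) = ℚₚ.toℚᵘ-injective (begin
  ℚ.toℚᵘ ((ℤ.+ m ℚ./ suc c) ℚ.* (ℤ.+ n ℚ./ suc d))         ≈⟨ ℚₚ.toℚᵘ-homo-* (ℤ.+ m ℚ./ suc c) (ℤ.+ n ℚ./ suc d) ⟩
  ℚ.toℚᵘ (ℤ.+ m ℚ./ suc c) ℚᵘ.* ℚ.toℚᵘ (ℤ.+ n ℚ./ suc d)   ≈⟨ ℚᵘₚ.*-cong (ℚₚ.toℚᵘ-fromℚᵘ (ℚᵘ.mkℚᵘ (ℤ.+ m) c)) (ℚₚ.toℚᵘ-fromℚᵘ (ℚᵘ.mkℚᵘ (ℤ.+ n) d)) ⟩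
  ℚᵘ.mkℚᵘ (ℤ.+ m) c ℚᵘ.* ℚᵘ.mkℚᵘ (ℤ.+ n) d                 ≈⟨ ℚᵘ.*≡* (≡.cong (ℤ._* (ℤ.+ (suc c ℕ.* suc d))) (≡.sym (ℤₚ.pos-* m n))) ⟩
  ℚᵘ.mkℚᵘ (ℤ.+ (m ℕ.* n)) (d ℕ.+ c ℕ.* suc d)              ≈⟨ ℚₚ.toℚᵘ-fromℚᵘ (ℚᵘ.mkℚᵘ (ℤ.+ (m ℕ.* n)) (d ℕ.+ c ℕ.* suc d)) ⟨
  ℚ.toℚᵘ (ℤ.+ (m ℕ.* n) ℚ./ (suc c ℕ.* suc d))             ∎)
  where open ℚᵘₚ.≃-Reasoning

/-cross : ∀ m n c d .{{_ : NonZero c}} .{{_ : NonZero d}} → m ℕ.* d ≡ n ℕ.* c → ℤ.+ m ℚ./ c ≡ ℤ.+ n ℚ./ d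
/-cross m n (suc c) (suc d) eq = ℚₚ.fromℚᵘ-cong {ℚᵘ.mkℚᵘ (ℤ.+ m) c} {ℚᵘ.mkℚᵘ (ℤ.+ n) d}
  (ℚᵘ.*≡* (≡.trans (≡.sym (ℤₚ.pos-* m (suc d))) (≡.trans (≡.cong ℤ.+_ eq) (ℤₚ.pos-* n (suc c)))))

-- Rational scalars in a commutative ring

record ℚ-Algebra : Set₁ where
  field
    commutativeRing : CommutativeRing 0ℓ 0ℓ
  open CommutativeRing commutativeRing
  field
    ν   : ℚ → Carrier
    ν-+ : ∀ a b → ν (a ℚ.+ b) ≈ ν a + ν b
    ν-* : ∀ a b → ν (a ℚ.* b) ≈ ν a * ν b
    ν-0 : ν ℚ.0ℚ ≈ 0#
    ν-1 : ν ℚ.1ℚ ≈ 1#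

module ℚ-AlgebraProperties (A : ℚ-Algebra) where

  open ℚ-Algebra A
  open CommutativeRing commutativeRing
  open import Algebra.Properties.Group +-group using (inverseˡ-unique)
  open import Relation.Binary.Reasoning.Setoid setoid

  ν-neg : ∀ a → ν (ℚ.- a) ≈ - ν a
  ν-neg a = inverseˡ-unique _ _ (begin
    ν (ℚ.- a) + ν a  ≈⟨ ν-+ (ℚ.- a) a ⟨
    ν (ℚ.- a ℚ.+ a)  ≡⟨ ≡.cong ν (ℚₚ.+-inverseˡ a) ⟩
    ν ℚ.0ℚ           ≈⟨ ν-0 ⟩
    0#               ∎)

  private
    morphism : CommutativeRing.rawRing ℚₚ.+-*-commutativeRing -Raw-AlmostCommutative⟶ fromCommutativeRing commutativeRing
    morphism = record { ⟦_⟧ = ν ; +-homo = ν-+ ; *-homo = ν-* ; -‿homo = ν-neg ; 0-homo = ν-0 ; 1-homo = ν-1 }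

    _≟_ : (a b : ℚ) → Maybe (ν a ≈ ν b)
    a ≟ b with a ℚₚ.≟ b
    ... | yes eq = just (reflexive (≡.cong ν eq))
    ... | no _   = nothing

  module Solver = Algebra.Solver.Ring _ _ morphism _≟_

  nat : ℕ → Carrier
  nat n = ν (ℤ.+ n ℚ./ 1)

  nat-+ : ∀ m n → nat (m ℕ.+ n) ≈ nat m + nat n
  nat-+ m n = trans (reflexive (≡.cong ν (/-homo-+ m n))) (ν-+ _ _)

  nat-0 : nat 0 ≈ 0#
  nat-0 = ν-0

  nat-suc : ∀ n → nat (suc n) ≈ 1# + nat n
  nat-suc n = trans (nat-+ 1 n) (+-congʳ ν-1)

  nat-inverse : ∀ n → ν (ℤ.+ 1 ℚ./ suc n) * nat (suc n) ≈ 1#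
  nat-inverse n = begin
    ν (ℤ.+ 1 ℚ./ suc n) * nat (suc n)       ≈⟨ ν-* _ _ ⟨
    ν ((ℤ.+ 1 ℚ./ suc n) ℚ.* (ℤ.+ suc n ℚ./ 1)) ≡⟨ ≡.cong ν (≡.trans (/-homo-* 1 (suc n) (suc n) 1) (/-cross (1 ℕ.* suc n) 1 (suc n ℕ.* 1) 1 (≡.trans (ℕₚ.*-identityʳ (1 ℕ.* suc n)) (≡.cong (1 ℕ.*_) (≡.sym (ℕₚ.*-identityʳ (suc n))))))) ⟩
    ν ℚ.1ℚ                                  ≈⟨ ν-1 ⟩
    1#                                      ∎

  -- Positive integers are invertible, not merely regular, so no knowledge of zero divisors in the
  -- presented rings is called for.
  nat-cancel : ∀ n {x y} → nat (suc n) * x ≈ nat (suc n) * y → x ≈ y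
  nat-cancel n {x} {y} eq = begin
    x                    ≈⟨ expand x ⟩
    c * (nat (suc n) * x) ≈⟨ *-congˡ eq ⟩
    c * (nat (suc n) * y) ≈⟨ expand y ⟨
    y                    ∎
    where
    c = ν (ℤ.+ 1 ℚ./ suc n)
    expand : ∀ z → z ≈ c * (nat (suc n) * z)
    expand z = begin
      z                     ≈⟨ *-identityˡ z ⟨
      1# * z                ≈⟨ *-congʳ (nat-inverse n) ⟨
      c * nat (suc n) * z   ≈⟨ *-assoc _ _ _ ⟩
      c * (nat (suc n) * z) ∎

-- Formal power series

module Sequences (A : ℚ-Algebra) where

  open ℚ-Algebra A
  open CommutativeRing commutativeRing
  open ℚ-AlgebraProperties A
  open import Algebra.Properties.CommutativeMonoid.Sum +-commutativeMonoid using (sum)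
  open import Relation.Binary.Reasoning.Setoid setoid
  open Solver using (solve; _:+_; _:*_; _:=_)

  opaque

    ∑ : ℕ → (ℕ → Carrier) → Carrier
    ∑ n g = sum {n} (λ i → g (toℕ i))

    ∑-cong : ∀ n {g g′} → (∀ i → i < n → g i ≈ g′ i) → ∑ n g ≈ ∑ n g′
    ∑-cong zero    e = refl
    ∑-cong (suc n) e = +-cong (e 0 (s≤s z≤n)) (∑-cong n (λ i i<n → e (suc i) (s≤s i<n)))

    ∑-zero : ∀ n {g} → (∀ i → i < n → g i ≈ 0#) → ∑ n g ≈ 0#
    ∑-zero zero    e = refl
    ∑-zero (suc n) e = trans (+-cong (e 0 (s≤s z≤n)) (∑-zero n (λ i i<n → e (suc i) (s≤s i<n)))) (+-identityˡ 0#)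

    ∑-+ : ∀ n g g′ → ∑ n (λ i → g i + g′ i) ≈ ∑ n g + ∑ n g′
    ∑-+ zero    g g′ = sym (+-identityˡ 0#)
    ∑-+ (suc n) g g′ = trans (+-congˡ (∑-+ n (g ∘ suc) (g′ ∘ suc)))
      (solve 4 (λ a b c d → (a :+ b) :+ (c :+ d) := (a :+ c) :+ (b :+ d)) refl _ _ _ _)

    ∑-* : ∀ n x g → ∑ n (λ i → x * g i) ≈ x * ∑ n g
    ∑-* zero    x g = sym (zeroʳ x)
    ∑-* (suc n) x g = trans (+-congˡ (∑-* n x (g ∘ suc))) (sym (distribˡ x _ _))

    ∑-++ : ∀ m n g → ∑ (m ℕ.+ n) g ≈ ∑ m g + ∑ n (λ i → g (m ℕ.+ i))
    ∑-++ zero    n g = sym (+-identityˡ _)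
    ∑-++ (suc m) n g = trans (+-congˡ (∑-++ m n (g ∘ suc))) (sym (+-assoc _ _ _))

    ∑-extend : ∀ {m n} g → m ≤ n → (∀ i → m ≤ i → g i ≈ 0#) → ∑ n g ≈ ∑ m g
    ∑-extend {n = n} g z≤n       e = ∑-zero n (λ i _ → e i z≤n)
    ∑-extend         g (s≤s m≤n) e = +-congˡ (∑-extend (g ∘ suc) m≤n (λ i m≤i → e (suc i) (s≤s m≤i)))

    ∑-zero′ : ∀ g → ∑ 0 g ≈ 0#
    ∑-zero′ g = refl

    ∑-suc : ∀ n g → ∑ (suc n) g ≈ g 0 + ∑ n (g ∘ suc)
    ∑-suc n g = refl

    ∑≈sum : ∀ n g → ∑ n g ≈ sum {n} (λ i → g (toℕ i))
    ∑≈sum n g = refl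

  infixl 7 _⋆_
  opaque
    _⋆_ : (ℕ → Carrier) → (ℕ → Carrier) → ℕ → Carrier
    (a ⋆ b) n = ∑ (suc n) (λ i → a i * b (n ∸ i))

    ⋆-∑ : ∀ a b n → (a ⋆ b) n ≈ ∑ (suc n) (λ i → a i * b (n ∸ i))
    ⋆-∑ a b n = refl

  ⋆-zero : ∀ a b → (a ⋆ b) 0 ≈ a 0 * b 0
  ⋆-zero a b = trans (⋆-∑ a b 0) (trans (∑-suc 0 _) (trans (+-congˡ (∑-zero′ _)) (+-identityʳ _)))

  ⋆-suc : ∀ a b n → (a ⋆ b) (suc n) ≈ a 0 * b (suc n) + (a ∘ suc ⋆ b) n
  ⋆-suc a b n = trans (⋆-∑ a b (suc n)) (trans (∑-suc (suc n) _) (+-congˡ (sym (⋆-∑ (a ∘ suc) b n))))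

  one : ℕ → Carrier
  one zero    = 1#
  one (suc _) = 0#

  ⋆-cong : ∀ {a a′ b b′} n → (∀ i → i ≤ n → a i ≈ a′ i) → (∀ i → i ≤ n → b i ≈ b′ i) → (a ⋆ b) n ≈ (a′ ⋆ b′) n
  ⋆-cong n e e′ = trans (⋆-∑ _ _ n) (trans
    (∑-cong (suc n) (λ { i (s≤s i≤n) → *-cong (e i i≤n) (e′ (n ∸ i) (ℕₚ.m∸n≤m n i)) })) (sym (⋆-∑ _ _ n)))

  ⋆-congˡ : ∀ {a b b′} n → (∀ i → i ≤ n → b i ≈ b′ i) → (a ⋆ b) n ≈ (a ⋆ b′) n
  ⋆-congˡ n = ⋆-cong n (λ _ _ → refl)

  ⋆-congʳ : ∀ {a a′ b} n → (∀ i → i ≤ n → a i ≈ a′ i) → (a ⋆ b) n ≈ (a′ ⋆ b) n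
  ⋆-congʳ n e = ⋆-cong n e (λ _ _ → refl)

  ⋆-+ˡ : ∀ a a′ b n → ((λ i → a i + a′ i) ⋆ b) n ≈ (a ⋆ b) n + (a′ ⋆ b) n
  ⋆-+ˡ a a′ b n = trans (⋆-∑ _ _ n) (trans (∑-cong (suc n) (λ i _ → distribʳ _ _ _))
    (trans (∑-+ (suc n) _ _) (sym (+-cong (⋆-∑ a b n) (⋆-∑ a′ b n)))))

  ⋆-+ʳ : ∀ a b b′ n → (a ⋆ (λ i → b i + b′ i)) n ≈ (a ⋆ b) n + (a ⋆ b′) n
  ⋆-+ʳ a b b′ n = trans (⋆-∑ _ _ n) (trans (∑-cong (suc n) (λ i _ → distribˡ _ _ _))
    (trans (∑-+ (suc n) _ _) (sym (+-cong (⋆-∑ a b n) (⋆-∑ a b′ n)))))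

  ⋆-*ʳ : ∀ x a b n → (a ⋆ (λ i → x * b i)) n ≈ x * (a ⋆ b) n
  ⋆-*ʳ x a b n = trans (⋆-∑ _ _ n) (trans
    (∑-cong (suc n) (λ i _ → solve 3 (λ x a b → a :* (x :* b) := x :* (a :* b)) refl x (a i) (b (n ∸ i))))
    (trans (∑-* (suc n) x _) (*-congˡ (sym (⋆-∑ a b n)))))

  ⋆-zeroʳ : ∀ a b n → (∀ i → b i ≈ 0#) → (a ⋆ b) n ≈ 0#
  ⋆-zeroʳ a b n e = trans (⋆-∑ _ _ n) (∑-zero (suc n) (λ i _ → trans (*-congˡ (e _)) (zeroʳ _)))

  ⋆-∑ʳ : ∀ N a (c : ℕ → Carrier) (P : ℕ → ℕ → Carrier) n →
    (a ⋆ (λ m → ∑ N (λ j → c j * P j m))) n ≈ ∑ N (λ j → c j * (a ⋆ P j) n)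
  ⋆-∑ʳ zero    a c P n = trans (⋆-zeroʳ a _ n (λ _ → ∑-zero′ _)) (sym (∑-zero′ _))
  ⋆-∑ʳ (suc N) a c P n = trans (⋆-congˡ n (λ m _ → ∑-suc N (λ j → c j * P j m)))
    (trans (⋆-+ʳ a _ _ n) (trans (+-cong (⋆-*ʳ (c 0) a (P 0) n) (⋆-∑ʳ N a (c ∘ suc) (P ∘ suc) n))
      (sym (∑-suc N _))))

  -- Both sides are unfolded at the heads of a and b and the tails are exchanged by recursion on the
  -- index. Together with the unit `one`, this single law gives commutativity.
  ⋆-leftComm : ∀ a b c n → (a ⋆ (b ⋆ c)) n ≈ (b ⋆ (a ⋆ c)) n
  ⋆-leftComm a b c zero = trans (expand a b c) (trans
    (solve 3 (λ a b c → a :* (b :* c) := b :* (a :* c)) refl (a 0) (b 0) (c 0)) (sym (expand b a c)))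
    where
    expand : ∀ a b c → (a ⋆ (b ⋆ c)) 0 ≈ a 0 * (b 0 * c 0)
    expand a b c = trans (⋆-zero _ _) (*-congˡ (⋆-zero b c))
  ⋆-leftComm a b c (suc n) = begin
    (a ⋆ (b ⋆ c)) (suc n)
      ≈⟨ trans (⋆-suc _ _ n) (+-congʳ (*-congˡ (⋆-suc b c n))) ⟩
    a 0 * (b 0 * c (suc n) + (b ∘ suc ⋆ c) n) + (a ∘ suc ⋆ (b ⋆ c)) n
      ≈⟨ +-congˡ (⋆-leftComm (a ∘ suc) b c n) ⟩
    a 0 * (b 0 * c (suc n) + (b ∘ suc ⋆ c) n) + (b ⋆ (a ∘ suc ⋆ c)) n
      ≈⟨ solve 5 (λ a b c x y → a :* (b :* c :+ x) :+ y := b :* (a :* c) :+ (a :* x :+ y)) refl (a 0) (b 0) (c (suc n)) ((b ∘ suc ⋆ c) n) ((b ⋆ (a ∘ suc ⋆ c)) n) ⟩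
    b 0 * (a 0 * c (suc n)) + (a 0 * (b ∘ suc ⋆ c) n + (b ⋆ (a ∘ suc ⋆ c)) n)
      ≈⟨ +-congˡ (exchange n) ⟩
    b 0 * (a 0 * c (suc n)) + (b 0 * (a ∘ suc ⋆ c) n + (a ⋆ (b ∘ suc ⋆ c)) n)
      ≈⟨ solve 5 (λ a b c x y → b :* (a :* c) :+ (b :* x :+ y) := b :* (a :* c :+ x) :+ y) refl (a 0) (b 0) (c (suc n)) ((a ∘ suc ⋆ c) n) ((a ⋆ (b ∘ suc ⋆ c)) n) ⟩
    b 0 * (a 0 * c (suc n) + (a ∘ suc ⋆ c) n) + (a ⋆ (b ∘ suc ⋆ c)) n
      ≈⟨ +-congˡ (⋆-leftComm a (b ∘ suc) c n) ⟩
    b 0 * (a 0 * c (suc n) + (a ∘ suc ⋆ c) n) + (b ∘ suc ⋆ (a ⋆ c)) n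
      ≈⟨ trans (⋆-suc _ _ n) (+-congʳ (*-congˡ (⋆-suc a c n))) ⟨
    (b ⋆ (a ⋆ c)) (suc n) ∎
    where
    exchange : ∀ n → a 0 * (b ∘ suc ⋆ c) n + (b ⋆ (a ∘ suc ⋆ c)) n ≈ b 0 * (a ∘ suc ⋆ c) n + (a ⋆ (b ∘ suc ⋆ c)) n
    exchange zero    = trans (+-congˡ (⋆-zero _ _)) (trans (+-comm _ _) (+-congˡ (sym (⋆-zero _ _))))
    exchange (suc m) = trans (+-congˡ (trans (⋆-suc _ _ m) (+-congˡ (⋆-leftComm (b ∘ suc) (a ∘ suc) c m))))
      (trans (solve 3 (λ x y z → x :+ (y :+ z) := y :+ (x :+ z)) refl _ _ _) (+-congˡ (sym (⋆-suc _ _ m))))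

  ⋆-identityʳ : ∀ a n → (a ⋆ one) n ≈ a n
  ⋆-identityʳ a zero    = trans (⋆-zero a one) (*-identityʳ _)
  ⋆-identityʳ a (suc n) = trans (⋆-suc a one n) (trans (+-cong (zeroʳ _) (⋆-identityʳ (a ∘ suc) n)) (+-identityˡ _))

  ⋆-comm : ∀ a b n → (a ⋆ b) n ≈ (b ⋆ a) n
  ⋆-comm a b n = begin
    (a ⋆ b) n         ≈⟨ ⋆-congˡ n (λ i _ → ⋆-identityʳ b i) ⟨
    (a ⋆ (b ⋆ one)) n ≈⟨ ⋆-leftComm a b one n ⟩
    (b ⋆ (a ⋆ one)) n ≈⟨ ⋆-congˡ n (λ i _ → ⋆-identityʳ a i) ⟩
    (b ⋆ a) n         ∎

  -- The Euler operator u d/du on coefficients; unlike d/du it keeps the index.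
  ∂ : (ℕ → Carrier) → ℕ → Carrier
  ∂ a n = nat n * a n

  ∂-⋆ : ∀ a b n → ∂ (a ⋆ b) n ≈ (∂ a ⋆ b) n + (a ⋆ ∂ b) n
  ∂-⋆ a b n = begin
    nat n * (a ⋆ b) n
      ≈⟨ trans (∑-* (suc n) (nat n) _) (*-congˡ (sym (⋆-∑ a b n))) ⟨
    ∑ (suc n) (λ i → nat n * (a i * b (n ∸ i)))
      ≈⟨ ∑-cong (suc n) (λ { i (s≤s i≤n) → trans
           (*-congʳ (trans (reflexive (≡.cong nat (≡.sym (ℕₚ.m+[n∸m]≡n i≤n)))) (nat-+ i (n ∸ i))))
           (solve 4 (λ k l x y → (k :+ l) :* (x :* y) := k :* x :* y :+ x :* (l :* y)) refl (nat i) (nat (n ∸ i)) (a i) (b (n ∸ i))) }) ⟩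
    ∑ (suc n) (λ i → ∂ a i * b (n ∸ i) + a i * ∂ b (n ∸ i))
      ≈⟨ trans (∑-+ (suc n) _ _) (+-cong (sym (⋆-∑ (∂ a) b n)) (sym (⋆-∑ a (∂ b) n))) ⟩
    (∂ a ⋆ b) n + (a ⋆ ∂ b) n ∎

  -- a = a₀ exp(Σ_{k ≥ 1} pₖ uᵏ / k).
  Newton : (ℕ → Carrier) → (ℕ → Carrier) → Set
  Newton p a = ∀ n → ∂ a n ≈ (p ⋆ a) n

  newton-⋆ : ∀ {p q a b} → Newton p a → Newton q b → Newton (λ i → p i + q i) (a ⋆ b)
  newton-⋆ {p} {q} {a} {b} na nb n = begin
    ∂ (a ⋆ b) n                       ≈⟨ ∂-⋆ a b n ⟩
    (∂ a ⋆ b) n + (a ⋆ ∂ b) n         ≈⟨ +-cong (⋆-cong n (λ i _ → na i) (λ _ _ → refl)) (⋆-congˡ n (λ i _ → nb i)) ⟩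
    ((p ⋆ a) ⋆ b) n + (a ⋆ (q ⋆ b)) n ≈⟨ +-cong (trans (⋆-comm (p ⋆ a) b n) (⋆-leftComm b p a n)) (⋆-leftComm a q b n) ⟩
    (p ⋆ (b ⋆ a)) n + (q ⋆ (a ⋆ b)) n ≈⟨ +-congʳ (⋆-congˡ n (λ i _ → ⋆-comm b a i)) ⟩
    (p ⋆ (a ⋆ b)) n + (q ⋆ (a ⋆ b)) n ≈⟨ ⋆-+ˡ p q (a ⋆ b) n ⟨
    ((λ i → p i + q i) ⋆ (a ⋆ b)) n   ∎

  -- As p₀ = 0, the identity at n + 1 expresses (n + 1) a_{n+1} through a_0, ..., a_n, and n + 1 can
  -- be cancelled. Identities between the series Ω[uA] thus reduce to identities between power sums.
  newton-unique : ∀ {p q a b} → p 0 ≈ 0# → (∀ n → p n ≈ q n) → a 0 ≈ b 0 → Newton p a → Newton q b → ∀ n → a n ≈ b n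
  newton-unique {p} {q} {a} {b} p₀ p≈q a₀≈b₀ na nb n = below n n ℕₚ.≤-refl
    where
    below : ∀ n m → m ≤ n → a m ≈ b m
    below n       zero    _         = a₀≈b₀
    below (suc n) (suc m) (s≤s m≤n) = nat-cancel m (begin
      nat (suc m) * a (suc m)                 ≈⟨ trans (na (suc m)) (⋆-suc p a m) ⟩
      p 0 * a (suc m) + (p ∘ suc ⋆ a) m       ≈⟨ +-cong (trans (*-congʳ p₀) (zeroˡ _)) (⋆-cong m (λ i _ → p≈q (suc i)) (λ i i≤m → below n i (ℕₚ.≤-trans i≤m m≤n))) ⟩
      0# + (q ∘ suc ⋆ b) m                    ≈⟨ +-congʳ (trans (*-congʳ (trans (sym (p≈q 0)) p₀)) (zeroˡ _)) ⟨
      q 0 * b (suc m) + (q ∘ suc ⋆ b) m       ≈⟨ trans (nb (suc m)) (⋆-suc q b m) ⟨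
      nat (suc m) * b (suc m)                 ∎)

-- Determinants

-- Serves to compare the minors without column j and without column j + 1: they differ only in which
-- of the two columns survives.
punchIn-adjacent : ∀ {n} (j : Fin n) b → punchIn (inject₁ j) b ≡ punchIn (suc j) b
  ⊎ punchIn (inject₁ j) b ≡ suc j × punchIn (suc j) b ≡ inject₁ j
punchIn-adjacent zero    zero    = inj₂ (≡.refl , ≡.refl)
punchIn-adjacent zero    (suc b) = inj₁ ≡.refl
punchIn-adjacent (suc j) zero    = inj₁ ≡.refl
punchIn-adjacent (suc j) (suc b) with punchIn-adjacent j b
... | inj₁ eq         = inj₁ (≡.cong suc eq)
... | inj₂ (eq , eq′) = inj₂ (≡.cong suc eq , ≡.cong suc eq′)

adjacent-preimage : ∀ {n} (b : Fin (suc (suc n))) (j : Fin (suc n)) → b ≢ inject₁ j → b ≢ suc j →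
  ∃[ j′ ] punchIn b (inject₁ j′) ≡ inject₁ j × punchIn b (suc j′) ≡ suc j
adjacent-preimage zero            zero    b≢j _    = contradiction ≡.refl b≢j
adjacent-preimage zero            (suc j) _   _    = j , ≡.refl , ≡.refl
adjacent-preimage (suc zero)      zero    _   b≢1+j = contradiction ≡.refl b≢1+j
adjacent-preimage {suc n} (suc (suc b)) zero _ _   = zero , ≡.refl , ≡.refl
adjacent-preimage {suc n} (suc b) (suc j) b≢j b≢1+j with adjacent-preimage b j (b≢j ∘ ≡.cong suc) (b≢1+j ∘ ≡.cong suc)
... | j′ , eq , eq′ = suc j′ , ≡.cong suc eq , ≡.cong suc eq′

module Determinant (R : CommutativeRing 0ℓ 0ℓ) where

  open CommutativeRing R hiding (zero)
  open Algebra.Properties.Semiring.Exp semiring using (_^_)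
  open Algebra.Properties.CommutativeMonoid.Sum +-commutativeMonoid using (sum)
  open import Algebra.Properties.Ring ring using (-‿distribˡ-*)
  open import Relation.Binary.Reasoning.Setoid setoid

  sum-cong : ∀ {n} {f g : Fin n → Carrier} → (∀ i → f i ≈ g i) → sum f ≈ sum g
  sum-cong {zero}  e = refl
  sum-cong {suc n} e = +-cong (e zero) (sum-cong (e ∘ suc))

  sum-zero : ∀ {n} {f : Fin n → Carrier} → (∀ i → f i ≈ 0#) → sum f ≈ 0#
  sum-zero {zero}  e = refl
  sum-zero {suc n} e = trans (+-cong (e zero) (sum-zero (e ∘ suc))) (+-identityˡ 0#)

  sum-linear : ∀ {n} c (f g : Fin n → Carrier) → sum (λ i → f i + c * g i) ≈ sum f + c * sum g
  sum-linear {zero}  c f g = sym (trans (+-identityˡ _) (zeroʳ c))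
  sum-linear {suc n} c f g = begin
    (f zero + c * g zero) + sum (λ i → f (suc i) + c * g (suc i))        ≈⟨ +-congˡ (sum-linear c (f ∘ suc) (g ∘ suc)) ⟩
    (f zero + c * g zero) + (sum (f ∘ suc) + c * sum (g ∘ suc))          ≈⟨ +-assoc _ _ _ ⟩
    f zero + (c * g zero + (sum (f ∘ suc) + c * sum (g ∘ suc)))          ≈⟨ +-congˡ (trans (sym (+-assoc _ _ _)) (trans (+-congʳ (+-comm _ _)) (+-assoc _ _ _))) ⟩
    f zero + (sum (f ∘ suc) + (c * g zero + c * sum (g ∘ suc)))          ≈⟨ +-congˡ (+-congˡ (distribˡ c _ _)) ⟨
    f zero + (sum (f ∘ suc) + c * sum g)                                 ≈⟨ +-assoc _ _ _ ⟨
    sum f + c * sum g                                                    ∎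

  sum-cancel : ∀ {n} (f : Fin (suc n) → Carrier) (j : Fin n) → f (inject₁ j) + f (suc j) ≈ 0# →
    (∀ b → b ≢ inject₁ j → b ≢ suc j → f b ≈ 0#) → sum f ≈ 0#
  sum-cancel f zero    e e′ = trans (sym (+-assoc _ _ _)) (trans
    (+-cong e (sum-zero (λ b → e′ (suc (suc b)) (λ ()) (λ ())))) (+-identityˡ 0#))
  sum-cancel f (suc j) e e′ = trans (+-cong (e′ zero (λ ()) (λ ()))
    (sum-cancel (f ∘ suc) j e (λ b b≢ b≢′ → e′ (suc b) (b≢ ∘ Finₚ.suc-injective) (b≢′ ∘ Finₚ.suc-injective)))) (+-identityˡ 0#)

  -- The same Laplace expansion over an arbitrary ring, because the Jacobi-Trudi argument takes a
  -- determinant over Λ[u, d].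
  det : ∀ {n} → (Fin n → Fin n → Carrier) → Carrier
  det {zero}  M = 1#
  det {suc n} M = sum (λ j → (- 1#) ^ toℕ j * (M zero j * det (λ a b → M (suc a) (punchIn j b))))

  cofactor : ∀ {n} → (Fin (suc n) → Fin (suc n) → Carrier) → Fin (suc n) → Carrier
  cofactor M j = (- 1#) ^ toℕ j * (M zero j * det (λ a b → M (suc a) (punchIn j b)))

  det-cong : ∀ {n} {M N : Fin n → Fin n → Carrier} → (∀ a b → M a b ≈ N a b) → det M ≈ det N
  det-cong {zero}  e = refl
  det-cong {suc n} {M} {N} e = sum-cong {f = cofactor M} {cofactor N} (λ j → *-congˡ (*-cong (e zero j) (det-cong (λ a b → e (suc a) (punchIn j b)))))

  -- In the expansion along the first row, the term of column j is linear through its entry and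
  -- every other term through its minor.
  det-linear : ∀ {n} {M N P : Fin n → Fin n → Carrier} c j →
    (∀ a b → b ≢ j → M a b ≈ N a b) → (∀ a b → b ≢ j → P a b ≈ N a b) →
    (∀ a → M a j ≈ N a j + c * P a j) → det M ≈ det N + c * det P
  det-linear {suc n} {M} {N} {P} c j MN PN Mj = trans (sum-cong {f = cofactor M} term) (sum-linear c (cofactor N) (cofactor P))
    where
    minor : (Fin (suc n) → Fin (suc n) → Carrier) → Fin (suc n) → Fin n → Fin n → Carrier
    minor M b a b′ = M (suc a) (punchIn b b′)
    sign : Fin (suc n) → Carrier
    sign b = (- 1#) ^ toℕ b
    term : ∀ b → sign b * (M zero b * det (minor M b)) ≈ sign b * (N zero b * det (minor N b)) + c * (sign b * (P zero b * det (minor P b)))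
    term b with b Finₚ.≟ j
    ... | yes ≡.refl = begin
      sign j * (M zero j * det (minor M j))
        ≈⟨ *-congˡ (*-cong (Mj zero) (det-cong (λ a b′ → MN (suc a) _ (Finₚ.punchInᵢ≢i j b′)))) ⟩
      sign j * ((N zero j + c * P zero j) * det (minor N j))
        ≈⟨ trans (*-congˡ (distribʳ _ _ _)) (distribˡ _ _ _) ⟩
      sign j * (N zero j * det (minor N j)) + sign j * (c * P zero j * det (minor N j))
        ≈⟨ +-congˡ (trans (*-congˡ (*-assoc _ _ _)) (trans (sym (*-assoc _ _ _)) (trans (*-congʳ (*-comm _ _)) (trans (*-assoc _ _ _)
             (*-congˡ (*-congˡ (*-congˡ (det-cong (λ a b′ → sym (PN (suc a) _ (Finₚ.punchInᵢ≢i j b′))))))))))) ⟩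
      sign j * (N zero j * det (minor N j)) + c * (sign j * (P zero j * det (minor P j))) ∎
    ... | no b≢j = begin
      sign b * (M zero b * det (minor M b))
        ≈⟨ *-congˡ (*-cong (MN zero b b≢j) (det-linear c (punchOut b≢j) (λ a b′ b′≢ → MN (suc a) _ (other b′ b′≢)) (λ a b′ b′≢ → PN (suc a) _ (other b′ b′≢))
             (λ a → ≡.subst (λ z → M (suc a) z ≈ N (suc a) z + c * P (suc a) z) (≡.sym (Finₚ.punchIn-punchOut b≢j)) (Mj (suc a))))) ⟩
      sign b * (N zero b * (det (minor N b) + c * det (minor P b)))
        ≈⟨ trans (*-congˡ (distribˡ _ _ _)) (distribˡ _ _ _) ⟩
      sign b * (N zero b * det (minor N b)) + sign b * (N zero b * (c * det (minor P b)))
        ≈⟨ +-congˡ (trans (*-congˡ (trans (sym (*-assoc _ _ _)) (trans (*-congʳ (trans (*-congʳ (sym (PN zero b b≢j))) (*-comm _ _))) (*-assoc _ _ _))))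
             (trans (sym (*-assoc _ _ _)) (trans (*-congʳ (*-comm _ _)) (*-assoc _ _ _)))) ⟩
      sign b * (N zero b * det (minor N b)) + c * (sign b * (P zero b * det (minor P b))) ∎
      where
      other : ∀ b′ → b′ ≢ punchOut b≢j → punchIn b b′ ≢ j
      other b′ b′≢ eq = b′≢ (Finₚ.punchIn-injective b b′ (punchOut b≢j) (≡.trans eq (≡.sym (Finₚ.punchIn-punchOut b≢j))))

  -- The terms of the two equal columns have equal entries and minors but opposite signs. Every
  -- other minor still contains the two columns side by side and vanishes by recursion.
  det-adjacent : ∀ {n} {M : Fin (suc n) → Fin (suc n) → Carrier} (j : Fin n) →
    (∀ a → M a (inject₁ j) ≈ M a (suc j)) → det M ≈ 0#
  det-adjacent {suc n} {M} j e = sum-cancel (cofactor M) j opposite vanish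
    where
    vanish : ∀ b → b ≢ inject₁ j → b ≢ suc j → cofactor M b ≈ 0#
    vanish b b≢ b≢′ with adjacent-preimage b j b≢ b≢′
    ... | j′ , eq , eq′ = trans (*-congˡ (trans (*-congˡ (det-adjacent {M = λ a b′ → M (suc a) (punchIn b b′)} j′
      (λ a → trans (reflexive (≡.cong (M (suc a)) eq)) (trans (e (suc a)) (reflexive (≡.cong (M (suc a)) (≡.sym eq′))))))) (zeroʳ _))) (zeroʳ _)
    minors : ∀ a b → M (suc a) (punchIn (inject₁ j) b) ≈ M (suc a) (punchIn (suc j) b)
    minors a b with punchIn-adjacent j b
    ... | inj₁ eq         = reflexive (≡.cong (M (suc a)) eq)
    ... | inj₂ (eq , eq′) = trans (reflexive (≡.cong (M (suc a)) eq)) (trans (sym (e (suc a))) (reflexive (≡.cong (M (suc a)) (≡.sym eq′))))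
    opposite : cofactor M (inject₁ j) + cofactor M (suc j) ≈ 0#
    opposite = begin
      (- 1#) ^ toℕ (inject₁ j) * (M zero (inject₁ j) * det (λ a b → M (suc a) (punchIn (inject₁ j) b))) + - 1# * (- 1#) ^ toℕ j * D
        ≈⟨ +-cong (*-cong (reflexive (≡.cong ((- 1#) ^_) (Finₚ.toℕ-inject₁ j))) (*-cong (e zero) (det-cong minors)))
             (trans (*-congʳ (trans (sym (-‿distribˡ-* _ _)) (-‿cong (*-identityˡ _)))) (sym (-‿distribˡ-* _ _))) ⟩
      (- 1#) ^ toℕ j * D + - ((- 1#) ^ toℕ j * D)
        ≈⟨ -‿inverseʳ _ ⟩
      0# ∎
      where
      D = M zero (suc j) * det (λ a b → M (suc a) (punchIn (suc j) b))

  det-addColumn : ∀ {n} {M N : Fin (suc n) → Fin (suc n) → Carrier} c (j : Fin n) →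
    (∀ a b → b ≢ suc j → M a b ≈ N a b) → (∀ a → M a (suc j) ≈ N a (suc j) + c * N a (inject₁ j)) → det M ≈ det N
  det-addColumn {n} {M} {N} c j MN Mj = begin
    det M             ≈⟨ det-linear {M = M} {N} {P} c (suc j) MN (λ a b b≢ → P-other a b b≢ (b Finₚ.≟ suc j)) (λ a → trans (Mj a) (+-congˡ (*-congˡ (sym (P-j a (suc j Finₚ.≟ suc j)))))) ⟩
    det N + c * det P ≈⟨ +-congˡ (trans (*-congˡ (det-adjacent {M = P} j (λ a → trans (P-other a (inject₁ j) inject₁≢suc (inject₁ j Finₚ.≟ suc j)) (sym (P-j a (suc j Finₚ.≟ suc j)))))) (zeroʳ c)) ⟩
    det N + 0#        ≈⟨ +-identityʳ _ ⟩
    det N             ∎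
    where
    column : ∀ {b} → Dec (b ≡ suc j) → Fin (suc n)
    column     (yes _) = inject₁ j
    column {b} (no _)  = b
    P : Fin (suc n) → Fin (suc n) → Carrier
    P a b = N a (column (b Finₚ.≟ suc j))
    P-other : ∀ a b → b ≢ suc j → (d : Dec (b ≡ suc j)) → N a (column d) ≈ N a b
    P-other a b b≢ (yes eq) = contradiction eq b≢
    P-other a b b≢ (no _)   = refl
    P-j : ∀ a (d : Dec (suc j ≡ suc j)) → N a (column d) ≈ N a (inject₁ j)
    P-j a (yes _) = refl
    P-j a (no ¬r) = contradiction ≡.refl ¬r
    inject₁≢suc : inject₁ j ≢ suc j
    inject₁≢suc eq = ℕₚ.1+n≢n (≡.trans (≡.sym (≡.cong toℕ eq)) (Finₚ.toℕ-inject₁ j))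

  -- Working from the right, each column is changed while its left neighbour is still unchanged.
  det-addColumns : ∀ {n} (M N : Fin (suc n) → Fin (suc n) → Carrier) c →
    (∀ a → M a zero ≈ N a zero) → (∀ a j → M a (suc j) ≈ N a (suc j) + c * N a (inject₁ j)) → det M ≈ det N
  det-addColumns {n} M N c M0 Mj = trans (det-cong initial) (trans (descend n ℕₚ.≤-refl) (det-cong last))
    where
    entry : ∀ m a (j : Fin n) → Dec (m ≤ toℕ j) → Carrier
    entry m a j (yes _) = N a (suc j) + c * N a (inject₁ j)
    entry m a j (no _)  = N a (suc j)
    stage : ℕ → Fin (suc n) → Fin (suc n) → Carrier
    stage m a zero    = N a zero
    stage m a (suc j) = entry m a j (m ℕₚ.≤? toℕ j)
    entry-yes : ∀ {m} a j (d : Dec (m ≤ toℕ j)) → m ≤ toℕ j → entry m a j d ≡ N a (suc j) + c * N a (inject₁ j)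
    entry-yes a j (yes _) _   = ≡.refl
    entry-yes a j (no ≰j) m≤j = contradiction m≤j ≰j
    entry-no : ∀ {m} a j (d : Dec (m ≤ toℕ j)) → toℕ j < m → entry m a j d ≡ N a (suc j)
    entry-no a j (yes m≤j) j<m = contradiction m≤j (ℕₚ.<⇒≱ j<m)
    entry-no a j (no _)    _   = ≡.refl
    initial : ∀ a b → M a b ≈ stage 0 a b
    initial a zero    = M0 a
    initial a (suc j) = trans (Mj a j) (reflexive (≡.sym (entry-yes a j (0 ℕₚ.≤? toℕ j) z≤n)))
    last : ∀ a b → stage n a b ≈ N a b
    last a zero    = refl
    last a (suc j) = reflexive (entry-no a j (n ℕₚ.≤? toℕ j) (Finₚ.toℕ<n j))
    stage-≤ : ∀ m a b → toℕ b ≤ m → stage m a b ≈ N a b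
    stage-≤ m a zero    _   = refl
    stage-≤ m a (suc j) j<m = reflexive (entry-no a j (m ℕₚ.≤? toℕ j) j<m)
    step : ∀ j → det (stage (toℕ j)) ≈ det (stage (suc (toℕ j)))
    step j = det-addColumn c j others
      (λ a → trans (reflexive (entry-yes a j (toℕ j ℕₚ.≤? toℕ j) ℕₚ.≤-refl)) (+-cong (sym (stage-≤ _ a (suc j) ℕₚ.≤-refl))
        (*-congˡ (sym (stage-≤ _ a (inject₁ j) (ℕₚ.≤-trans (ℕₚ.≤-reflexive (Finₚ.toℕ-inject₁ j)) (ℕₚ.n≤1+n _)))))))
      where
      others : ∀ a b → b ≢ suc j → stage (toℕ j) a b ≈ stage (suc (toℕ j)) a b
      others a zero    _ = refl
      others a (suc i) i≢j with suc (toℕ j) ℕₚ.≤? toℕ i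
      ... | yes j<i = reflexive (≡.trans (entry-yes a i (toℕ j ℕₚ.≤? toℕ i) (ℕₚ.<⇒≤ j<i)) ≡.refl)
      ... | no j≮i  = reflexive (entry-no a i (toℕ j ℕₚ.≤? toℕ i)
        (ℕₚ.≤∧≢⇒< (ℕₚ.≮⇒≥ j≮i) (λ eq → i≢j (≡.cong suc (Finₚ.toℕ-injective eq)))))
    descend : ∀ m → m ≤ n → det (stage 0) ≈ det (stage m)
    descend zero    _   = refl
    descend (suc m) m<n = trans (descend m (ℕₚ.<⇒≤ m<n))
      (≡.subst (λ k → det (stage k) ≈ det (stage (suc k))) (Finₚ.toℕ-fromℕ< m<n) (step (Fin.fromℕ< m<n)))

-- Ring homomorphisms applied to determinants and power series

record RingMap (R S : CommutativeRing 0ℓ 0ℓ) : Set where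
  private
    module R = CommutativeRing R
    module S = CommutativeRing S
  field
    φ      : R.Carrier → S.Carrier
    φ-cong : ∀ {x y} → x R.≈ y → φ x S.≈ φ y
    φ-+    : ∀ x y → φ (x R.+ y) S.≈ φ x S.+ φ y
    φ-*    : ∀ x y → φ (x R.* y) S.≈ φ x S.* φ y
    φ-neg  : ∀ x → φ (R.- x) S.≈ S.- φ x
    φ-0    : φ R.0# S.≈ S.0#
    φ-1    : φ R.1# S.≈ S.1#

module DeterminantHomomorphism {R S : CommutativeRing 0ℓ 0ℓ} (m : RingMap R S) where

  private
    module R = CommutativeRing R
    module S = CommutativeRing S
  open RingMap m

  private
    module DR = Determinant R
    module DS = Determinant S
    module ER = Algebra.Properties.Semiring.Exp R.semiring
    module ES = Algebra.Properties.Semiring.Exp S.semiring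
    module MR = Algebra.Properties.CommutativeMonoid.Sum R.+-commutativeMonoid
    module MS = Algebra.Properties.CommutativeMonoid.Sum S.+-commutativeMonoid

  φ-sum : ∀ {n} (f : Fin n → R.Carrier) → φ (MR.sum f) S.≈ MS.sum (φ ∘ f)
  φ-sum {zero}  f = φ-0
  φ-sum {suc n} f = S.trans (φ-+ _ _) (S.+-congˡ (φ-sum (f ∘ suc)))

  φ-sign : ∀ n → φ ((R.- R.1#) ER.^ n) S.≈ (S.- S.1#) ES.^ n
  φ-sign zero    = φ-1
  φ-sign (suc n) = S.trans (φ-* _ _) (S.*-cong (S.trans (φ-neg _) (S.-‿cong φ-1)) (φ-sign n))

  φ-det : ∀ {n} (M : Fin n → Fin n → R.Carrier) → φ (DR.det M) S.≈ DS.det (λ a b → φ (M a b))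
  φ-det {zero}  M = φ-1
  φ-det {suc n} M = S.trans (φ-sum (DR.cofactor M)) (DS.sum-cong {f = φ ∘ DR.cofactor M} {DS.cofactor (λ a b → φ (M a b))} (λ j → S.trans (φ-* _ _)
    (S.*-cong (φ-sign (toℕ j)) (S.trans (φ-* _ _) (S.*-congˡ (φ-det (λ a b → M (suc a) (punchIn j b))))))))

module SequenceHomomorphism (A B : ℚ-Algebra)
  (m : RingMap (ℚ-Algebra.commutativeRing A) (ℚ-Algebra.commutativeRing B))
  (φ-ν : ∀ q → CommutativeRing._≈_ (ℚ-Algebra.commutativeRing B) (RingMap.φ m (ℚ-Algebra.ν A q)) (ℚ-Algebra.ν B q))
  where

  private
    module A = CommutativeRing (ℚ-Algebra.commutativeRing A)
    module B = CommutativeRing (ℚ-Algebra.commutativeRing B)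
    module AS = Sequences A
    module BS = Sequences B
  open RingMap m

  φ-∑ : ∀ n g → φ (AS.∑ n g) B.≈ BS.∑ n (φ ∘ g)
  φ-∑ zero    g = B.trans (φ-cong (AS.∑-zero′ g)) (B.trans φ-0 (B.sym (BS.∑-zero′ _)))
  φ-∑ (suc n) g = B.trans (φ-cong (AS.∑-suc n g)) (B.trans (φ-+ _ _) (B.trans (B.+-congˡ (φ-∑ n (g ∘ suc))) (B.sym (BS.∑-suc n _))))

  φ-⋆ : ∀ a b n → φ ((a AS.⋆ b) n) B.≈ ((φ ∘ a) BS.⋆ (φ ∘ b)) n
  φ-⋆ a b n = B.trans (φ-cong (AS.⋆-∑ a b n)) (B.trans (φ-∑ (suc n) _) (B.trans (BS.∑-cong (suc n) (λ i _ → φ-* _ _)) (B.sym (BS.⋆-∑ _ _ n))))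

  -- With `newton-unique` this evaluates a homomorphism on the h_n from its values on power sums,
  -- without an explicit formula for h_n.
  φ-newton : ∀ {p a} → AS.Newton p a → BS.Newton (φ ∘ p) (φ ∘ a)
  φ-newton {p} {a} na n = B.trans (B.*-congʳ (B.sym (φ-ν _))) (B.trans (B.sym (φ-* _ _)) (B.trans (φ-cong (na n)) (φ-⋆ p a n)))

open import Defs

-- Maps out of polynomial rings

module PolynomialHomomorphism (R : CommutativeRing 0ℓ 0ℓ) (I : Set) (S : CommutativeRing 0ℓ 0ℓ) where

  private
    module R = CommutativeRing R
    module S = CommutativeRing S
    module P = Polynomial R I

  -- A map that respects the operations inherits the ring laws from S; only the laws about constants
  -- remain to be assumed.
  record IsHomomorphism (φ : P.Poly → S.Carrier) : Set where
    field
      homo-+   : ∀ x y → φ (x P.+ y) S.≈ φ x S.+ φ y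
      homo-*   : ∀ x y → φ (x P.* y) S.≈ φ x S.* φ y
      homo-neg : ∀ x → φ (P.- x) S.≈ S.- φ x
      con-cong : ∀ {a b} → a R.≈ b → φ (P.con a) S.≈ φ (P.con b)
      con-+    : ∀ a b → φ (P.con (a R.+ b)) S.≈ φ (P.con a) S.+ φ (P.con b)
      con-*    : ∀ a b → φ (P.con (a R.* b)) S.≈ φ (P.con a) S.* φ (P.con b)
      con-0    : φ (P.con R.0#) S.≈ S.0#
      con-1    : φ (P.con R.1#) S.≈ S.1#

    cong : ∀ {x y} → x P.≈ y → φ x S.≈ φ y
    cong P.≈-refl              = S.refl
    cong (P.≈-sym e)           = S.sym (cong e)
    cong (P.≈-trans e e′)      = S.trans (cong e) (cong e′)
    cong (P.+-cong e e′)       = S.trans (homo-+ _ _) (S.trans (S.+-cong (cong e) (cong e′)) (S.sym (homo-+ _ _)))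
    cong (P.*-cong e e′)       = S.trans (homo-* _ _) (S.trans (S.*-cong (cong e) (cong e′)) (S.sym (homo-* _ _)))
    cong (P.-‿cong e)          = S.trans (homo-neg _) (S.trans (S.-‿cong (cong e)) (S.sym (homo-neg _)))
    cong (P.+-assoc x y z)     = S.trans (S.trans (homo-+ _ _) (S.+-congʳ (homo-+ _ _)))
      (S.trans (S.+-assoc _ _ _) (S.sym (S.trans (homo-+ _ _) (S.+-congˡ (homo-+ _ _)))))
    cong (P.+-comm x y)        = S.trans (homo-+ _ _) (S.trans (S.+-comm _ _) (S.sym (homo-+ _ _)))
    cong (P.+-identityˡ x)     = S.trans (homo-+ _ _) (S.trans (S.+-congʳ con-0) (S.+-identityˡ _))
    cong (P.-‿inverseˡ x)      = S.trans (homo-+ _ _) (S.trans (S.+-congʳ (homo-neg _)) (S.trans (S.-‿inverseˡ _) (S.sym con-0)))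
    cong (P.*-assoc x y z)     = S.trans (S.trans (homo-* _ _) (S.*-congʳ (homo-* _ _)))
      (S.trans (S.*-assoc _ _ _) (S.sym (S.trans (homo-* _ _) (S.*-congˡ (homo-* _ _)))))
    cong (P.*-comm x y)        = S.trans (homo-* _ _) (S.trans (S.*-comm _ _) (S.sym (homo-* _ _)))
    cong (P.*-identityˡ x)     = S.trans (homo-* _ _) (S.trans (S.*-congʳ con-1) (S.*-identityˡ _))
    cong (P.distribˡ x y z)    = S.trans (S.trans (homo-* _ _) (S.*-congˡ (homo-+ _ _)))
      (S.trans (S.distribˡ _ _ _) (S.sym (S.trans (homo-+ _ _) (S.+-cong (homo-* _ _) (homo-* _ _)))))
    cong (P.con-cong e)        = con-cong e
    cong (P.con-+ a b)         = S.trans (con-+ a b) (S.sym (homo-+ _ _))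
    cong (P.con-* a b)         = S.trans (con-* a b) (S.sym (homo-* _ _))

  ringMap : ∀ {φ} → IsHomomorphism φ → RingMap P.commutativeRing S
  ringMap {φ} φ-isHomomorphism = record
    { φ = φ ; φ-cong = cong ; φ-+ = homo-+ ; φ-* = homo-* ; φ-neg = homo-neg ; φ-0 = con-0 ; φ-1 = con-1 }
    where open IsHomomorphism φ-isHomomorphism

-- The rings ℚ[t], Λ and Λ[u, d]

Kℚ : ℚ-Algebra
Kℚ = record { commutativeRing = ℚ[t]-commutativeRing ; ν = K.con ; ν-+ = K.con-+ ; ν-* = K.con-* ; ν-0 = K.≈-refl ; ν-1 = K.≈-refl }

module Λ′ = Polynomial ℚ[t]-commutativeRing ℕ

Λℚ : ℚ-Algebra
Λℚ = record { commutativeRing = Λ-commutativeRing ; ν = λ q → con (K.con q)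
  ; ν-+ = λ a b → Λ′.≈-trans (Λ′.con-cong (K.con-+ a b)) (Λ′.con-+ _ _)
  ; ν-* = λ a b → Λ′.≈-trans (Λ′.con-cong (K.con-* a b)) (Λ′.con-* _ _)
  ; ν-0 = Λ′.≈-refl ; ν-1 = Λ′.≈-refl }

-- Λ[u, d]; u and d will shift the index of a sequence up and down.
module L = Polynomial Λ-commutativeRing Bool

Lℚ : ℚ-Algebra
Lℚ = record { commutativeRing = L.commutativeRing ; ν = λ q → L.con (con (K.con q))
  ; ν-+ = λ a b → L.≈-trans (L.con-cong (ℚ-Algebra.ν-+ Λℚ a b)) (L.con-+ _ _)
  ; ν-* = λ a b → L.≈-trans (L.con-cong (ℚ-Algebra.ν-* Λℚ a b)) (L.con-* _ _)
  ; ν-0 = L.≈-refl ; ν-1 = L.≈-refl }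

open PolynomialHomomorphism using (IsHomomorphism; ringMap)

open CommutativeRing Λ-commutativeRing using (0#; 1#; _-_; refl; sym; trans; reflexive; setoid; +-cong; +-congˡ; +-congʳ; *-cong; *-congˡ; *-congʳ; -‿cong; +-identityˡ; +-identityʳ; +-assoc; +-comm; *-assoc; *-comm; *-identityˡ; *-identityʳ; distribˡ; distribʳ; zeroˡ; zeroʳ; -‿inverseˡ; -‿inverseʳ; +-group; ring; semiring)
open import Algebra.Properties.Group +-group using (inverseˡ-unique; identityˡ-unique)
open import Algebra.Properties.Ring ring using (-0#≈0#; -‿distribʳ-*; -‿distribˡ-*)
open ℚ-Algebra Λℚ using (ν; ν-*)
open ℚ-AlgebraProperties Λℚ using (nat; nat-0; nat-suc; nat-inverse; nat-cancel; module Solver)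
open Solver using (solve; _:+_; _:*_; _:-_; :-_; _:=_) renaming (con to :con)
open Sequences Λℚ
open import Relation.Binary.Reasoning.Setoid setoid

private
  module ℤS = +-*-Solver
  module KR = CommutativeRing ℚ[t]-commutativeRing
  module KS = Sequences Kℚ
  module KP = ℚ-AlgebraProperties Kℚ
  module LR = CommutativeRing L.commutativeRing
  module LS = Sequences Lℚ
  module LP = ℚ-AlgebraProperties Lℚ
  module DΛ = Determinant Λ-commutativeRing
  module DL = Determinant L.commutativeRing
  module ΛSum = Algebra.Properties.CommutativeMonoid.Sum (CommutativeRing.+-commutativeMonoid Λ-commutativeRing)
  module LSum = Algebra.Properties.CommutativeMonoid.Sum LR.+-commutativeMonoid

open LP.Solver using () renaming (solve to solveᴸ; _:=_ to _:=ᴸ_; _:+_ to _:+ᴸ_; _:*_ to _:*ᴸ_; :-_ to :-ᴸ_; con to :conᴸ)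

-- Commuting additive operators for the constants and the variables of R[I] make the sequences J → Λ
-- a module over R[I]. With J = ⊤ this gives differential operators with symbols in Λ, with J = ℤ
-- the shifts of a sequence.
module Action
  (R : CommutativeRing 0ℓ 0ℓ) (I J : Set)
  (step : CommutativeRing.Carrier R ⊎ I → (J → Λ) → J → Λ)
  (step-cong : ∀ a {g g′} → (∀ x → g x ≈ g′ x) → ∀ x → step a g x ≈ step a g′ x)
  (step-+ : ∀ a g g′ x → step a (λ y → g y + g′ y) x ≈ step a g x + step a g′ x)
  (step-comm : ∀ a b g x → step a (step b g) x ≈ step b (step a g) x)
  (con-congˢ : ∀ {a b} → CommutativeRing._≈_ R a b → ∀ g x → step (inj₁ a) g x ≈ step (inj₁ b) g x)
  (con-+ˢ : ∀ a b g x → step (inj₁ (CommutativeRing._+_ R a b)) g x ≈ step (inj₁ a) g x + step (inj₁ b) g x)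
  (con-*ˢ : ∀ a b g x → step (inj₁ (CommutativeRing._*_ R a b)) g x ≈ step (inj₁ a) (step (inj₁ b) g) x)
  (con-0ˢ : ∀ g x → step (inj₁ (CommutativeRing.0# R)) g x ≈ 0#)
  (con-1ˢ : ∀ g x → step (inj₁ (CommutativeRing.1# R)) g x ≈ g x)
  where

  private module P = Polynomial R I

  act : P.Poly → (J → Λ) → J → Λ
  act (P.con a) g   = step (inj₁ a) g
  act (P.var i) g   = step (inj₂ i) g
  act (F P.+ G) g x = act F g x + act G g x
  act (F P.* G) g   = act F (act G g)
  act (P.- F) g x   = - act F g x

  act-congʳ : ∀ F {g g′} → (∀ x → g x ≈ g′ x) → ∀ x → act F g x ≈ act F g′ x
  act-congʳ (P.con a) e x = step-cong (inj₁ a) e x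
  act-congʳ (P.var i) e x = step-cong (inj₂ i) e x
  act-congʳ (F P.+ G) e x = +-cong (act-congʳ F e x) (act-congʳ G e x)
  act-congʳ (F P.* G) e x = act-congʳ F (act-congʳ G e) x
  act-congʳ (P.- F)   e x = -‿cong (act-congʳ F e x)

  act-+ : ∀ F g g′ x → act F (λ y → g y + g′ y) x ≈ act F g x + act F g′ x
  act-+ (P.con a) g g′ x = step-+ (inj₁ a) g g′ x
  act-+ (P.var i) g g′ x = step-+ (inj₂ i) g g′ x
  act-+ (F P.+ G) g g′ x = trans (+-cong (act-+ F g g′ x) (act-+ G g g′ x))
    (solve 4 (λ a b c d → (a :+ b) :+ (c :+ d) := (a :+ c) :+ (b :+ d)) refl (act F g x) (act F g′ x) (act G g x) (act G g′ x))
  act-+ (F P.* G) g g′ x = trans (act-congʳ F (act-+ G g g′) x) (act-+ F (act G g) (act G g′) x)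
  act-+ (P.- F)   g g′ x = trans (-‿cong (act-+ F g g′ x))
    (solve 2 (λ a b → :- (a :+ b) := :- a :+ :- b) refl (act F g x) (act F g′ x))

  act-0 : ∀ F x → act F (λ _ → 0#) x ≈ 0#
  act-0 F x = identityˡ-unique _ _ (trans (sym (act-+ F (λ _ → 0#) (λ _ → 0#) x)) (act-congʳ F (λ _ → +-identityˡ 0#) x))

  act-neg : ∀ F g x → act F (λ y → - g y) x ≈ - act F g x
  act-neg F g x = inverseˡ-unique _ _ (trans (sym (act-+ F (λ y → - g y) g x))
    (trans (act-congʳ F (λ y → -‿inverseˡ (g y)) x) (act-0 F x)))

  act-step : ∀ F b g x → act F (step b g) x ≈ step b (act F g) x
  act-step (P.con a) b g x = step-comm (inj₁ a) b g x
  act-step (P.var i) b g x = step-comm (inj₂ i) b g x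
  act-step (F P.+ G) b g x = trans (+-cong (act-step F b g x) (act-step G b g x)) (sym (step-+ b (act F g) (act G g) x))
  act-step (F P.* G) b g x = trans (act-congʳ F (act-step G b g) x) (act-step F b (act G g) x)
  act-step (P.- F)   b g x = trans (-‿cong (act-step F b g x)) (sym (step-neg (act F g) x))
    where
    step-0 : ∀ x → step b (λ _ → 0#) x ≈ 0#
    step-0 x = identityˡ-unique _ _ (trans (sym (step-+ b (λ _ → 0#) (λ _ → 0#) x)) (step-cong b (λ _ → +-identityˡ 0#) x))
    step-neg : ∀ g x → step b (λ y → - g y) x ≈ - step b g x
    step-neg g x = inverseˡ-unique _ _ (trans (sym (step-+ b (λ y → - g y) g x))
      (trans (step-cong b (λ y → -‿inverseˡ (g y)) x) (step-0 x)))

  -- The law `*-comm` of the presented ring concerns arbitrary factors, so commutation of the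
  -- generators has to be extended to all expressions before the action can respect ≈.
  act-comm : ∀ F G g x → act F (act G g) x ≈ act G (act F g) x
  act-comm F (P.con a) g x = act-step F (inj₁ a) g x
  act-comm F (P.var i) g x = act-step F (inj₂ i) g x
  act-comm F (G P.+ H) g x = trans (act-+ F (act G g) (act H g) x) (+-cong (act-comm F G g x) (act-comm F H g x))
  act-comm F (G P.* H) g x = trans (act-comm F G (act H g) x) (act-congʳ G (act-comm F H g) x)
  act-comm F (P.- G)   g x = trans (act-neg F (act G g) x) (-‿cong (act-comm F G g x))

  act-congˡ : ∀ {F G} → F P.≈ G → ∀ g x → act F g x ≈ act G g x
  act-congˡ P.≈-refl             g x = refl
  act-congˡ (P.≈-sym e)          g x = sym (act-congˡ e g x)
  act-congˡ (P.≈-trans e e′)     g x = trans (act-congˡ e g x) (act-congˡ e′ g x)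
  act-congˡ (P.+-cong e e′)      g x = +-cong (act-congˡ e g x) (act-congˡ e′ g x)
  act-congˡ (P.*-cong {x = F} e e′) g x = trans (act-congʳ F (act-congˡ e′ g) x) (act-congˡ e _ x)
  act-congˡ (P.-‿cong e)         g x = -‿cong (act-congˡ e g x)
  act-congˡ (P.+-assoc F G H)    g x = +-assoc _ _ _
  act-congˡ (P.+-comm F G)       g x = +-comm _ _
  act-congˡ (P.+-identityˡ F)    g x = trans (+-cong (con-0ˢ g x) refl) (+-identityˡ _)
  act-congˡ (P.-‿inverseˡ F)     g x = trans (-‿inverseˡ _) (sym (con-0ˢ g x))
  act-congˡ (P.*-assoc F G H)    g x = refl
  act-congˡ (P.*-comm F G)       g x = act-comm F G g x
  act-congˡ (P.*-identityˡ F)    g x = con-1ˢ _ x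
  act-congˡ (P.distribˡ F G H)   g x = act-+ F (act G g) (act H g) x
  act-congˡ (P.con-cong e)       g x = con-congˢ e g x
  act-congˡ (P.con-+ a b)        g x = con-+ˢ a b g x
  act-congˡ (P.con-* a b)        g x = con-*ˢ a b g x

  act-cong : ∀ {F G} → F P.≈ G → ∀ {g g′} → (∀ x → g x ≈ g′ x) → ∀ x → act F g x ≈ act G g′ x
  act-cong {F} e e′ x = trans (act-congʳ F e′ x) (act-congˡ e _ x)

-- Differential operators in the power sums

δ : ∀ i {j : ℕ} → Dec (i ≡ j) → Λ
δ i (yes _) = nat (suc i)
δ i (no _)  = 0#

-- D i is (i+1) ∂/∂p_{i+1}.
D : ℕ → Op
D i (con a) = 0#
D i (var j) = δ i (i ℕₚ.≟ j)
D i (F + G) = D i F + D i G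
D i (F * G) = D i F * G + F * D i G
D i (- F)   = - D i F

D-cong : ∀ i {F G} → F ≈ G → D i F ≈ D i G
D-cong i Λ′.≈-refl            = refl
D-cong i (Λ′.≈-sym e)         = sym (D-cong i e)
D-cong i (Λ′.≈-trans e e′)    = trans (D-cong i e) (D-cong i e′)
D-cong i (Λ′.+-cong e e′)     = +-cong (D-cong i e) (D-cong i e′)
D-cong i (Λ′.*-cong e e′)     = +-cong (*-cong (D-cong i e) e′) (*-cong e (D-cong i e′))
D-cong i (Λ′.-‿cong e)        = -‿cong (D-cong i e)
D-cong i (Λ′.+-assoc x y z)   = +-assoc _ _ _
D-cong i (Λ′.+-comm x y)      = +-comm _ _
D-cong i (Λ′.+-identityˡ x)   = +-identityˡ _
D-cong i (Λ′.-‿inverseˡ x)    = -‿inverseˡ _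
D-cong i (Λ′.*-assoc x y z)   = solve 6 (λ x y z x′ y′ z′ → (x′ :* y :+ x :* y′) :* z :+ x :* y :* z′ := x′ :* (y :* z) :+ x :* (y′ :* z :+ y :* z′)) refl x y z (D i x) (D i y) (D i z)
D-cong i (Λ′.*-comm x y)      = solve 4 (λ x y x′ y′ → x′ :* y :+ x :* y′ := y′ :* x :+ y :* x′) refl x y (D i x) (D i y)
D-cong i (Λ′.*-identityˡ x)   = trans (+-cong (zeroˡ _) (*-identityˡ _)) (+-identityˡ _)
D-cong i (Λ′.distribˡ x y z)  = solve 6 (λ x y z x′ y′ z′ → x′ :* (y :+ z) :+ x :* (y′ :+ z′) := x′ :* y :+ x :* y′ :+ (x′ :* z :+ x :* z′)) refl x y z (D i x) (D i y) (D i z)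
D-cong i (Λ′.con-cong e)      = refl
D-cong i (Λ′.con-+ a b)       = sym (+-identityˡ _)
D-cong i (Λ′.con-* a b)       = sym (trans (+-cong (zeroˡ _) (zeroʳ _)) (+-identityˡ _))

D-scale : ∀ i a F → D i (con a * F) ≈ con a * D i F
D-scale i a F = trans (+-congʳ (zeroˡ _)) (+-identityˡ _)

D-δ : ∀ i j {k} (d : Dec (j ≡ k)) → D i (δ j d) ≈ 0#
D-δ i j (yes _) = refl
D-δ i j (no _)  = refl

D-comm : ∀ i j F → D i (D j F) ≈ D j (D i F)
D-comm i j (con a) = refl
D-comm i j (var k) = trans (D-δ i j (j ℕₚ.≟ k)) (sym (D-δ j i (i ℕₚ.≟ k)))
D-comm i j (F + G) = +-cong (D-comm i j F) (D-comm i j G)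
D-comm i j (F * G) = trans (+-cong (+-congʳ (*-congʳ (D-comm i j F))) (+-congˡ (*-congˡ (D-comm i j G))))
  (solve 8 (λ F G FG GF Fi Fj Gi Gj → (FG :* G :+ Fj :* Gi) :+ (Fi :* Gj :+ F :* GF) := (FG :* G :+ Fi :* Gj) :+ (Fj :* Gi :+ F :* GF)) refl
    F G (D j (D i F)) (D j (D i G)) (D i F) (D j F) (D i G) (D j G))
D-comm i j (- F)   = -‿cong (D-comm i j F)

δ-≡ : ∀ i (d : Dec (i ≡ i)) → δ i d ≡ nat (suc i)
δ-≡ i (yes _) = ≡.refl
δ-≡ i (no ¬e) = contradiction ≡.refl ¬e

δ-≢ : ∀ {i j} (d : Dec (i ≡ j)) → ¬ i ≡ j → δ i d ≡ 0#
δ-≢ (yes e) ¬e = contradiction e ¬e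
δ-≢ (no _)  _  = ≡.refl

D-var-sym : ∀ i j → D i (var j) ≡ D j (var i)
D-var-sym i j with i ℕₚ.≟ j
... | yes ≡.refl = ≡.sym (δ-≡ i (i ℕₚ.≟ i))
... | no i≢j     = ≡.sym (δ-≢ (j ℕₚ.≟ i) (λ e → i≢j (≡.sym e)))

private
  D-step : ℚ[t] ⊎ ℕ → (⊤ → Λ) → ⊤ → Λ
  D-step (inj₁ a) g x = con a * g x
  D-step (inj₂ i) g x = D i (g x)

  D-step-comm : ∀ a b g x → D-step a (D-step b g) x ≈ D-step b (D-step a g) x
  D-step-comm (inj₁ a) (inj₁ b) g x = solve 3 (λ a b g → a :* (b :* g) := b :* (a :* g)) refl (con a) (con b) (g x)
  D-step-comm (inj₁ a) (inj₂ j) g x = sym (D-scale j a (g x))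
  D-step-comm (inj₂ i) (inj₁ b) g x = D-scale i b (g x)
  D-step-comm (inj₂ i) (inj₂ j) g x = D-comm i j (g x)

  D-step-cong : ∀ a {g g′ : ⊤ → Λ} → (∀ x → g x ≈ g′ x) → ∀ x → D-step a g x ≈ D-step a g′ x
  D-step-cong (inj₁ a) e x = *-congˡ (e x)
  D-step-cong (inj₂ i) e x = D-cong i (e x)

  D-step-+ : ∀ a (g g′ : ⊤ → Λ) x → D-step a (λ y → g y + g′ y) x ≈ D-step a g x + D-step a g′ x
  D-step-+ (inj₁ a) g g′ x = distribˡ _ _ _
  D-step-+ (inj₂ i) g g′ x = refl

  module DA = Action ℚ[t]-commutativeRing ℕ ⊤ D-step D-step-cong D-step-+ D-step-comm
    (λ e g x → *-congʳ (Λ′.con-cong e))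
    (λ a b g x → trans (*-congʳ (Λ′.con-+ a b)) (distribʳ _ _ _))
    (λ a b g x → trans (*-congʳ (Λ′.con-* a b)) (*-assoc _ _ _))
    (λ g x → zeroˡ _) (λ g x → *-identityˡ _)

-- P ∙ F is P(D₀, D₁, …) F, the concrete form of P^⊥ F.
infixr 8 _∙_
_∙_ : Λ → Λ → Λ
P ∙ F = DA.act P (λ _ → F) tt

∙-cong : ∀ {P Q F G} → P ≈ Q → F ≈ G → P ∙ F ≈ Q ∙ G
∙-cong e e′ = DA.act-cong e (λ _ → e′) tt

∙-+ : ∀ P F G → P ∙ (F + G) ≈ P ∙ F + P ∙ G
∙-+ P F G = DA.act-+ P _ _ tt

∙-0 : ∀ P → P ∙ 0# ≈ 0#
∙-0 P = DA.act-0 P tt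

∙-comm : ∀ P Q F → P ∙ Q ∙ F ≈ Q ∙ P ∙ F
∙-comm P Q F = DA.act-comm P Q _ tt

∙-scale : ∀ P a F → P ∙ (con a * F) ≈ con a * (P ∙ F)
∙-scale P a F = ∙-comm P (con a) F

∙-D : ∀ P i F → P ∙ D i F ≈ D i (P ∙ F)
∙-D P i F = ∙-comm P (var i) F

-- Since [D j , p_{i+1}] is a scalar, the commutator of P(D₀, D₁, ...) with p_{i+1} is a derivative
-- of the symbol P; the factor i + 1 makes it `D i P`.
∙-var : ∀ P i F → P ∙ (var i * F) ≈ var i * (P ∙ F) + D i P ∙ F
∙-var (con a) i F = trans (solve 3 (λ a p F → a :* (p :* F) := p :* (a :* F)) refl (con a) (var i) F) (sym (trans (+-congˡ (zeroˡ _)) (+-identityʳ _)))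
∙-var (var j) i F = trans (+-comm _ _) (+-congˡ (trans (*-congʳ (reflexive (D-var-sym j i))) (δ-∙ (i ℕₚ.≟ j))))
  where
  δ-∙ : ∀ {k} (d : Dec (i ≡ k)) → δ i d * F ≈ δ i d ∙ F
  δ-∙ (yes _) = refl
  δ-∙ (no _)  = refl
∙-var (P + Q) i F = trans (+-cong (∙-var P i F) (∙-var Q i F))
  (solve 5 (λ p a b c d → p :* a :+ b :+ (p :* c :+ d) := p :* (a :+ c) :+ (b :+ d)) refl (var i) (P ∙ F) (D i P ∙ F) (Q ∙ F) (D i Q ∙ F))
∙-var (P * Q) i F = trans (∙-cong (refl {P}) (∙-var Q i F)) (trans (∙-+ P _ _) (trans (+-congʳ (∙-var P i (Q ∙ F)))
  (+-assoc _ _ _)))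
∙-var (- P)   i F = trans (-‿cong (∙-var P i F))
  (solve 3 (λ p a b → :- (p :* a :+ b) := p :* (:- a) :+ :- b) refl (var i) (P ∙ F) (D i P ∙ F))

private
  L-step : Λ ⊎ Bool → (ℤ → Λ) → ℤ → Λ
  L-step (inj₁ c)     g r = c * g r
  L-step (inj₂ true)  g r = g (r ℤ.+ ℤ.1ℤ)
  L-step (inj₂ false) g r = g (r ℤ.+ ℤ.-1ℤ)

  L-step-cong : ∀ a {g g′} → (∀ x → g x ≈ g′ x) → ∀ x → L-step a g x ≈ L-step a g′ x
  L-step-cong (inj₁ c)     e x = *-congˡ (e x)
  L-step-cong (inj₂ true)  e x = e _
  L-step-cong (inj₂ false) e x = e _

  L-step-+ : ∀ a g g′ x → L-step a (λ y → g y + g′ y) x ≈ L-step a g x + L-step a g′ x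
  L-step-+ (inj₁ c)     g g′ x = distribˡ _ _ _
  L-step-+ (inj₂ true)  g g′ x = refl
  L-step-+ (inj₂ false) g g′ x = refl

+-swap : ∀ a b c → (a ℤ.+ b) ℤ.+ c ≡ (a ℤ.+ c) ℤ.+ b
+-swap a b c = ≡.trans (ℤₚ.+-assoc a b c) (≡.trans (≡.cong (λ z → a ℤ.+ z) (ℤₚ.+-comm b c)) (≡.sym (ℤₚ.+-assoc a c b)))

private
  L-step-comm : ∀ a b g x → L-step a (L-step b g) x ≈ L-step b (L-step a g) x
  L-step-comm (inj₁ a)     (inj₁ b)     g x = solve 3 (λ a b g → a :* (b :* g) := b :* (a :* g)) refl a b (g x)
  L-step-comm (inj₁ a)     (inj₂ true)  g x = refl
  L-step-comm (inj₁ a)     (inj₂ false) g x = refl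
  L-step-comm (inj₂ true)  (inj₁ b)     g x = refl
  L-step-comm (inj₂ false) (inj₁ b)     g x = refl
  L-step-comm (inj₂ true)  (inj₂ true)  g x = refl
  L-step-comm (inj₂ false) (inj₂ false) g x = refl
  L-step-comm (inj₂ true)  (inj₂ false) g x = reflexive (≡.cong g (+-swap x _ _))
  L-step-comm (inj₂ false) (inj₂ true)  g x = reflexive (≡.cong g (+-swap x _ _))

module LA = Action Λ-commutativeRing Bool ℤ L-step L-step-cong L-step-+ L-step-comm
  (λ e g x → *-congʳ e) (λ a b g x → distribʳ _ _ _) (λ a b g x → *-assoc _ _ _) (λ g x → zeroˡ _) (λ g x → *-identityˡ _)

-- Exponentials and their logarithmic derivatives

*ˢ≈⋆ : ∀ a b n → (a *ˢ b) n ≈ (a ⋆ b) n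
*ˢ≈⋆ a b n = sym (trans (⋆-∑ a b n) (∑≈sum (suc n) (λ i → a i * b (n ∸ i))))

^ˢ-vanish : ∀ {a} → a 0 ≈ 0# → ∀ j n → n < j → (a ^ˢ j) n ≈ 0#
^ˢ-vanish {a} a₀ (suc j) zero    _         = trans (*ˢ≈⋆ a (a ^ˢ j) 0) (trans (⋆-zero a (a ^ˢ j)) (trans (*-congʳ a₀) (zeroˡ _)))
^ˢ-vanish {a} a₀ (suc j) (suc n) (s≤s n<j) = trans (*ˢ≈⋆ a (a ^ˢ j) (suc n)) (trans (⋆-suc a (a ^ˢ j) n)
  (trans (+-cong (trans (*-congʳ a₀) (zeroˡ _))
    (trans (⋆-congˡ n (λ i i≤n → ^ˢ-vanish a₀ j i (ℕₚ.≤-<-trans i≤n n<j))) (⋆-zeroʳ (a ∘ suc) _ n (λ _ → refl))))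
    (+-identityˡ 0#)))

invFactorial : ℕ → Λ
invFactorial j = ratio 1 (j !) {{ℕₚ._!≢0 j}}

invFactorial-suc : ∀ j → invFactorial (suc j) * nat (suc j) ≈ invFactorial j
invFactorial-suc j = trans (sym (ν-* _ _)) (reflexive (≡.cong ν (≡.trans
  (/-homo-* 1 (suc j) (suc j !) 1 {{ℕₚ._!≢0 (suc j)}} {{_}} {{ℕₚ.m*n≢0 (suc j !) 1 {{ℕₚ._!≢0 (suc j)}}}})
  (/-cross (1 ℕ.* suc j) 1 (suc j ! ℕ.* 1) (j !) {{ℕₚ.m*n≢0 (suc j !) 1 {{ℕₚ._!≢0 (suc j)}}}} {{ℕₚ._!≢0 j}}
    (≡.trans (≡.cong (ℕ._* (j !)) (ℕₚ.*-identityˡ (suc j))) (≡.sym (≡.trans (ℕₚ.*-identityˡ _) (ℕₚ.*-identityʳ _))))))))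

exp-∑ : ∀ {a} → a 0 ≈ 0# → ∀ {N} n → n < N → expˢ a n ≈ ∑ N (λ j → invFactorial j * (a ^ˢ j) n)
exp-∑ {a} a₀ n n<N = trans (sym (∑≈sum (suc n) (λ j → invFactorial j * (a ^ˢ j) n)))
  (sym (∑-extend _ n<N (λ j n<j → trans (*-congˡ (^ˢ-vanish a₀ j n n<j)) (zeroʳ _))))

record IsAdditive (φ : Op) : Set where
  field
    cong   : ∀ {F G} → F ≈ G → φ F ≈ φ G
    homo-+ : ∀ F G → φ (F + G) ≈ φ F + φ G

  homo-0 : φ 0# ≈ 0#
  homo-0 = identityˡ-unique _ _ (trans (sym (homo-+ 0# 0#)) (cong (+-identityˡ 0#)))

  homo-∑ : ∀ n g → φ (∑ n g) ≈ ∑ n (φ ∘ g)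
  homo-∑ zero    g = trans (cong (∑-zero′ g)) (trans homo-0 (sym (∑-zero′ (φ ∘ g))))
  homo-∑ (suc n) g = trans (cong (∑-suc n g)) (trans (homo-+ _ _) (trans (+-congˡ (homo-∑ n (g ∘ suc))) (sym (∑-suc n (φ ∘ g)))))

  homo-neg : ∀ F → φ (- F) ≈ - φ F
  homo-neg F = inverseˡ-unique _ _ (trans (sym (homo-+ (- F) F)) (trans (cong (-‿inverseˡ F)) homo-0))

-- The family `d` may depend on the index, so that u d/du and the coefficientwise `D i` are both
-- instances; `d-exp` is then the rule (exp a)′ = a′ exp a.
module Derivation
  (d : ℕ → Op)
  (d-additive : ∀ n → IsAdditive (d n))
  (d-ν : ∀ n q F → d n (ν q * F) ≈ ν q * d n F)
  (d-⋆ : ∀ a b n → d n ((a ⋆ b) n) ≈ ((λ i → d i (a i)) ⋆ b) n + (a ⋆ (λ i → d i (b i))) n)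
  (d-one : ∀ n → d n (oneˢ n) ≈ 0#)
  {a : Series} (a₀ : a 0 ≈ 0#)
  where

  private
    module d n = IsAdditive (d-additive n)
    a′ : Series
    a′ i = d i (a i)

  d-^ˢ : ∀ j n → d n ((a ^ˢ suc j) n) ≈ nat (suc j) * (a′ ⋆ (a ^ˢ j)) n
  d-^ˢ zero n = begin
    d n ((a *ˢ oneˢ) n)                             ≈⟨ trans (d.cong n (*ˢ≈⋆ a oneˢ n)) (d-⋆ a oneˢ n) ⟩
    (a′ ⋆ oneˢ) n + (a ⋆ (λ i → d i (oneˢ i))) n    ≈⟨ +-congˡ (⋆-zeroʳ a _ n d-one) ⟩
    (a′ ⋆ oneˢ) n + 0#                              ≈⟨ +-identityʳ _ ⟩
    (a′ ⋆ oneˢ) n                                   ≈⟨ *-identityˡ _ ⟨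
    nat 1 * (a′ ⋆ oneˢ) n                           ∎
  d-^ˢ (suc j) n = begin
    d n ((a *ˢ (a ^ˢ suc j)) n)                                     ≈⟨ trans (d.cong n (*ˢ≈⋆ a _ n)) (d-⋆ a _ n) ⟩
    (a′ ⋆ (a ^ˢ suc j)) n + (a ⋆ (λ i → d i ((a ^ˢ suc j) i))) n    ≈⟨ +-congˡ (⋆-congˡ n (λ i _ → d-^ˢ j i)) ⟩
    (a′ ⋆ (a ^ˢ suc j)) n + (a ⋆ (λ i → nat (suc j) * (a′ ⋆ (a ^ˢ j)) i)) n
      ≈⟨ +-congˡ (trans (⋆-*ʳ (nat (suc j)) a _ n) (*-congˡ (trans (⋆-leftComm a a′ (a ^ˢ j) n)
           (⋆-congˡ n (λ i _ → sym (*ˢ≈⋆ a (a ^ˢ j) i)))))) ⟩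
    (a′ ⋆ (a ^ˢ suc j)) n + nat (suc j) * (a′ ⋆ (a ^ˢ suc j)) n     ≈⟨ +-congʳ (*-identityˡ _) ⟨
    1# * (a′ ⋆ (a ^ˢ suc j)) n + nat (suc j) * (a′ ⋆ (a ^ˢ suc j)) n ≈⟨ distribʳ _ _ _ ⟨
    (1# + nat (suc j)) * (a′ ⋆ (a ^ˢ suc j)) n                      ≈⟨ *-congʳ (nat-suc (suc j)) ⟨
    nat (suc (suc j)) * (a′ ⋆ (a ^ˢ suc j)) n                       ∎

  d-exp : ∀ n → d n (expˢ a n) ≈ (a′ ⋆ expˢ a) n
  d-exp n = begin
    d n (expˢ a n)
      -- One exponent more than `expˢ` sums over: the term j = 0 is differentiated away, and n + 1
      -- terms have to remain.
      ≈⟨ trans (d.cong n (exp-∑ a₀ n (ℕₚ.≤-trans (ℕₚ.n<1+n n) (ℕₚ.n≤1+n _)))) (d.homo-∑ n (suc (suc n)) _) ⟩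
    ∑ (suc (suc n)) (λ j → d n (invFactorial j * (a ^ˢ j) n))
      ≈⟨ trans (∑-suc (suc n) _) (+-congʳ (trans (d-ν n _ _) (trans (*-congˡ (d-one n)) (zeroʳ _)))) ⟩
    0# + ∑ (suc n) (λ j → d n (invFactorial (suc j) * (a ^ˢ suc j) n))
      ≈⟨ trans (+-identityˡ _) (∑-cong (suc n) (λ j _ → trans (d-ν n _ _) (trans (*-congˡ (d-^ˢ j n))
           (trans (sym (*-assoc _ _ _)) (*-congʳ (invFactorial-suc j)))))) ⟩
    ∑ (suc n) (λ j → invFactorial j * (a′ ⋆ (a ^ˢ j)) n)
      ≈⟨ ⋆-∑ʳ (suc n) a′ invFactorial (λ j m → (a ^ˢ j) m) n ⟨
    (a′ ⋆ (λ m → ∑ (suc n) (λ j → invFactorial j * (a ^ˢ j) m))) n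
      ≈⟨ ⋆-congˡ n (λ m m≤n → sym (exp-∑ a₀ m (s≤s m≤n))) ⟩
    (a′ ⋆ expˢ a) n ∎

D-additive : ∀ i → IsAdditive (D i)
D-additive i = record { cong = D-cong i ; homo-+ = λ _ _ → refl }

D-⋆ : ∀ i a b n → D i ((a ⋆ b) n) ≈ ((λ j → D i (a j)) ⋆ b) n + (a ⋆ (λ j → D i (b j))) n
D-⋆ i a b n = begin
  D i ((a ⋆ b) n)                                                  ≈⟨ D-cong i (⋆-∑ a b n) ⟩
  D i (∑ (suc n) (λ j → a j * b (n ∸ j)))                          ≈⟨ IsAdditive.homo-∑ (D-additive i) (suc n) _ ⟩
  ∑ (suc n) (λ j → D i (a j) * b (n ∸ j) + a j * D i (b (n ∸ j)))  ≈⟨ ∑-+ (suc n) _ _ ⟩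
  _                                                                ≈⟨ +-cong (⋆-∑ _ b n) (⋆-∑ a _ n) ⟨
  _                                                                ∎

powers : Λ → Series
powers A zero    = 0#
powers A (suc i) = ψ (suc i) A

Ω-0 : ∀ A → Ω A 0 ≈ 1#
Ω-0 A = trans (+-identityʳ _) (*-identityʳ _)

Ω-newton : ∀ A → Newton (powers A) (Ω A)
Ω-newton A n = trans
  (Derivation.d-exp (λ n F → nat n * F)
    (λ n → record { cong = *-congˡ ; homo-+ = distribˡ _ })
    (λ n q F → solve 3 (λ n q F → n :* (q :* F) := q :* (n :* F)) refl (nat n) (ν q) F)
    ∂-⋆ (λ { zero → trans (*-congʳ nat-0) (zeroˡ _) ; (suc n) → zeroʳ _ }) {logΩ A} refl n)
  (⋆-congʳ n (λ i _ → ∂-log i))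
  where
  ∂-log : ∀ i → nat i * logΩ A i ≈ powers A i
  ∂-log zero    = zeroʳ _
  ∂-log (suc i) = trans (sym (*-assoc _ _ _)) (trans (*-congʳ (trans (*-comm _ _) (nat-inverse i))) (*-identityˡ _))

D-Ω : ∀ i A n → D i (Ω A n) ≈ ((λ j → D i (logΩ A j)) ⋆ Ω A) n
D-Ω i A n = Derivation.d-exp (λ _ → D i) (λ _ → D-additive i) (λ _ q F → D-scale i (K.con q) F)
  (D-⋆ i) (λ { zero → refl ; (suc _) → refl }) {logΩ A} refl n

-- The integer index of `coefficient` covers n < k as well, where the coefficient is 0.
⋆-single : ∀ k a b n → (∀ j → ¬ j ≡ k → a j ≈ 0#) → (a ⋆ b) n ≈ a k * coefficient b (ℤ.+ n ℤ.- ℤ.+ k)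
⋆-single zero    a b zero    e = ⋆-zero a b
⋆-single zero    a b (suc n) e = trans (⋆-suc a b n) (trans (+-cong
  (*-congˡ (reflexive (≡.cong (b ∘ suc) (≡.sym (ℕₚ.+-identityʳ n)))))
  (trans (⋆-comm (a ∘ suc) b n) (⋆-zeroʳ b (a ∘ suc) n (λ i → e (suc i) (λ ()))))) (+-identityʳ _))
⋆-single (suc k) a b zero    e = trans (⋆-zero a b) (trans (*-congʳ (e 0 (λ ()))) (trans (zeroˡ _) (sym (zeroʳ _))))
⋆-single (suc k) a b (suc n) e = trans (⋆-suc a b n) (trans (+-cong (trans (*-congʳ (e 0 (λ ()))) (zeroˡ _))
  (⋆-single k (a ∘ suc) b n (λ j j≢k → e (suc j) (j≢k ∘ ℕₚ.suc-injective))))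
  (trans (+-identityˡ _) (*-congˡ (reflexive (≡.cong (coefficient b) (shift n k))))))
  where
  shift : ∀ n k → ℤ.+ n ℤ.- ℤ.+ k ≡ ℤ.+ suc n ℤ.- ℤ.+ suc k
  shift n k = ≡.trans (ℤₚ.m-n≡m⊖n n k) (≡.sym (≡.trans (ℤₚ.m-n≡m⊖n (suc n) (suc k)) (ℤₚ.[1+m]⊖[1+n]≡m⊖n n k)))

-- For A = cX with c a scalar.
D-Ω-linear : ∀ c {A} → (∀ j → ψ (suc j) A ≈ con c * var j) → ∀ i n →
  D i (Ω A n) ≈ con c * coefficient (Ω A) (ℤ.+ n ℤ.- ℤ.+ suc i)
D-Ω-linear c {A} ψA i n = trans (D-Ω i A n) (trans (⋆-single (suc i) _ (Ω A) n other) (*-congʳ at-i))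
  where
  D-log : ∀ j → D i (logΩ A (suc j)) ≈ con c * (ratio 1 (suc j) * δ i (i ℕₚ.≟ j))
  D-log j = trans (D-scale i _ _) (trans (*-congˡ (trans (D-cong i (ψA j)) (D-scale i c (var j))))
    (solve 3 (λ r c d → r :* (c :* d) := c :* (r :* d)) refl (ratio 1 (suc j)) (con c) (δ i (i ℕₚ.≟ j))))
  other : ∀ j → ¬ j ≡ suc i → D i (logΩ A j) ≈ 0#
  other zero    _   = refl
  other (suc j) j≢i = trans (D-log j) (trans (*-congˡ (trans (*-congˡ (reflexive (δ-≢ (i ℕₚ.≟ j) (λ e → j≢i (≡.cong suc (≡.sym e)))))) (zeroʳ _))) (zeroʳ _))
  at-i : D i (logΩ A (suc i)) ≈ con c
  at-i = trans (D-log i) (trans (*-congˡ (trans (*-congˡ (reflexive (δ-≡ i (i ℕₚ.≟ i)))) (nat-inverse i))) (*-identityʳ _))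

ψ-X : ∀ i → ψ (suc i) X ≡ var i
ψ-X i = ≡.cong var (ℕₚ.*-identityʳ i)

-1ₜ : ℚ[t]
-1ₜ = K.con (ℚ.- ℚ.1ℚ)

con-1 : ∀ F → - F ≈ con -1ₜ * F
con-1 F = solve 1 (λ F → :- F := :con (ℚ.- ℚ.1ℚ) :* F) refl F

ψ-posX : ∀ i → ψ (suc i) X ≈ con (K.con ℚ.1ℚ) * var i
ψ-posX i = trans (reflexive (ψ-X i)) (sym (*-identityˡ _))

ψ-negX : ∀ i → ψ (suc i) (- X) ≈ con -1ₜ * var i
ψ-negX i = trans (-‿cong (reflexive (ψ-X i))) (con-1 _)

-- (-1)^r e_r
e : ℤ → Λ
e = coefficient (Ω (- X))

h-0 : h ℤ.0ℤ ≈ 1#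
h-0 = Ω-0 X

e-0 : e ℤ.0ℤ ≈ 1#
e-0 = Ω-0 (- X)

coefficient-neg : ∀ a {r} → r ℤ.< ℤ.0ℤ → coefficient a r ≈ 0#
coefficient-neg a {ℤ.+ n} (ℤ.+<+ ())
coefficient-neg a {r = -[1+ n ]} _ = refl

-- -[1+ n ] - k reduces to -[1+ _ ] only for k = suc i.
D-h : ∀ i r → D i (h r) ≈ h (r ℤ.- ℤ.+ suc i)
D-h i (ℤ.+ n)  = trans (D-Ω-linear (K.con ℚ.1ℚ) ψ-posX i n) (*-identityˡ _)
D-h i -[1+ n ] = refl

D-e : ∀ i r → D i (e r) ≈ - e (r ℤ.- ℤ.+ suc i)
D-e i (ℤ.+ n)  = trans (D-Ω-linear -1ₜ ψ-negX i n) (sym (con-1 _))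
D-e i -[1+ n ] = sym -0#≈0#

-- The power sums of X and -X cancel, so the product solves Newton's identity with all power sums 0,
-- as does the series 1.
h⋆e : ∀ n → (Ω (- X) ⋆ Ω X) n ≈ one n
h⋆e = newton-unique (+-identityˡ 0#) (λ { zero → +-identityˡ 0# ; (suc i) → -‿inverseˡ _ })
  (trans (⋆-zero _ _) (trans (*-cong e-0 h-0) (*-identityˡ 1#)))
  (newton-⋆ {powers (- X)} {powers X} {Ω (- X)} {Ω X} (Ω-newton (- X)) (Ω-newton X))
  newton-one
  where
  newton-one : Newton (λ _ → 0#) one
  newton-one n = trans (∂-one n) (sym (trans (⋆-comm _ one n) (⋆-zeroʳ one _ n (λ _ → refl))))
    where
    ∂-one : ∀ n → ∂ one n ≈ 0#
    ∂-one zero    = trans (*-congʳ nat-0) (zeroˡ _)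
    ∂-one (suc n) = zeroʳ _

-- Vertex operators

con-neg : ∀ a → con (K.- a) ≈ - con a
con-neg a = inverseˡ-unique _ _ (trans (sym (Λ′.con-+ (K.- a) a)) (Λ′.con-cong (K.-‿inverseˡ a)))

-- An expression is not a sum of monomials, so the recursion shows that multiplication by F
-- preserves P; F itself is the product with 1. The index lets P speak about cut-offs above `deg F`.
degree-induction : (P : ℕ → Λ → Set) →
  (∀ {d F G} → F ≈ G → P d F → P d G) → (∀ {d d′ F} → d ≤ d′ → P d F → P d′ F) →
  P 0 1# → (∀ {d F G} → P d F → P d G → P d (F + G)) → (∀ a {d F} → P d F → P d (con a * F)) →
  (∀ i {d F} → P d F → P (suc i ℕ.+ d) (var i * F)) → ∀ F → P (deg F) F
degree-induction P resp mono one′ add scale var* F =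
  resp (*-identityʳ F) (≡.subst (λ d → P d (F * 1#)) (ℕₚ.+-identityʳ (deg F)) (multiply F one′))
  where
  multiply : ∀ F {d G} → P d G → P (deg F ℕ.+ d) (F * G)
  multiply (con a)         PG = scale a PG
  multiply (var i)         PG = var* i PG
  multiply (F + F′) {d} {G} PG = resp (sym (distribʳ G F F′))
    (add (mono (ℕₚ.+-monoˡ-≤ d (ℕₚ.m≤m⊔n (deg F) (deg F′))) (multiply F PG))
         (mono (ℕₚ.+-monoˡ-≤ d (ℕₚ.m≤n⊔m (deg F) (deg F′))) (multiply F′ PG)))
  multiply (F * F′) {d} {G} PG = resp (sym (*-assoc F F′ G))
    (≡.subst (λ n → P n (F * (F′ * G))) (≡.sym (ℕₚ.+-assoc (deg F) (deg F′) d)) (multiply F (multiply F′ PG)))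
  multiply (- F) {d} {G}    PG = resp (trans (sym (con-1 (F * G))) (-‿distribˡ-* F G)) (scale -1ₜ (multiply F PG))

Λ-induction : (P : Λ → Set) → (∀ {F G} → F ≈ G → P F → P G) →
  P 1# → (∀ {F G} → P F → P G → P (F + G)) → (∀ a {F} → P F → P (con a * F)) →
  (∀ i {F} → P F → P (var i * F)) → ∀ F → P F
Λ-induction P resp one′ add scale var* =
  degree-induction (λ _ → P) (λ e PF → resp e PF) (λ _ PF → PF) one′ (λ PF PG → add PF PG) (λ a PF → scale a PF) (λ i PF → var* i PF)

-- The components V_r of Σ_r V_r z^r where V p_k = (p_k + x_k z^{-k} + y_k z^k) V and V 1 = Σ_r g_r z^r;
-- here k = suc i.
record IsVertex (g : ℤ → Λ) (x y : ℕ → ℚ[t]) (V : ℤ → Op) : Set where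
  field
    cong   : ∀ r {F G} → F ≈ G → V r F ≈ V r G
    homo-+ : ∀ r F G → V r (F + G) ≈ V r F + V r G
    scale  : ∀ r a F → V r (con a * F) ≈ con a * V r F
    base   : ∀ r → V r 1# ≈ g r
    step   : ∀ r i F → V r (var i * F) ≈
      var i * V r F + (con (x i) * V (r ℤ.+ ℤ.+ suc i) F + con (y i) * V (r ℤ.- ℤ.+ suc i) F)

  additive : ∀ r → IsAdditive (V r)
  additive r = record { cong = cong r ; homo-+ = homo-+ r }

  homo-0 : ∀ r → V r 0# ≈ 0#
  homo-0 r = IsAdditive.homo-0 (additive r)

  homo-neg : ∀ r F → V r (- F) ≈ - V r F
  homo-neg r = IsAdditive.homo-neg (additive r)

pow : Bool → ℕ → L.Poly
pow b zero    = L.con 1#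
pow b (suc n) = L.var b L.* pow b n

act-up : ∀ n g r → LA.act (pow true n) g r ≈ g (r ℤ.+ ℤ.+ n)
act-up zero    g r = trans (*-identityˡ _) (reflexive (≡.cong g (≡.sym (ℤₚ.+-identityʳ r))))
act-up (suc n) g r = trans (act-up n g _) (reflexive (≡.cong g (ℤₚ.+-assoc r ℤ.1ℤ (ℤ.+ n))))

act-down : ∀ n g r → LA.act (pow false n) g r ≈ g (r ℤ.- ℤ.+ n)
act-down zero    g r = trans (*-identityˡ _) (reflexive (≡.cong g (≡.sym (ℤₚ.+-identityʳ r))))
act-down (suc n) g r = trans (act-down n g _) (reflexive (≡.cong g (≡.trans (ℤₚ.+-assoc r ℤ.-1ℤ (ℤ.- ℤ.+ n))
  (≡.cong (λ z → r ℤ.+ z) (≡.sym (ℤₚ.neg-distrib-+ ℤ.1ℤ (ℤ.+ n)))))))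

module Canonical (x y : ℕ → ℚ[t]) where

  -- The substitution p_k ↦ p_k + x_k u^k + y_k d^k. Letting the result act on the sequence g
  -- produces a vertex operator for any data g, x, y.
  σ : Λ → L.Poly
  σ (con a) = L.con (con a)
  σ (var i) = L.con (var i) L.+ (L.con (con (x i)) L.* pow true (suc i) L.+ L.con (con (y i)) L.* pow false (suc i))
  σ (F + G) = σ F L.+ σ G
  σ (F * G) = σ F L.* σ G
  σ (- F)   = L.- σ F

  σ-isHomomorphism : IsHomomorphism ℚ[t]-commutativeRing ℕ L.commutativeRing σ
  σ-isHomomorphism = record
    { homo-+ = λ _ _ → L.≈-refl ; homo-* = λ _ _ → L.≈-refl ; homo-neg = λ _ → L.≈-refl
    ; con-cong = λ e → L.con-cong (Λ′.con-cong e)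
    ; con-+ = λ a b → L.≈-trans (L.con-cong (Λ′.con-+ a b)) (L.con-+ _ _)
    ; con-* = λ a b → L.≈-trans (L.con-cong (Λ′.con-* a b)) (L.con-* _ _)
    ; con-0 = L.≈-refl ; con-1 = L.≈-refl }

  vertex : (ℤ → Λ) → ℤ → Op
  vertex g r F = LA.act (σ F) g r

  vertex-isVertex : ∀ g → IsVertex g x y (vertex g)
  vertex-isVertex g = record
    { cong   = λ r e → LA.act-congˡ (IsHomomorphism.cong σ-isHomomorphism e) g r
    ; homo-+ = λ _ _ _ → refl
    ; scale  = λ _ _ _ → refl
    ; base   = λ r → *-identityˡ _
    ; step   = λ r i F → +-congˡ (+-cong (*-congˡ (act-up (suc i) (LA.act (σ F) g) r)) (*-congˡ (act-down (suc i) (LA.act (σ F) g) r)))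
    }

δ-scalar : ∀ i {j} (d : Dec (i ≡ j)) → ∃[ a ] δ i d ≡ con a
δ-scalar i (yes _) = _ , ≡.refl
δ-scalar i (no _)  = _ , ≡.refl

-- The relation holds on 1 by the hypothesis on g, and multiplication by p_k preserves it: x, y and
-- `D i` of a power sum are scalars, so the shifts made by V and the shift s do not interfere.
D-vertex : ∀ {g x y V} → IsVertex g x y V → ∀ i c s → (∀ r → D i (g r) ≈ con c * g (r ℤ.+ s)) →
  ∀ F r → D i (V r F) ≈ V r (D i F) + con c * V (r ℤ.+ s) F
D-vertex {g} {x} {y} {V} v i c s Dg = Λ-induction (λ F → ∀ r → D i (V r F) ≈ V r (D i F) + con c * V (r ℤ.+ s) F)
  (λ e PF r → trans (D-cong i (cong r (sym e))) (trans (PF r) (+-cong (cong r (D-cong i e)) (*-congˡ (cong _ e)))))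
  (λ r → trans (D-cong i (base r)) (trans (Dg r) (sym (trans (+-cong (homo-0 r) (*-congˡ (base _))) (+-identityˡ _)))))
  (λ {F} {G} PF PG r → trans (D-cong i (homo-+ r F G)) (trans (+-cong (PF r) (PG r))
    (trans (solve 5 (λ a b c d e → (a :+ e :* b) :+ (c :+ e :* d) := (a :+ c) :+ e :* (b :+ d)) refl (V r (D i F)) (V (r ℤ.+ s) F) (V r (D i G)) (V (r ℤ.+ s) G) (con c))
      (sym (+-cong (homo-+ r _ _) (*-congˡ (homo-+ _ F G)))))))
  (λ a {F} PF r → trans (D-cong i (scale r a F)) (trans (D-scale i a _) (trans (*-congˡ (PF r))
    (trans (solve 4 (λ a c x y → a :* (x :+ c :* y) := a :* x :+ c :* (a :* y)) refl (con a) (con c) (V r (D i F)) (V (r ℤ.+ s) F))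
      (sym (+-cong (trans (cong r (D-scale i a F)) (scale r a (D i F))) (*-congˡ (scale _ a F))))))))
  (λ j {F} PF r → step-case j F PF r)
  where
  open IsVertex v
  step-case : ∀ j F → (∀ r → D i (V r F) ≈ V r (D i F) + con c * V (r ℤ.+ s) F) →
    ∀ r → D i (V r (var j * F)) ≈ V r (D i (var j * F)) + con c * V (r ℤ.+ s) (var j * F)
  -- The derivative of p_{j+1} is replaced by a scalar, which V lets through.
  step-case j F PF r with δ-scalar i (i ℕₚ.≟ j)
  ... | a , eq = begin
    D i (V r (var j * F))
      ≈⟨ D-cong i (step r j F) ⟩
    D i (var j) * V r F + var j * D i (V r F) + ((0# * V r⁺ F + X′ * D i (V r⁺ F)) + (0# * V r⁻ F + Y′ * D i (V r⁻ F)))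
      ≈⟨ +-cong (+-cong (*-congʳ (reflexive eq)) (*-congˡ (PF r)))
           (+-cong (trans (+-congʳ (zeroˡ _)) (trans (+-identityˡ _) (*-congˡ (trans (PF r⁺) (+-congˡ (*-congˡ (reflexive (≡.cong (λ z → V z F) (+-swap r _ s)))))))))
                   (trans (+-congʳ (zeroˡ _)) (trans (+-identityˡ _) (*-congˡ (trans (PF r⁻) (+-congˡ (*-congˡ (reflexive (≡.cong (λ z → V z F) (+-swap r _ s)))))))))) ⟩
    con a * V r F + var j * (V r (D i F) + con c * V rs F)
      + (X′ * (V r⁺ (D i F) + con c * V (rs ℤ.+ ℤ.+ suc j) F) + Y′ * (V r⁻ (D i F) + con c * V (rs ℤ.- ℤ.+ suc j) F))
      ≈⟨ solve 12 (λ a v p d c vs x d⁺ s⁺ y d⁻ s⁻ → a :* v :+ p :* (d :+ c :* vs) :+ (x :* (d⁺ :+ c :* s⁺) :+ y :* (d⁻ :+ c :* s⁻))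
           := a :* v :+ (p :* d :+ (x :* d⁺ :+ y :* d⁻)) :+ c :* (p :* vs :+ (x :* s⁺ :+ y :* s⁻)))
           refl (con a) (V r F) (var j) (V r (D i F)) (con c) (V rs F) X′ (V r⁺ (D i F)) (V (rs ℤ.+ ℤ.+ suc j) F) Y′ (V r⁻ (D i F)) (V (rs ℤ.- ℤ.+ suc j) F) ⟩
    con a * V r F + (var j * V r (D i F) + (X′ * V r⁺ (D i F) + Y′ * V r⁻ (D i F)))
      + con c * (var j * V rs F + (X′ * V (rs ℤ.+ ℤ.+ suc j) F + Y′ * V (rs ℤ.- ℤ.+ suc j) F))
      ≈⟨ +-cong (trans (homo-+ r _ _) (+-cong (trans (cong r (*-congʳ (reflexive eq))) (scale r a F)) (step r j (D i F)))) (*-congˡ (step rs j F)) ⟨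
    V r (D i (var j * F)) + con c * V rs (var j * F) ∎
    where
    X′ Y′ : Λ
    X′ = con (x j)
    Y′ = con (y j)
    r⁺ r⁻ rs : ℤ
    r⁺ = r ℤ.+ ℤ.+ suc j
    r⁻ = r ℤ.- ℤ.+ suc j
    rs = r ℤ.+ s

con-ringMap : RingMap Λ-commutativeRing L.commutativeRing
con-ringMap = record
  { φ = L.con ; φ-cong = L.con-cong ; φ-+ = L.con-+ ; φ-* = L.con-*
  ; φ-neg = λ F → LG.inverseˡ-unique _ _ (LR.trans (LR.sym (L.con-+ (- F) F)) (L.con-cong (-‿inverseˡ F)))
  ; φ-0 = L.≈-refl ; φ-1 = L.≈-refl }
  where module LG = Algebra.Properties.Group LR.+-group

σ-ringMap : ∀ x y → RingMap Λ-commutativeRing L.commutativeRing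
σ-ringMap x y = ringMap ℚ[t]-commutativeRing ℕ L.commutativeRing (Canonical.σ-isHomomorphism x y)

module L-con = SequenceHomomorphism Λℚ Lℚ con-ringMap (λ _ → L.≈-refl)
module L-σ (x y : ℕ → ℚ[t]) = SequenceHomomorphism Λℚ Lℚ (σ-ringMap x y) (λ _ → L.≈-refl)

0ₜ 1ₜ : ℚ[t]
0ₜ = K.con ℚ.0ℚ
1ₜ = K.con ℚ.1ℚ

private
  module C  = Canonical (λ _ → -1ₜ) (λ _ → 0ₜ)
  module C* = Canonical (λ _ → 0ₜ) (λ _ → 1ₜ)

e⁻ : ℤ → Λ
e⁻ r = e (ℤ.- r)

-- 𝐁* r is the adjoint of 𝐁 r: the coefficient of z^r in Ω[-z⁻¹X] Ω[zX]^⊥.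
opaque
  𝐁 𝐁* : ℤ → Op
  𝐁  = C.vertex h
  𝐁* = C*.vertex e⁻

  𝐁-vertex : IsVertex h (λ _ → -1ₜ) (λ _ → 0ₜ) 𝐁
  𝐁-vertex = C.vertex-isVertex h

  𝐁*-vertex : IsVertex e⁻ (λ _ → 0ₜ) (λ _ → 1ₜ) 𝐁*
  𝐁*-vertex = C*.vertex-isVertex e⁻

  𝐁-act : ∀ {F P} → C.σ F L.≈ P → ∀ r → 𝐁 r F ≈ LA.act P h r
  𝐁-act e = LA.act-congˡ e h

  𝐁*-act : ∀ {F P} → C*.σ F L.≈ P → ∀ r → 𝐁* r F ≈ LA.act P e⁻ r
  𝐁*-act e = LA.act-congˡ e e⁻

module 𝐁  = IsVertex 𝐁-vertex
module 𝐁* = IsVertex 𝐁*-vertex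

𝐁-var : ∀ r i F → 𝐁 r (var i * F) ≈ var i * 𝐁 r F - 𝐁 (r ℤ.+ ℤ.+ suc i) F
𝐁-var r i F = trans (𝐁.step r i F)
  (solve 3 (λ a b c → a :+ (:con (ℚ.- ℚ.1ℚ) :* b :+ :con ℚ.0ℚ :* c) := a :- b) refl
    (var i * 𝐁 r F) (𝐁 (r ℤ.+ ℤ.+ suc i) F) (𝐁 (r ℤ.- ℤ.+ suc i) F))

𝐁*-var : ∀ r i F → 𝐁* r (var i * F) ≈ var i * 𝐁* r F + 𝐁* (r ℤ.- ℤ.+ suc i) F
𝐁*-var r i F = trans (𝐁*.step r i F)
  (solve 3 (λ a b c → a :+ (:con ℚ.0ℚ :* b :+ :con ℚ.1ℚ :* c) := a :+ c) refl
    (var i * 𝐁* r F) (𝐁* (r ℤ.+ ℤ.+ suc i) F) (𝐁* (r ℤ.- ℤ.+ suc i) F))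

-- The geometric series 1/(1 - uz) has the powers of u themselves as power sums: n u^n is a sum of n
-- equal products.
up-newton : ∀ b → LS.Newton (λ { zero → L.con 0# ; (suc i) → pow b (suc i) }) (pow b)
up-newton b zero    = LR.trans (LR.trans (LR.*-congʳ LP.nat-0) (LR.zeroˡ _)) (LR.sym (LR.trans (LS.⋆-zero _ (pow b)) (LR.zeroˡ _)))
up-newton b (suc n) = LR.sym (LR.trans (LS.⋆-suc _ (pow b) n) (LR.trans (LR.+-congʳ (LR.zeroˡ _)) (LR.trans (LR.+-identityˡ _)
  (LR.trans (LS.⋆-∑ (pow b ∘ suc) (pow b) n) (LR.trans (LS.∑-cong (suc n) (λ { i (s≤s i≤n) → pow-∸ i n i≤n })) (∑-const (suc n) _))))))
  where
  pow-∸ : ∀ i n → i ≤ n → pow b (suc i) L.* pow b (n ∸ i) L.≈ pow b (suc n)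
  pow-∸ zero    n       _         = LR.trans (LR.*-assoc _ _ _) (LR.*-congˡ (LR.*-identityˡ _))
  pow-∸ (suc i) (suc n) (s≤s i≤n) = LR.trans (LR.*-assoc _ _ _) (LR.*-congˡ (pow-∸ i n i≤n))
  ∑-const : ∀ n x → LS.∑ n (λ _ → x) L.≈ LP.nat n L.* x
  ∑-const zero    x = LR.trans (LS.∑-zero′ _) (LR.sym (LR.trans (LR.*-congʳ LP.nat-0) (LR.zeroˡ _)))
  ∑-const (suc n) x = LR.trans (LS.∑-suc n _) (LR.trans (LR.+-congˡ (∑-const n x))
    (LR.sym (LR.trans (LR.*-congʳ (LP.nat-suc n)) (LR.trans (LR.distribʳ _ _ _) (LR.+-congʳ (LR.*-identityˡ _))))))

-- The series 1 - uz.
lin : ℕ → L.Poly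
lin zero          = L.con 1#
lin (suc zero)    = L.- L.var true
lin (suc (suc _)) = L.con 0#

lin-⋆ : ∀ b n → (lin LS.⋆ b) (suc n) L.≈ b (suc n) L.+ L.- (L.var true L.* b n)
lin-⋆ b zero    = LR.trans (LS.⋆-suc lin b 0) (LR.trans (LR.+-cong (LR.*-identityˡ _) (LS.⋆-zero _ b))
  (solveᴸ 3 (λ u x y → x :+ᴸ (:-ᴸ u) :*ᴸ y :=ᴸ x :+ᴸ :-ᴸ (u :*ᴸ y)) L.≈-refl (L.var true) (b 1) (b 0)))
lin-⋆ b (suc n) = LR.trans (LS.⋆-suc lin b (suc n)) (LR.trans (LR.+-cong (LR.*-identityˡ _)
  (LR.trans (LS.⋆-suc _ b n) (LR.trans (LR.+-congˡ (LR.trans (LS.⋆-comm _ b n) (LS.⋆-zeroʳ b _ n (λ _ → L.≈-refl)))) (LR.+-identityʳ _))))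
  (solveᴸ 3 (λ u x y → x :+ᴸ (:-ᴸ u) :*ᴸ y :=ᴸ x :+ᴸ :-ᴸ (u :*ᴸ y)) L.≈-refl (L.var true) (b (suc (suc n))) (b (suc n))))

lin-powers : ℕ → L.Poly
lin-powers zero    = L.con 0#
lin-powers (suc i) = L.- pow true (suc i)

lin-newton : LS.Newton lin-powers lin
lin-newton n = LR.trans (go n) (LS.⋆-comm lin lin-powers n)
  where
  go : ∀ n → LS.∂ lin n L.≈ (lin LS.⋆ lin-powers) n
  go zero          = LR.trans (LR.trans (LR.*-congʳ LP.nat-0) (LR.zeroˡ _)) (LR.sym (LR.trans (LS.⋆-zero lin lin-powers) (LR.zeroʳ _)))
  go (suc zero)    = LR.sym (LR.trans (lin-⋆ lin-powers 0)
    (solveᴸ 1 (λ u → :-ᴸ (u :*ᴸ :conᴸ ℚ.1ℚ) :+ᴸ :-ᴸ (u :*ᴸ :conᴸ ℚ.0ℚ) :=ᴸ :conᴸ ℚ.1ℚ :*ᴸ (:-ᴸ u)) L.≈-refl (L.var true)))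
  go (suc (suc n)) = LR.sym (LR.trans (lin-⋆ lin-powers (suc n)) (LR.trans
    (solveᴸ 2 (λ u p → :-ᴸ (u :*ᴸ p) :+ᴸ :-ᴸ (u :*ᴸ (:-ᴸ p)) :=ᴸ :conᴸ ℚ.0ℚ) L.≈-refl (L.var true) (pow true (suc n))) (LR.sym (LR.zeroʳ _))))

private
  σ-ψX : ∀ i → C.σ (var i) L.≈ L.- pow true (suc i) L.+ L.con (var i)
  σ-ψX i = solveᴸ 3 (λ p u d → p :+ᴸ (:conᴸ (ℚ.- ℚ.1ℚ) :*ᴸ u :+ᴸ :conᴸ ℚ.0ℚ :*ᴸ d) :=ᴸ :-ᴸ u :+ᴸ p) L.≈-refl (L.con (var i)) (pow true (suc i)) (pow false (suc i))

  σ*-ψX : ∀ i → C*.σ (var i) L.≈ pow false (suc i) L.+ L.con (var i)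
  σ*-ψX i = solveᴸ 3 (λ p u d → p :+ᴸ (:conᴸ ℚ.0ℚ :*ᴸ u :+ᴸ :conᴸ ℚ.1ℚ :*ᴸ d) :=ᴸ d :+ᴸ p) L.≈-refl (L.con (var i)) (pow true (suc i)) (pow false (suc i))

-- Here σ is X ↦ X - u, and Ω[z(X - u)] = (1 - uz) Ω[zX]: both sides solve Newton's identity with
-- power sums p_k - u^k.
σ-Ω-X : ∀ n → C.σ (Ω X n) L.≈ (lin LS.⋆ (L.con ∘ Ω X)) n
σ-Ω-X = LS.newton-unique L.≈-refl
  (λ { zero → LR.sym (LR.+-identityˡ _)
     ; (suc i) → ≡.subst (λ F → C.σ F L.≈ L.- pow true (suc i) L.+ L.con F) (≡.sym (ψ-X i)) (σ-ψX i) })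
  (LR.trans (IsHomomorphism.cong C.σ-isHomomorphism h-0) (LR.sym (LR.trans (LS.⋆-zero _ _) (LR.trans (LR.*-identityˡ _) (L.con-cong h-0)))))
  (L-σ.φ-newton (λ _ → -1ₜ) (λ _ → 0ₜ) {powers X} {Ω X} (Ω-newton X))
  (LS.newton-⋆ {lin-powers} {L.con ∘ powers X} lin-newton (L-con.φ-newton {powers X} {Ω X} (Ω-newton X)))

σ-Ω-negX : ∀ n → C.σ (Ω (- X) n) L.≈ ((L.con ∘ Ω (- X)) LS.⋆ pow true) n
σ-Ω-negX = LS.newton-unique L.≈-refl
  (λ { zero → LR.sym (LR.+-identityˡ _)
     ; (suc i) → ≡.subst (λ F → L.- C.σ F L.≈ L.con (- F) L.+ pow true (suc i)) (≡.sym (ψ-X i))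
         (LR.trans (LR.-‿cong (σ-ψX i)) (LR.trans (solveᴸ 2 (λ u p → :-ᴸ (:-ᴸ u :+ᴸ p) :=ᴸ :-ᴸ p :+ᴸ u) L.≈-refl (pow true (suc i)) (L.con (var i)))
           (LR.+-congʳ (LR.sym (RingMap.φ-neg con-ringMap (var i)))))) })
  (LR.trans (IsHomomorphism.cong C.σ-isHomomorphism e-0) (LR.sym (LR.trans (LS.⋆-zero _ _) (LR.trans (LR.*-identityʳ _) (L.con-cong e-0)))))
  (L-σ.φ-newton (λ _ → -1ₜ) (λ _ → 0ₜ) {powers (- X)} {Ω (- X)} (Ω-newton (- X)))
  (LS.newton-⋆ {L.con ∘ powers (- X)} (L-con.φ-newton {powers (- X)} {Ω (- X)} (Ω-newton (- X))) (up-newton true))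

σ*-Ω-X : ∀ n → C*.σ (Ω X n) L.≈ (pow false LS.⋆ (L.con ∘ Ω X)) n
σ*-Ω-X = LS.newton-unique L.≈-refl
  (λ { zero → LR.sym (LR.+-identityˡ _)
     ; (suc i) → ≡.subst (λ F → C*.σ F L.≈ pow false (suc i) L.+ L.con F) (≡.sym (ψ-X i)) (σ*-ψX i) })
  (LR.trans (IsHomomorphism.cong C*.σ-isHomomorphism h-0) (LR.sym (LR.trans (LS.⋆-zero _ _) (LR.trans (LR.*-identityˡ _) (L.con-cong h-0)))))
  (L-σ.φ-newton (λ _ → 0ₜ) (λ _ → 1ₜ) {powers X} {Ω X} (Ω-newton X))
  (LS.newton-⋆ {b = L.con ∘ Ω X} (up-newton false) (L-con.φ-newton {powers X} {Ω X} (Ω-newton X)))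

σ-h : ∀ r → C.σ (h r) L.≈ L.con (h r) L.+ L.- (L.var true L.* L.con (h (r ℤ.- ℤ.1ℤ)))
σ-h (ℤ.+ zero)  = LR.trans (σ-Ω-X 0) (LR.trans (LS.⋆-zero _ _) (solveᴸ 2 (λ u x → :conᴸ ℚ.1ℚ :*ᴸ x :=ᴸ x :+ᴸ :-ᴸ (u :*ᴸ :conᴸ ℚ.0ℚ)) L.≈-refl (L.var true) (L.con (Ω X 0))))
σ-h (ℤ.+ suc n) = LR.trans (σ-Ω-X (suc n)) (lin-⋆ (L.con ∘ Ω X) n)
σ-h -[1+ n ]    = solveᴸ 1 (λ u → :conᴸ ℚ.0ℚ :=ᴸ :conᴸ ℚ.0ℚ :+ᴸ :-ᴸ (u :*ᴸ :conᴸ ℚ.0ℚ)) L.≈-refl (L.var true)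

act-∑ : ∀ n w g r → LA.act (LS.∑ n w) g r ≈ ∑ n (λ i → LA.act (w i) g r)
act-∑ zero    w g r = trans (LA.act-congˡ (LS.∑-zero′ w) g r) (trans (zeroˡ _) (sym (∑-zero′ _)))
act-∑ (suc n) w g r = trans (LA.act-congˡ (LS.∑-suc n w) g r) (trans (+-congˡ (act-∑ n (w ∘ suc) g r)) (sym (∑-suc n _)))

pos-∸ : ∀ {j m} → j ≤ m → ℤ.+ (m ∸ j) ≡ ℤ.+ m ℤ.- ℤ.+ j
pos-∸ {j} {m} j≤m = ≡.sym (≡.trans (ℤₚ.m-n≡m⊖n m j) (ℤₚ.⊖-≥ j≤m))

pos-neg : ∀ {j m} → m < j → ℤ.+ m ℤ.- ℤ.+ j ℤ.< ℤ.0ℤ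
pos-neg {j} {m} m<j = ≡.subst (λ z → ℤ.+ m ℤ.- ℤ.+ j ℤ.< z) (ℤₚ.+-inverseʳ (ℤ.+ j)) (ℤₚ.+-monoˡ-< (ℤ.- ℤ.+ j) (ℤ.+<+ m<j))

-- Ω[-zX] Ω[zX] = 1, for an integer exponent M and any range long enough; in this form the sum can
-- be cut into two segments in `clifford-base`.
∑-eh : ∀ N M → M ℤ.< ℤ.+ N → ∑ N (λ j → e (ℤ.+ j) * h (M ℤ.- ℤ.+ j)) ≈ coefficient one M
∑-eh N (ℤ.+ k)  (ℤ.+<+ k<N) = begin
  ∑ N (λ j → e (ℤ.+ j) * h (ℤ.+ k ℤ.- ℤ.+ j))
    ≈⟨ ∑-extend _ k<N (λ j k<j → trans (*-congˡ (coefficient-neg (Ω X) (pos-neg k<j))) (zeroʳ _)) ⟩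
  ∑ (suc k) (λ j → e (ℤ.+ j) * h (ℤ.+ k ℤ.- ℤ.+ j))
    ≈⟨ ∑-cong (suc k) (λ { j (s≤s j≤k) → *-congˡ (reflexive (≡.cong h (≡.sym (pos-∸ j≤k)))) }) ⟩
  ∑ (suc k) (λ j → Ω (- X) j * Ω X (k ∸ j))
    ≈⟨ ⋆-∑ (Ω (- X)) (Ω X) k ⟨
  (Ω (- X) ⋆ Ω X) k
    ≈⟨ h⋆e k ⟩
  one k ∎
∑-eh N -[1+ k ] _ = ∑-zero N (λ j _ → trans (*-congˡ (coefficient-neg (Ω X) {r = -[1+ k ] ℤ.- ℤ.+ j} (neg j))) (zeroʳ _))
  where
  neg : ∀ j → -[1+ k ] ℤ.- ℤ.+ j ℤ.< ℤ.0ℤ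
  neg zero    = ℤ.-<+
  neg (suc j) = ℤ.-<+

𝐁*-h : ∀ N s r → s ℤ.< ℤ.+ N → 𝐁* r (h s) ≈ ∑ N (λ i → e (ℤ.+ i ℤ.- r) * h (s ℤ.- ℤ.+ i))
𝐁*-h N (ℤ.+ n) r (ℤ.+<+ n<N) = begin
  𝐁* r (Ω X n)
    ≈⟨ 𝐁*-act (LR.trans (σ*-Ω-X n) (LS.⋆-∑ _ _ n)) r ⟩
  LA.act (LS.∑ (suc n) (λ i → pow false i L.* L.con (Ω X (n ∸ i)))) e⁻ r
    ≈⟨ act-∑ (suc n) _ e⁻ r ⟩
  ∑ (suc n) (λ i → LA.act (pow false i) (λ z → Ω X (n ∸ i) * e⁻ z) r)
    ≈⟨ ∑-cong (suc n) (λ { i (s≤s i≤n) → trans (act-down i _ r) (trans (*-comm _ _)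
         (*-cong (reflexive (≡.cong e (ℤS.solve 2 (λ r i → ℤS.:- (r ℤS.:- i) ℤS.:= i ℤS.:- r) ≡.refl r (ℤ.+ i))))
                 (reflexive (≡.cong h (pos-∸ i≤n))))) }) ⟩
  ∑ (suc n) (λ i → e (ℤ.+ i ℤ.- r) * h (ℤ.+ n ℤ.- ℤ.+ i))
    ≈⟨ ∑-extend _ n<N (λ i n<i → trans (*-congˡ (coefficient-neg (Ω X) (pos-neg n<i))) (zeroʳ _)) ⟨
  ∑ N (λ i → e (ℤ.+ i ℤ.- r) * h (ℤ.+ n ℤ.- ℤ.+ i)) ∎
𝐁*-h N -[1+ n ] r _ = trans (𝐁*.homo-0 r) (sym (∑-zero N (λ { zero _ → zeroʳ _ ; (suc i) _ → zeroʳ _ })))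

𝐁-e : ∀ m s → 𝐁 s (e (ℤ.+ m)) ≈ ∑ (suc m) (λ j → e (ℤ.+ j) * h (s ℤ.+ ℤ.+ (m ∸ j)))
𝐁-e m s = begin
  𝐁 s (Ω (- X) m)
    ≈⟨ 𝐁-act (LR.trans (σ-Ω-negX m) (LS.⋆-∑ _ _ m)) s ⟩
  LA.act (LS.∑ (suc m) (λ j → L.con (Ω (- X) j) L.* pow true (m ∸ j))) h s
    ≈⟨ act-∑ (suc m) _ h s ⟩
  ∑ (suc m) (λ j → Ω (- X) j * LA.act (pow true (m ∸ j)) h s)
    ≈⟨ ∑-cong (suc m) (λ j _ → *-congˡ (act-up (m ∸ j) h s)) ⟩
  ∑ (suc m) (λ j → e (ℤ.+ j) * h (s ℤ.+ ℤ.+ (m ∸ j))) ∎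

𝐁-h : ∀ r s → 𝐁 r (h s) ≈ h s * h r - h (s ℤ.- ℤ.1ℤ) * h (r ℤ.+ ℤ.1ℤ)
𝐁-h r s = 𝐁-act (σ-h s) r

private
  at : ∀ (V : ℤ → Op) {r s F} → r ≡ s → V r F ≈ V s F
  at V {F = F} eq = reflexive (≡.cong (λ z → V z F) eq)

  +1-1 : ∀ r → (r ℤ.+ ℤ.1ℤ) ℤ.- ℤ.1ℤ ≡ r
  +1-1 r = ℤS.solve 1 (λ r → (r ℤS.:+ ℤS.con ℤ.1ℤ) ℤS.:- ℤS.con ℤ.1ℤ ℤS.:= r) ≡.refl r

  -1+1 : ∀ r → (r ℤ.- ℤ.1ℤ) ℤ.+ ℤ.1ℤ ≡ r
  -1+1 r = ℤS.solve 1 (λ r → (r ℤS.:- ℤS.con ℤ.1ℤ) ℤS.:+ ℤS.con ℤ.1ℤ ℤS.:= r) ≡.refl r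

-- The Clifford relations

-- Moving p_k out of `Z r s` only produces `Z` with r or s raised by k, so the case F = 1 decides.
-- There both terms are 2 × 2 determinants in the h, negatives of each other.
𝐁-anticomm : ∀ F r s → 𝐁 r (𝐁 s F) + 𝐁 (s ℤ.- ℤ.1ℤ) (𝐁 (r ℤ.+ ℤ.1ℤ) F) ≈ 0#
𝐁-anticomm = Λ-induction (λ F → ∀ r s → Z r s F ≈ 0#)
  (λ e PF r s → trans (+-cong (𝐁.cong r (𝐁.cong s (sym e))) (𝐁.cong _ (𝐁.cong _ (sym e)))) (PF r s))
  base
  (λ {F} {G} PF PG r s → trans (+-cong (trans (𝐁.cong r (𝐁.homo-+ s F G)) (𝐁.homo-+ r _ _)) (trans (𝐁.cong _ (𝐁.homo-+ _ F G)) (𝐁.homo-+ _ _ _)))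
    (trans (solve 4 (λ a b c d → (a :+ b) :+ (c :+ d) := (a :+ c) :+ (b :+ d)) refl _ _ _ _) (trans (+-cong (PF r s) (PG r s)) (+-identityˡ 0#))))
  (λ a {F} PF r s → trans (+-cong (trans (𝐁.cong r (𝐁.scale s a F)) (𝐁.scale r a _)) (trans (𝐁.cong _ (𝐁.scale _ a F)) (𝐁.scale _ a _)))
    (trans (sym (distribˡ _ _ _)) (trans (*-congˡ (PF r s)) (zeroʳ _))))
  (λ i {F} PF r s → begin
    𝐁 r (𝐁 s (var i * F)) + 𝐁 (s ℤ.- ℤ.1ℤ) (𝐁 (r ℤ.+ ℤ.1ℤ) (var i * F))
      ≈⟨ +-cong (𝐁𝐁-var i F r s) (trans (𝐁𝐁-var i F (s ℤ.- ℤ.1ℤ) (r ℤ.+ ℤ.1ℤ))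
           (+-cong (+-congˡ (-‿cong (at 𝐁 (+-swap s _ _)))) (-‿cong (𝐁.cong _ (at 𝐁 (+-swap r _ _)))))) ⟩
    _ ≈⟨ solve 7 (λ p a b c a′ b′ c′ → (p :* a :- b :- c) :+ (p :* a′ :- b′ :- c′) := p :* (a :+ a′) :- (b :+ c′) :- (c :+ b′)) refl
           (var i) (𝐁 r (𝐁 s F)) (𝐁 (r ℤ.+ ℤ.+ suc i) (𝐁 s F)) (𝐁 r (𝐁 (s ℤ.+ ℤ.+ suc i) F))
           (𝐁 (s ℤ.- ℤ.1ℤ) (𝐁 (r ℤ.+ ℤ.1ℤ) F)) (𝐁 ((s ℤ.+ ℤ.+ suc i) ℤ.- ℤ.1ℤ) (𝐁 (r ℤ.+ ℤ.1ℤ) F)) (𝐁 (s ℤ.- ℤ.1ℤ) (𝐁 ((r ℤ.+ ℤ.+ suc i) ℤ.+ ℤ.1ℤ) F)) ⟩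
    var i * Z r s F - Z (r ℤ.+ ℤ.+ suc i) s F - Z r (s ℤ.+ ℤ.+ suc i) F
      ≈⟨ +-cong (+-cong (*-congˡ (PF r s)) (-‿cong (PF _ s))) (-‿cong (PF r _)) ⟩
    var i * 0# - 0# - 0#
      ≈⟨ solve 1 (λ p → p :* :con ℚ.0ℚ :- :con ℚ.0ℚ :- :con ℚ.0ℚ := :con ℚ.0ℚ) refl (var i) ⟩
    0# ∎)
  where
  Z : ℤ → ℤ → Op
  Z r s F = 𝐁 r (𝐁 s F) + 𝐁 (s ℤ.- ℤ.1ℤ) (𝐁 (r ℤ.+ ℤ.1ℤ) F)

  𝐁𝐁-var : ∀ i F r s → 𝐁 r (𝐁 s (var i * F)) ≈ var i * 𝐁 r (𝐁 s F) - 𝐁 (r ℤ.+ ℤ.+ suc i) (𝐁 s F) - 𝐁 r (𝐁 (s ℤ.+ ℤ.+ suc i) F)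
  𝐁𝐁-var i F r s = trans (𝐁.cong r (𝐁-var s i F)) (trans (𝐁.homo-+ r _ _) (+-cong (𝐁-var r i _) (𝐁.homo-neg r _)))

  base : ∀ r s → Z r s 1# ≈ 0#
  base r s = begin
    Z r s 1#
      ≈⟨ +-cong (trans (𝐁.cong r (𝐁.base s)) (𝐁-h r s)) (trans (𝐁.cong _ (𝐁.base _)) (trans (𝐁-h (s ℤ.- ℤ.1ℤ) (r ℤ.+ ℤ.1ℤ))
           (+-congˡ (-‿cong (*-cong (reflexive (≡.cong h (+1-1 r))) (reflexive (≡.cong h (-1+1 s)))))))) ⟩
    _ ≈⟨ solve 4 (λ a b c d → (a :* b :- c :* d) :+ (d :* c :- b :* a) := :con ℚ.0ℚ) refl (h s) (h r) (h (s ℤ.- ℤ.1ℤ)) (h (r ℤ.+ ℤ.1ℤ)) ⟩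
    0# ∎

private
  i<1+∣i∣ : ∀ i → i ℤ.< ℤ.+ suc ℤ.∣ i ∣
  i<1+∣i∣ (ℤ.+ n)  = ℤ.+<+ (ℕₚ.n<1+n n)
  i<1+∣i∣ -[1+ n ] = ℤ.-<+

-- The two terms are complementary segments of Σ_j e_j h_{M-j} with M = s - r. For r ≥ 0 the second
-- term is 0 and the first is the whole sum; for r = -(m + 1) the second is the part j ≤ m and the
-- first the part j > m.
clifford-base : ∀ r s → 𝐁* r (h s) + 𝐁 (s ℤ.+ ℤ.1ℤ) (e (ℤ.- (r ℤ.+ ℤ.1ℤ))) ≈ coefficient one (s ℤ.- r)
clifford-base (ℤ.+ k) s = begin
  𝐁* (ℤ.+ k) (h s) + 𝐁 (s ℤ.+ ℤ.1ℤ) (e (ℤ.- (ℤ.+ k ℤ.+ ℤ.1ℤ)))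
    ≈⟨ +-cong (𝐁*-h (k ℕ.+ N) s (ℤ.+ k) (ℤₚ.<-≤-trans (i<1+∣i∣ s) (ℤ.+≤+ (ℕₚ.m≤n+m N k))))
        (trans (𝐁.cong _ (coefficient-neg (Ω (- X)) (ℤₚ.neg-mono-< {x = ℤ.0ℤ} (ℤ.+<+ (ℕₚ.m≤n+m 1 k))))) (𝐁.homo-0 _)) ⟩
  ∑ (k ℕ.+ N) g + 0#
    ≈⟨ trans (+-identityʳ _) (∑-++ k N g) ⟩
  ∑ k g + ∑ N (λ j → g (k ℕ.+ j))
    ≈⟨ +-cong (∑-zero k (λ i i<k → trans (*-congʳ (coefficient-neg (Ω (- X)) (pos-neg i<k))) (zeroˡ _)))
        (∑-cong N (λ j _ → *-cong
          (reflexive (≡.cong e (ℤS.solve 2 (λ k j → (k ℤS.:+ j) ℤS.:- k ℤS.:= j) ≡.refl (ℤ.+ k) (ℤ.+ j))))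
          (reflexive (≡.cong h (ℤS.solve 3 (λ s k j → s ℤS.:- (k ℤS.:+ j) ℤS.:= (s ℤS.:- k) ℤS.:- j) ≡.refl s (ℤ.+ k) (ℤ.+ j)))))) ⟩
  0# + ∑ N (λ j → e (ℤ.+ j) * h ((s ℤ.- ℤ.+ k) ℤ.- ℤ.+ j))
    ≈⟨ trans (+-identityˡ _) (∑-eh N (s ℤ.- ℤ.+ k) (ℤₚ.≤-<-trans (ℤₚ.i-j≤i s (ℤ.+ k)) (i<1+∣i∣ s))) ⟩
  coefficient one (s ℤ.- ℤ.+ k) ∎
  where
  N = suc ℤ.∣ s ∣
  g : ℕ → Λ
  g i = e (ℤ.+ i ℤ.- ℤ.+ k) * h (s ℤ.- ℤ.+ i)
clifford-base -[1+ m ] s = begin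
  𝐁* -[1+ m ] (h s) + 𝐁 (s ℤ.+ ℤ.1ℤ) (e (ℤ.- (-[1+ m ] ℤ.+ ℤ.1ℤ)))
    ≈⟨ +-cong (𝐁*-h N s -[1+ m ] (i<1+∣i∣ s)) (trans (𝐁.cong _ (reflexive (≡.cong e
        (ℤS.solve 1 (λ m → ℤS.:- ((ℤS.:- (ℤS.con ℤ.1ℤ ℤS.:+ m)) ℤS.:+ ℤS.con ℤ.1ℤ) ℤS.:= m) ≡.refl (ℤ.+ m))))) (𝐁-e m _)) ⟩
  ∑ N (λ i → e (ℤ.+ i ℤ.+ ℤ.+ suc m) * h (s ℤ.- ℤ.+ i)) + ∑ (suc m) (λ j → e (ℤ.+ j) * h ((s ℤ.+ ℤ.1ℤ) ℤ.+ ℤ.+ (m ∸ j)))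
    ≈⟨ +-comm _ _ ⟩
  _
    ≈⟨ +-cong (∑-cong (suc m) (λ { j (s≤s j≤m) → *-congˡ (reflexive (≡.cong h (≡.trans (≡.cong (λ z → (s ℤ.+ ℤ.1ℤ) ℤ.+ z) (pos-∸ j≤m))
           (ℤS.solve 3 (λ s m j → (s ℤS.:+ ℤS.con ℤ.1ℤ) ℤS.:+ (m ℤS.:- j) ℤS.:= (s ℤS.:+ (ℤS.con ℤ.1ℤ ℤS.:+ m)) ℤS.:- j) ≡.refl s (ℤ.+ m) (ℤ.+ j))))) }))
        (∑-cong N (λ i _ → *-cong (reflexive (≡.cong e (ℤₚ.+-comm (ℤ.+ i) (ℤ.+ suc m)))) (reflexive (≡.cong h
           (ℤS.solve 3 (λ s m i → s ℤS.:- i ℤS.:= (s ℤS.:+ m) ℤS.:- (m ℤS.:+ i)) ≡.refl s (ℤ.+ suc m) (ℤ.+ i)))))) ⟩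
  ∑ (suc m) g + ∑ N (λ i → g (suc m ℕ.+ i))
    ≈⟨ ∑-++ (suc m) N g ⟨
  ∑ (suc m ℕ.+ N) g
    ≈⟨ ∑-eh (suc m ℕ.+ N) M (≡.subst (λ z → M ℤ.< z) (ℤₚ.+-comm (ℤ.+ N) (ℤ.+ suc m)) (ℤₚ.+-monoˡ-< (ℤ.+ suc m) (i<1+∣i∣ s))) ⟩
  coefficient one M ∎
  where
  N = suc ℤ.∣ s ∣
  M = s ℤ.+ ℤ.+ suc m
  g : ℕ → Λ
  g j = e (ℤ.+ j) * h (M ℤ.- ℤ.+ j)

-- Multiplication by p_k lowers r in `𝐁*` and raises s in `𝐁`, with opposite signs. Both changes
-- turn s - r into s - r + k, so the additional scalars cancel and the case F = 1 decides.
clifford : ∀ F r s → 𝐁* r (𝐁 s F) + 𝐁 (s ℤ.+ ℤ.1ℤ) (𝐁* (r ℤ.+ ℤ.1ℤ) F) ≈ coefficient one (s ℤ.- r) * F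
clifford = Λ-induction (λ F → ∀ r s → Z r s F ≈ coefficient one (s ℤ.- r) * F)
  (λ e PF r s → trans (+-cong (𝐁*.cong r (𝐁.cong s (sym e))) (𝐁.cong _ (𝐁*.cong _ (sym e)))) (trans (PF r s) (*-congˡ e)))
  (λ r s → trans (+-cong (𝐁*.cong r (𝐁.base s)) (𝐁.cong _ (𝐁*.base _))) (trans (clifford-base r s) (sym (*-identityʳ _))))
  (λ {F} {G} PF PG r s → trans (+-cong (trans (𝐁*.cong r (𝐁.homo-+ s F G)) (𝐁*.homo-+ r _ _)) (trans (𝐁.cong _ (𝐁*.homo-+ _ F G)) (𝐁.homo-+ _ _ _)))
    (trans (solve 4 (λ a b c d → (a :+ b) :+ (c :+ d) := (a :+ c) :+ (b :+ d)) refl _ _ _ _) (trans (+-cong (PF r s) (PG r s)) (sym (distribˡ _ _ _)))))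
  (λ a {F} PF r s → trans (+-cong (trans (𝐁*.cong r (𝐁.scale s a F)) (𝐁*.scale r a _)) (trans (𝐁.cong _ (𝐁*.scale _ a F)) (𝐁.scale _ a _)))
    (trans (sym (distribˡ _ _ _)) (trans (*-congˡ (PF r s)) (solve 3 (λ a u F → a :* (u :* F) := u :* (a :* F)) refl (con a) (coefficient one (s ℤ.- r)) F))))
  (λ i {F} PF r s → begin
    𝐁* r (𝐁 s (var i * F)) + 𝐁 (s ℤ.+ ℤ.1ℤ) (𝐁* (r ℤ.+ ℤ.1ℤ) (var i * F))
      ≈⟨ +-cong (trans (𝐁*.cong r (𝐁-var s i F)) (trans (𝐁*.homo-+ r _ _) (+-cong (𝐁*-var r i _) (𝐁*.homo-neg r _))))
          (trans (𝐁.cong _ (𝐁*-var _ i F)) (trans (𝐁.homo-+ _ _ _) (+-cong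
            (trans (𝐁-var _ i _) (+-congˡ (-‿cong (at 𝐁 (+-swap s _ _)))))
            (𝐁.cong _ (at 𝐁* (+-swap r _ _)))))) ⟩
    _ ≈⟨ solve 7 (λ p a b c a′ b′ c′ → (p :* a :+ b :- c) :+ (p :* a′ :- b′ :+ c′) := p :* (a :+ a′) :+ (b :+ c′) :- (c :+ b′)) refl
           (var i) (𝐁* r (𝐁 s F)) (𝐁* (r ℤ.- ℤ.+ suc i) (𝐁 s F)) (𝐁* r (𝐁 (s ℤ.+ ℤ.+ suc i) F))
           (𝐁 (s ℤ.+ ℤ.1ℤ) (𝐁* (r ℤ.+ ℤ.1ℤ) F)) (𝐁 ((s ℤ.+ ℤ.+ suc i) ℤ.+ ℤ.1ℤ) (𝐁* (r ℤ.+ ℤ.1ℤ) F)) (𝐁 (s ℤ.+ ℤ.1ℤ) (𝐁* ((r ℤ.- ℤ.+ suc i) ℤ.+ ℤ.1ℤ) F)) ⟩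
    var i * Z r s F + Z (r ℤ.- ℤ.+ suc i) s F - Z r (s ℤ.+ ℤ.+ suc i) F
      ≈⟨ +-cong (+-cong (*-congˡ (PF r s)) (PF _ s)) (-‿cong (trans (PF r _) (*-congʳ (reflexive (≡.cong (coefficient one)
           (ℤS.solve 3 (λ r s k → (s ℤS.:+ k) ℤS.:- r ℤS.:= s ℤS.:- (r ℤS.:- k)) ≡.refl r s (ℤ.+ suc i))))))) ⟩
    _
      ≈⟨ solve 4 (λ p c F u → p :* (c :* F) :+ u :* F :- u :* F := c :* (p :* F)) refl (var i) (coefficient one (s ℤ.- r)) F (coefficient one (s ℤ.- (r ℤ.- ℤ.+ suc i))) ⟩
    coefficient one (s ℤ.- r) * (var i * F) ∎)
  where
  Z : ℤ → ℤ → Op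
  Z r s F = 𝐁* r (𝐁 s F) + 𝐁 (s ℤ.+ ℤ.1ℤ) (𝐁* (r ℤ.+ ℤ.1ℤ) F)

-- The Hall form

ε : Λ → ℚ[t]
ε (con a) = a
ε (var i) = K.con ℚ.0ℚ
ε (F + G) = ε F K.+ ε G
ε (F * G) = ε F K.* ε G
ε (- F)   = K.- ε F

ε-isHomomorphism : IsHomomorphism ℚ[t]-commutativeRing ℕ ℚ[t]-commutativeRing ε
ε-isHomomorphism = record
  { homo-+ = λ _ _ → K.≈-refl ; homo-* = λ _ _ → K.≈-refl ; homo-neg = λ _ → K.≈-refl
  ; con-cong = λ e → e ; con-+ = λ a b → K.≈-refl ; con-* = λ a b → K.≈-refl
  ; con-0 = K.≈-refl ; con-1 = K.≈-refl }

ε-cong : ∀ {F G} → F ≈ G → ε F K.≈ ε G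
ε-cong = IsHomomorphism.cong ε-isHomomorphism

con-injective : ∀ {a b} → con a ≈ con b → a K.≈ b
con-injective = ε-cong

-- The scalar product with ⟨p_λ , p_μ⟩ = z_λ δ_λμ.
opaque
  ⟦_∣_⟧ : Λ → Λ → ℚ[t]
  ⟦ F ∣ G ⟧ = ε (G ∙ F)

  hall-cong : ∀ {F F′ G G′} → F ≈ F′ → G ≈ G′ → ⟦ F ∣ G ⟧ K.≈ ⟦ F′ ∣ G′ ⟧
  hall-cong e e′ = ε-cong (∙-cong e′ e)

  hall-+ˡ : ∀ F F′ G → ⟦ F + F′ ∣ G ⟧ K.≈ ⟦ F ∣ G ⟧ K.+ ⟦ F′ ∣ G ⟧
  hall-+ˡ F F′ G = ε-cong (∙-+ G F F′)

  hall-+ʳ : ∀ F G G′ → ⟦ F ∣ G + G′ ⟧ K.≈ ⟦ F ∣ G ⟧ K.+ ⟦ F ∣ G′ ⟧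
  hall-+ʳ F G G′ = K.≈-refl

  hall-scaleˡ : ∀ a F G → ⟦ con a * F ∣ G ⟧ K.≈ a K.* ⟦ F ∣ G ⟧
  hall-scaleˡ a F G = ε-cong (∙-scale G a F)

  hall-scaleʳ : ∀ a F G → ⟦ F ∣ con a * G ⟧ K.≈ a K.* ⟦ F ∣ G ⟧
  hall-scaleʳ a F G = K.≈-refl

  hall-varˡ : ∀ i F G → ⟦ var i * F ∣ G ⟧ K.≈ ⟦ F ∣ D i G ⟧
  hall-varˡ i F G = K.≈-trans (ε-cong (∙-var G i F)) (KR.trans (KR.+-congʳ (KR.zeroˡ _)) (KR.+-identityˡ _))

  hall-varʳ : ∀ i F G → ⟦ F ∣ var i * G ⟧ K.≈ ⟦ D i F ∣ G ⟧
  hall-varʳ i F G = ε-cong (sym (∙-D G i F))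

  hall-∙ : ∀ P F G → ⟦ P ∙ F ∣ G ⟧ K.≈ ⟦ F ∣ P * G ⟧
  hall-∙ P F G = ε-cong (∙-comm G P F)

  hall-1ʳ : ∀ F → ⟦ F ∣ 1# ⟧ K.≈ ε F
  hall-1ʳ F = ε-cong (*-identityˡ F)

hall-0ˡ : ∀ G → ⟦ 0# ∣ G ⟧ K.≈ K.con ℚ.0ℚ
hall-0ˡ G = KR.trans (hall-cong (sym (zeroˡ 0#)) refl) (KR.trans (hall-scaleˡ _ 0# G) (KR.zeroˡ _))

hall-0ʳ : ∀ F → ⟦ F ∣ 0# ⟧ K.≈ K.con ℚ.0ℚ
hall-0ʳ F = KR.trans (hall-cong refl (sym (zeroˡ 0#))) (KR.trans (hall-scaleʳ _ F 0#) (KR.zeroˡ _))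

hall-sym : ∀ F G → ⟦ F ∣ G ⟧ K.≈ ⟦ G ∣ F ⟧
hall-sym = Λ-induction (λ F → ∀ G → ⟦ F ∣ G ⟧ K.≈ ⟦ G ∣ F ⟧)
  (λ e PF G → KR.trans (hall-cong (sym e) refl) (KR.trans (PF G) (hall-cong refl e)))
  (Λ-induction (λ G → ⟦ 1# ∣ G ⟧ K.≈ ⟦ G ∣ 1# ⟧)
    (λ e PG → KR.trans (hall-cong refl (sym e)) (KR.trans PG (hall-cong e refl)))
    K.≈-refl
    (λ PF PG → KR.trans (hall-+ʳ _ _ _) (KR.trans (KR.+-cong PF PG) (KR.sym (hall-+ˡ _ _ _))))
    (λ a PF → KR.trans (hall-scaleʳ a _ _) (KR.trans (KR.*-congˡ PF) (KR.sym (hall-scaleˡ a _ _))))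
    (λ i {G} _ → KR.trans (hall-varʳ i 1# G) (KR.trans (hall-0ˡ G) (KR.sym (KR.trans (hall-varˡ i G 1#) (hall-0ʳ G))))))
  (λ PF PG G → KR.trans (hall-+ˡ _ _ G) (KR.trans (KR.+-cong (PF G) (PG G)) (KR.sym (hall-+ʳ G _ _))))
  (λ a PF G → KR.trans (hall-scaleˡ a _ G) (KR.trans (KR.*-congˡ (PF G)) (KR.sym (hall-scaleʳ a G _))))
  (λ i {F} PF G → KR.trans (hall-varˡ i F G) (KR.trans (PF (D i G)) (KR.sym (hall-varʳ i G F))))

module Λ-ε = SequenceHomomorphism Λℚ Kℚ (ringMap _ _ _ ε-isHomomorphism) (λ _ → K.≈-refl)

ε-Ω : ∀ {A} → (∀ i → ε (ψ (suc i) A) K.≈ K.con ℚ.0ℚ) → ∀ n → ε (Ω A (suc n)) K.≈ K.con ℚ.0ℚ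
ε-Ω {A} ε-ψ n = KP.nat-cancel n (KR.trans (Λ-ε.φ-newton {powers A} (Ω-newton A) (suc n)) (KR.trans
  (KR.trans (KS.⋆-comm _ (ε ∘ Ω A) (suc n)) (KS.⋆-zeroʳ (ε ∘ Ω A) (ε ∘ powers A) (suc n) (λ { zero → K.≈-refl ; (suc i) → ε-ψ i })))
  (KR.sym (KR.zeroʳ _))))

-- Both constant terms are 1 at r = 0 and 0 elsewhere; the two sequences extend in opposite
-- directions.
ε-h≈ε-e⁻ : ∀ r → ε (h r) K.≈ ε (e⁻ r)
ε-h≈ε-e⁻ (ℤ.+ zero)  = ε-cong (trans h-0 (sym e-0))
ε-h≈ε-e⁻ (ℤ.+ suc n) = ε-Ω {X} (λ i → KR.reflexive (≡.cong ε (ψ-X i))) n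
ε-h≈ε-e⁻ -[1+ n ]    = KR.sym (ε-Ω { - X} (λ i → KR.trans (ε-cong (ψ-negX i)) (KR.zeroʳ _)) n)

D-𝐁* : ∀ i F r → D i (𝐁* r F) ≈ 𝐁* r (D i F) - 𝐁* (r ℤ.+ ℤ.+ suc i) F
D-𝐁* i F r = trans (D-vertex 𝐁*-vertex i -1ₜ (ℤ.+ suc i) (λ r → trans (D-e i (ℤ.- r))
    (trans (-‿cong (reflexive (≡.cong e (≡.sym (ℤₚ.neg-distrib-+ r (ℤ.+ suc i)))))) (con-1 _))) F r)
  (+-congˡ (sym (con-1 _)))

-- Each p_k in F moves to the right as `D`, whose commutator with `𝐁*` matches the term -𝐁_{r+k} of
-- `𝐁-var`. What remains is F = 1, which is settled by moving the p_k of G to the left, where they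
-- lower the index of h_r.
𝐁-adjoint : ∀ F r G → ⟦ 𝐁 r F ∣ G ⟧ K.≈ ⟦ F ∣ 𝐁* r G ⟧
𝐁-adjoint = Λ-induction (λ F → ∀ r G → ⟦ 𝐁 r F ∣ G ⟧ K.≈ ⟦ F ∣ 𝐁* r G ⟧)
  (λ e PF r G → KR.trans (hall-cong (𝐁.cong r (sym e)) refl) (KR.trans (PF r G) (hall-cong e refl)))
  (λ r G → KR.trans (hall-cong (𝐁.base r) refl) (base G r))
  (λ PF PG r G → KR.trans (hall-cong (𝐁.homo-+ r _ _) refl) (KR.trans (hall-+ˡ _ _ G) (KR.trans (KR.+-cong (PF r G) (PG r G)) (KR.sym (hall-+ˡ _ _ _)))))
  (λ a PF r G → KR.trans (hall-cong (𝐁.scale r a _) refl) (KR.trans (hall-scaleˡ a _ G) (KR.trans (KR.*-congˡ (PF r G)) (KR.sym (hall-scaleˡ a _ _)))))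
  (λ i {F} PF r G → KR.trans (hall-cong (𝐁-var r i F) refl) (KR.trans (hall-+ˡ _ _ G) (KR.trans
    (KR.+-cong (KR.trans (hall-varˡ i _ G) (PF r (D i G))) (KR.trans (negˡ _ G) (KR.trans (KR.-‿cong (PF _ G)) (KR.sym (negʳ F _)))))
    (KR.sym (KR.trans (hall-varˡ i F _) (KR.trans (hall-cong refl (D-𝐁* i G r)) (hall-+ʳ F _ _)))))))
  where
  module KG = Algebra.Properties.Group KR.+-group

  negˡ : ∀ F G → ⟦ - F ∣ G ⟧ K.≈ K.- ⟦ F ∣ G ⟧
  negˡ F G = KG.inverseˡ-unique _ _ (KR.trans (KR.sym (hall-+ˡ (- F) F G)) (KR.trans (hall-cong (-‿inverseˡ F) refl) (hall-0ˡ G)))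

  negʳ : ∀ F G → ⟦ F ∣ - G ⟧ K.≈ K.- ⟦ F ∣ G ⟧
  negʳ F G = KR.trans (hall-sym F (- G)) (KR.trans (negˡ G F) (KR.-‿cong (hall-sym G F)))

  base : ∀ G r → ⟦ h r ∣ G ⟧ K.≈ ⟦ 1# ∣ 𝐁* r G ⟧
  base = Λ-induction (λ G → ∀ r → ⟦ h r ∣ G ⟧ K.≈ ⟦ 1# ∣ 𝐁* r G ⟧)
    (λ e PG r → KR.trans (hall-cong refl (sym e)) (KR.trans (PG r) (hall-cong refl (𝐁*.cong r e))))
    (λ r → KR.trans (hall-1ʳ _) (KR.trans (ε-h≈ε-e⁻ r) (KR.sym (KR.trans (hall-cong refl (𝐁*.base r)) (KR.trans (hall-sym _ _) (hall-1ʳ _))))))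
    (λ PF PG r → KR.trans (hall-+ʳ _ _ _) (KR.trans (KR.+-cong (PF r) (PG r)) (KR.sym (KR.trans (hall-cong refl (𝐁*.homo-+ r _ _)) (hall-+ʳ _ _ _)))))
    (λ a PF r → KR.trans (hall-scaleʳ a _ _) (KR.trans (KR.*-congˡ (PF r)) (KR.sym (KR.trans (hall-cong refl (𝐁*.scale r a _)) (hall-scaleʳ a _ _)))))
    (λ i {G} PG r → KR.trans (hall-varʳ i (h r) G) (KR.trans (hall-cong (D-h i r) refl) (KR.trans (PG _)
      (KR.sym (KR.trans (hall-cong refl (𝐁*-var r i G)) (KR.trans (hall-+ʳ _ _ _) (KR.trans (KR.+-congʳ
        (KR.trans (hall-varʳ i 1# _) (hall-0ˡ _))) (KR.+-identityˡ _))))))))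

-- Orthonormality of the functions 𝐁_{λ₁} 𝐁_{λ₂} ⋯ 1

bern : List ℕ → Λ
bern = foldr (λ m → 𝐁 (ℤ.+ m)) 1#

-- Relevant evidence in place of the irrelevant fields of `Partition`; every head bounds its whole
-- tail, the form in which the Clifford relation is applied.
data IsPartition : List ℕ → Set where
  []   : IsPartition []
  cons : ∀ {m ms} → 0 < m → All (_≤ m) ms → IsPartition ms → IsPartition (m ∷ ms)

-- The Clifford scalar vanishes as m < r, so 𝐁*_r passes each 𝐁_m with its index raised by one,
-- until it meets 1, which it kills because its index is positive.
𝐁*-bern : ∀ ms r → 0 < r → All (_< r) ms → 𝐁* (ℤ.+ r) (bern ms) ≈ 0#
𝐁*-bern []       (suc r) _   _              = 𝐁*.base _
𝐁*-bern (m ∷ ms) r       0<r (m<r ∷ ms<r) = begin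
  𝐁* (ℤ.+ r) (𝐁 (ℤ.+ m) (bern ms))
    ≈⟨ +-identityʳ _ ⟨
  𝐁* (ℤ.+ r) (𝐁 (ℤ.+ m) (bern ms)) + 0#
    ≈⟨ +-congˡ (trans (𝐁.cong _ (𝐁*-bern ms (r ℕ.+ 1) (ℕₚ.≤-trans 0<r (ℕₚ.m≤m+n r 1)) (All.map (λ i<r → ℕₚ.≤-trans i<r (ℕₚ.m≤m+n r 1)) ms<r))) (𝐁.homo-0 _)) ⟨
  𝐁* (ℤ.+ r) (𝐁 (ℤ.+ m) (bern ms)) + 𝐁 (ℤ.+ m ℤ.+ ℤ.1ℤ) (𝐁* (ℤ.+ r ℤ.+ ℤ.1ℤ) (bern ms))
    ≈⟨ clifford (bern ms) (ℤ.+ r) (ℤ.+ m) ⟩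
  coefficient one (ℤ.+ m ℤ.- ℤ.+ r) * bern ms
    ≈⟨ trans (*-congʳ (coefficient-neg one (pos-neg m<r))) (zeroˡ _) ⟩
  0# ∎

-- For equal indices the Clifford scalar is 1, and the other term contains 𝐁*_{m+1}, whose index
-- exceeds every part.
𝐁*-𝐁-bern : ∀ m ms → All (_≤ m) ms → 𝐁* (ℤ.+ m) (𝐁 (ℤ.+ m) (bern ms)) ≈ bern ms
𝐁*-𝐁-bern m ms ms≤m = begin
  𝐁* (ℤ.+ m) (𝐁 (ℤ.+ m) (bern ms))
    ≈⟨ +-identityʳ _ ⟨
  𝐁* (ℤ.+ m) (𝐁 (ℤ.+ m) (bern ms)) + 0#
    ≈⟨ +-congˡ (trans (𝐁.cong _ (𝐁*-bern ms (m ℕ.+ 1) (ℕₚ.m≤n+m 1 m) (All.map (λ {i} i≤m → ≡.subst (λ z → i < z) (ℕₚ.+-comm 1 m) (s≤s i≤m)) ms≤m))) (𝐁.homo-0 _)) ⟨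
  𝐁* (ℤ.+ m) (𝐁 (ℤ.+ m) (bern ms)) + 𝐁 (ℤ.+ m ℤ.+ ℤ.1ℤ) (𝐁* (ℤ.+ m ℤ.+ ℤ.1ℤ) (bern ms))
    ≈⟨ clifford (bern ms) (ℤ.+ m) (ℤ.+ m) ⟩
  coefficient one (ℤ.+ m ℤ.- ℤ.+ m) * bern ms
    ≈⟨ trans (*-congʳ (reflexive (≡.cong (coefficient one) (ℤₚ.+-inverseʳ (ℤ.+ m))))) (*-identityˡ _) ⟩
  bern ms ∎

bern-normal : ∀ {ms} → IsPartition ms → ⟦ bern ms ∣ bern ms ⟧ K.≈ K.con ℚ.1ℚ
bern-normal []                             = hall-1ʳ 1#
bern-normal {m ∷ ms} (cons _ ms≤m ms-part) = KR.trans (𝐁-adjoint _ _ _)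
  (KR.trans (hall-cong refl (𝐁*-𝐁-bern m ms ms≤m)) (bern-normal ms-part))

-- The adjoint of the larger first part kills the other function; equal first parts cancel and the
-- tails are compared.
bern-orthogonal : ∀ {ms ns} → IsPartition ms → IsPartition ns → ¬ ms ≡ ns → ⟦ bern ms ∣ bern ns ⟧ K.≈ K.con ℚ.0ℚ
bern-orthogonal-> : ∀ {m ms ns} → IsPartition (m ∷ ms) → All (_< m) ns → ⟦ bern (m ∷ ms) ∣ bern ns ⟧ K.≈ K.con ℚ.0ℚ
bern-orthogonal-> {m} {ms} {ns} (cons 0<m _ _) ns<m = KR.trans (𝐁-adjoint _ _ _)
  (KR.trans (hall-cong refl (𝐁*-bern ns m 0<m ns<m)) (hall-0ʳ _))
bern-orthogonal []                  []                   ms≢ns = contradiction ≡.refl ms≢ns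
bern-orthogonal []                  ns@(cons _ _ _)      _     = KR.trans (hall-sym _ _) (bern-orthogonal-> ns [])
bern-orthogonal ms@(cons _ _ _)     []                   _     = bern-orthogonal-> ms []
bern-orthogonal {m ∷ ms} {n ∷ ns} pm@(cons _ ms≤m pm′) pn@(cons _ ns≤n pn′) ms≢ns with ℕₚ.<-cmp m n
... | tri< m<n _ _    = KR.trans (hall-sym _ _) (bern-orthogonal-> pn (m<n ∷ All.map (λ i≤m → ℕₚ.≤-<-trans i≤m m<n) ms≤m))
... | tri> _ _ n<m    = bern-orthogonal-> pm (n<m ∷ All.map (λ i≤n → ℕₚ.≤-<-trans i≤n n<m) ns≤n)
... | tri≈ _ ≡.refl _ = KR.trans (𝐁-adjoint _ _ _) (KR.trans (hall-cong refl (𝐁*-𝐁-bern m ns ns≤n))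
  (bern-orthogonal pm′ pn′ (λ { ≡.refl → ms≢ns ≡.refl })))

-- The functions B_{λ₁} B_{λ₂} ⋯ 1 span Λ

-- The index bounds the parts, so that 𝐁_m can be put in front of any combination in `Span m`.
data Span (b : ℕ) : Λ → Set where
  basis : ∀ {ms} → IsPartition ms → All (_≤ b) ms → Span b (bern ms)
  addˢ   : ∀ {F G} → Span b F → Span b G → Span b (F + G)
  scaleˢ : ∀ a {F} → Span b F → Span b (con a * F)
  respˢ  : ∀ {F G} → F ≈ G → Span b F → Span b G

Span-0 : ∀ {b} → Span b 0#
Span-0 = respˢ (zeroˡ _) (scaleˢ (K.con ℚ.0ℚ) (basis [] []))

Span-neg : ∀ {b F} → Span b F → Span b (- F)
Span-neg SF = respˢ (sym (con-1 _)) (scaleˢ -1ₜ SF)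

Span-mono : ∀ {b b′ F} → b ≤ b′ → Span b F → Span b′ F
Span-mono b≤b′ (basis pm ms≤b) = basis pm (All.map (λ i≤b → ℕₚ.≤-trans i≤b b≤b′) ms≤b)
Span-mono b≤b′ (addˢ SF SG)     = addˢ (Span-mono b≤b′ SF) (Span-mono b≤b′ SG)
Span-mono b≤b′ (scaleˢ a SF)    = scaleˢ a (Span-mono b≤b′ SF)
Span-mono b≤b′ (respˢ e SF)     = respˢ e (Span-mono b≤b′ SF)

𝐁-cons : ∀ {m b F} → m ≤ b → Span m F → Span b (𝐁 (ℤ.+ m) F)
-- Parts bounded by 0 leave only `bern []`, and 𝐁₀ 1 = h₀ = 1; so no zero part arises.
𝐁-cons {zero}  m≤b (basis [] _)                       = respˢ (sym (trans (𝐁.base _) h-0)) (basis [] [])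
𝐁-cons {zero}  m≤b (basis (cons 0<m _ _) (m≤0 ∷ _))   = contradiction (ℕₚ.≤-trans 0<m m≤0) (λ ())
𝐁-cons {suc m} m≤b (basis pm ms≤m)                    = basis (cons (s≤s z≤n) ms≤m pm) (m≤b ∷ All.map (λ i≤m → ℕₚ.≤-trans i≤m m≤b) ms≤m)
𝐁-cons         m≤b (addˢ SF SG)                        = respˢ (sym (𝐁.homo-+ _ _ _)) (addˢ (𝐁-cons m≤b SF) (𝐁-cons m≤b SG))
𝐁-cons         m≤b (scaleˢ a SF)                       = respˢ (sym (𝐁.scale _ a _)) (scaleˢ a (𝐁-cons m≤b SF))
𝐁-cons         m≤b (respˢ e SF)                        = respˢ (𝐁.cong _ e) (𝐁-cons m≤b SF)

x+x≈0 : ∀ {x} → x + x ≈ 0# → x ≈ 0#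
x+x≈0 {x} e = nat-cancel 1 (trans (*-congʳ (nat-suc 1)) (trans (distribʳ _ _ _) (trans (+-cong (*-identityˡ x) (*-identityˡ x)) (trans e (sym (zeroʳ _))))))

-- Uses 𝐁_r 𝐁_{m+1} = -𝐁_m 𝐁_{r+1}. If r < m, recursion puts 𝐁_{r+1} ⋯ 1 into `Span m`, where 𝐁_m
-- can be prepended; if r = m, the product is its own negative; if r > m, the list is already
-- decreasing. The bound `suc b` on the parts fits the recursive call, whose parts lie below the old
-- head m + 1.
𝐁-straighten : ∀ {b ms} r → IsPartition ms → All (_≤ suc b) ms → r ℤ.≤ ℤ.+ b → Span b (𝐁 r (bern ms))
𝐁-straighten (ℤ.+ zero)  [] _ _            = respˢ (sym (trans (𝐁.base _) h-0)) (basis [] [])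
𝐁-straighten (ℤ.+ suc n) [] _ (ℤ.+≤+ n<b)  = basis (cons (s≤s z≤n) [] []) (n<b ∷ [])
𝐁-straighten -[1+ n ]    [] _ _            = respˢ (sym (𝐁.base _)) Span-0
𝐁-straighten {b} {suc m ∷ ms} r (cons 0<m ms≤m pm) (s≤s m≤b ∷ _) r≤b with ℤₚ.<-cmp r (ℤ.+ m)
... | tri< r<m _ _    = respˢ (sym (inverseˡ-unique _ _ (𝐁-anticomm (bern ms) r (ℤ.+ suc m))))
  (Span-neg (𝐁-cons m≤b (𝐁-straighten (r ℤ.+ ℤ.1ℤ) pm ms≤m (≡.subst (λ z → z ℤ.≤ ℤ.+ m) (ℤₚ.+-comm ℤ.1ℤ r) (ℤₚ.i<j⇒suc[i]≤j r<m)))))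
... | tri≈ _ ≡.refl _ = respˢ (sym (x+x≈0 (trans (+-congˡ (reflexive (≡.cong (λ z → 𝐁 (ℤ.+ m) (𝐁 (ℤ.+ z) (bern ms))) (ℕₚ.+-comm 1 m)))) (𝐁-anticomm (bern ms) (ℤ.+ m) (ℤ.+ suc m))))) Span-0
... | tri> _ _ m<r with r | m<r | r≤b
...   | ℤ.+ n | ℤ.+<+ m<n | ℤ.+≤+ n≤b = basis (cons (ℕₚ.≤-trans 0<m m<n) (m<n ∷ All.map (λ i≤m → ℕₚ.≤-trans i≤m m<n) ms≤m) (cons 0<m ms≤m pm))
  (n≤b ∷ ℕₚ.≤-trans m<n n≤b ∷ All.map (λ i≤m → ℕₚ.≤-trans i≤m (ℕₚ.≤-trans m<n n≤b)) ms≤m)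

InSpan : Λ → Set
InSpan F = ∃[ b ] Span b F

in-resp : ∀ {F G} → F ≈ G → InSpan F → InSpan G
in-resp e (b , SF) = b , respˢ e SF

in-add : ∀ {F G} → InSpan F → InSpan G → InSpan (F + G)
in-add (b , SF) (c , SG) = b ℕ.⊔ c , addˢ (Span-mono (ℕₚ.m≤m⊔n b c) SF) (Span-mono (ℕₚ.m≤n⊔m b c) SG)

in-scale : ∀ a {F} → InSpan F → InSpan (con a * F)
in-scale a (b , SF) = b , scaleˢ a SF

in-neg : ∀ {F} → InSpan F → InSpan (- F)
in-neg (b , SF) = b , Span-neg SF

in-∑ : ∀ n {g} → (∀ i → i < n → InSpan (g i)) → InSpan (∑ n g)
in-∑ zero    _ = in-resp (sym (∑-zero′ _)) (0 , Span-0)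
in-∑ (suc n) e = in-resp (sym (∑-suc n _)) (in-add (e 0 (s≤s z≤n)) (in-∑ n (λ i i<n → e (suc i) (s≤s i<n))))

in-𝐁 : ∀ r {F} → InSpan F → InSpan (𝐁 r F)
in-𝐁 r (b , basis pm ms≤b) = b ℕ.⊔ ℤ.∣ r ∣ , 𝐁-straighten r pm
  (All.map (λ i≤b → ℕₚ.≤-trans i≤b (ℕₚ.≤-trans (ℕₚ.m≤m⊔n b ℤ.∣ r ∣) (ℕₚ.n≤1+n _))) ms≤b)
  (ℤₚ.≤-trans (i≤∣i∣ r) (ℤ.+≤+ (ℕₚ.m≤n⊔m b ℤ.∣ r ∣)))
  where
  i≤∣i∣ : ∀ i → i ℤ.≤ ℤ.+ ℤ.∣ i ∣
  i≤∣i∣ (ℤ.+ n)  = ℤₚ.≤-refl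
  i≤∣i∣ -[1+ n ] = ℤ.-≤+
in-𝐁 r (b , addˢ SF SG)   = in-resp (sym (𝐁.homo-+ r _ _)) (in-add (in-𝐁 r (b , SF)) (in-𝐁 r (b , SG)))
in-𝐁 r (b , scaleˢ a SF)  = in-resp (sym (𝐁.scale r a _)) (in-scale a (in-𝐁 r (b , SF)))
in-𝐁 r (b , respˢ e SF)   = in-resp (𝐁.cong r e) (in-𝐁 r (b , SF))

in-1 : InSpan 1#
in-1 = 0 , basis [] []

in-h : ∀ r → InSpan (h r)
in-h r = in-resp (𝐁.base r) (in-𝐁 r in-1)

-- Newton's identity solved for its last power sum, whose coefficient is h₀ = 1. It reduces p_{n+1}
-- to h_{n+1} and products of smaller power sums with some h.
var-newton : ∀ n → nat (suc n) * Ω X (suc n) - ∑ n (λ i → var i * Ω X (n ∸ i)) ≈ var n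
var-newton n = begin
  nat (suc n) * Ω X (suc n) - S
    ≈⟨ +-congʳ (trans (Ω-newton X (suc n)) (trans (⋆-suc (powers X) (Ω X) n) (trans (+-congʳ (zeroˡ _)) (+-identityˡ _)))) ⟩
  (powers X ∘ suc ⋆ Ω X) n - S
    ≈⟨ +-congʳ (trans (⋆-congʳ n (λ i _ → reflexive (ψ-X i))) (trans (⋆-∑ var (Ω X) n)
         (trans (reflexive (≡.cong (λ z → ∑ z (λ i → var i * Ω X (n ∸ i))) (ℕₚ.+-comm 1 n))) (trans (∑-++ n 1 _)
           (+-congˡ (trans (∑-suc 0 _) (trans (+-congˡ (∑-zero′ _)) (+-identityʳ _)))))))) ⟩
  (S + var (n ℕ.+ 0) * Ω X (n ∸ (n ℕ.+ 0))) - S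
    ≈⟨ solve 2 (λ s x → s :+ x :- s := x) refl S (var (n ℕ.+ 0) * Ω X (n ∸ (n ℕ.+ 0))) ⟩
  var (n ℕ.+ 0) * Ω X (n ∸ (n ℕ.+ 0))
    ≈⟨ reflexive (≡.cong (λ z → var z * Ω X (n ∸ z)) (ℕₚ.+-identityʳ n)) ⟩
  var n * Ω X (n ∸ n)
    ≈⟨ trans (*-congˡ (trans (reflexive (≡.cong (Ω X) (ℕₚ.n∸n≡0 n))) (Ω-0 X))) (*-identityʳ _) ⟩
  var n ∎
  where S = ∑ n (λ i → var i * Ω X (n ∸ i))

-- An outer recursion on k obtains p_{k+1} itself from `var-newton`. An inner one on the list uses
-- p_{k+1} 𝐁_m = 𝐁_m p_{k+1} + 𝐁_{m+k+1}, whose last term is straightened. The bound n makes the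
-- outer recursion structural.
in-var-* : ∀ n k → k < n → ∀ {F} → InSpan F → InSpan (var k * F)
in-var-* (suc n) k (s≤s k≤n) (b , SF) = in-span b SF
  where
  in-var : InSpan (var k)
  in-var = in-resp (var-newton k) (in-add (in-scale _ (in-h (ℤ.+ suc k)))
    (in-neg (in-∑ k (λ i i<k → in-var-* n i (ℕₚ.<-≤-trans i<k k≤n) (in-h (ℤ.+ (k ∸ i)))))))
  in-bern : ∀ ms b → Span b (bern ms) → IsPartition ms → InSpan (var k * bern ms)
  in-bern []       b S _             = in-resp (sym (*-identityʳ _)) in-var
  in-bern (m ∷ ms) b S (cons _ ≤m pm) = in-resp
    (trans (+-congʳ (𝐁-var (ℤ.+ m) k (bern ms))) (solve 2 (λ x y → x :- y :+ y := x) refl _ (𝐁 (ℤ.+ m ℤ.+ ℤ.+ suc k) (bern ms))))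
    (in-add (in-𝐁 (ℤ.+ m) (in-bern ms m (basis pm ≤m) pm)) (in-𝐁 _ (m , basis pm ≤m)))
  in-span : ∀ b {F} → Span b F → InSpan (var k * F)
  in-span b (basis {ms} pm ≤b) = in-bern ms b (basis pm ≤b) pm
  in-span b (addˢ SF SG)   = in-resp (sym (distribˡ _ _ _)) (in-add (in-span b SF) (in-span b SG))
  in-span b (scaleˢ a {F} SF)  = in-resp (solve 3 (λ a p F → a :* (p :* F) := p :* (a :* F)) refl (con a) (var k) F) (in-scale a (in-span b SF))
  in-span b (respˢ e SF)   = in-resp (*-congˡ e) (in-span b SF)

spanning : ∀ F → InSpan F
spanning = Λ-induction InSpan in-resp in-1 in-add in-scale (λ i → in-var-* (suc i) i (ℕₚ.n<1+n i))

-- The Jacobi–Trudi formula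

private
  open Algebra.Properties.Semiring.Exp semiring using (_^_)

  module σ-det = DeterminantHomomorphism (σ-ringMap (λ _ → -1ₜ) (λ _ → 0ₜ))
  module con-det = DeterminantHomomorphism con-ringMap

det≈ : ∀ {n} (M : Fin n → Fin n → Λ) → det M ≈ DΛ.det M
det≈ {zero}  M = refl
det≈ {suc n} M = DΛ.sum-cong {g = DΛ.cofactor M} (λ j → *-congˡ (*-congˡ (det≈ (λ a b → M (suc a) (punchIn j b)))))

act-sum : ∀ {n} (f : Fin n → L.Poly) g r → LA.act (LSum.sum f) g r ≈ ΛSum.sum (λ j → LA.act (f j) g r)
act-sum {zero}  f g r = zeroˡ _
act-sum {suc n} f g r = +-congˡ (act-sum (f ∘ suc) g r)

module _ {l} (β : Fin l → ℤ) where

  private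
    -- Bordered by the row (1, u, u², …); letting u act on h turns this row into h_r, h_{r+1}, ….
    bordered : Fin (suc l) → Fin (suc l) → L.Poly
    bordered zero    b = pow true (toℕ b)
    bordered (suc a) b = L.con (h (β a ℤ.+ ℤ.+ toℕ b))

    -- Subtracting u times the left neighbour turns the border into (1, 0, ..., 0) and every h_n
    -- outside the first column into h_n - u h_{n-1}, which is σ of h_n. So the determinant is σ of
    -- the unbordered one.
    reduced : Fin (suc l) → Fin (suc l) → L.Poly
    reduced a zero    = bordered a zero
    reduced a (suc j) = bordered a (suc j) L.+ (L.- L.var true) L.* bordered a (inject₁ j)

    reduced-det : DL.det reduced L.≈ C.σ (DΛ.det (λ a b → h (β a ℤ.+ ℤ.+ suc (toℕ b))))
    reduced-det = LR.trans (LR.+-cong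
      (LR.trans (LR.*-identityˡ _) (LR.trans (LR.*-identityˡ _) (DL.det-cong {N = λ a b → C.σ (h (β a ℤ.+ ℤ.+ suc (toℕ b)))} minor)))
      (DL.sum-zero {f = λ j → DL.cofactor reduced (suc j)} (λ j → LR.trans (LR.*-congˡ (LR.trans (LR.*-congʳ (border j)) (LR.zeroˡ _))) (LR.zeroʳ _))))
      (LR.trans (LR.+-identityʳ _) (LR.sym (σ-det.φ-det (λ a b → h (β a ℤ.+ ℤ.+ suc (toℕ b))))))
      where
      border : ∀ j → reduced zero (suc j) L.≈ L.con 0#
      border j = LR.trans (LR.+-congˡ (LR.*-congˡ (LR.reflexive (≡.cong (pow true) (Finₚ.toℕ-inject₁ j)))))
        (solveᴸ 2 (λ u p → u :*ᴸ p :+ᴸ (:-ᴸ u) :*ᴸ p :=ᴸ :conᴸ ℚ.0ℚ) L.≈-refl (L.var true) (pow true (toℕ j)))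
      minor : ∀ a b → reduced (suc a) (suc b) L.≈ C.σ (h (β a ℤ.+ ℤ.+ suc (toℕ b)))
      minor a b = LR.trans (LR.+-congˡ (LR.trans (LR.*-congˡ (LR.reflexive (≡.cong (λ z → L.con (h z))
          (≡.trans (≡.cong (λ n → β a ℤ.+ ℤ.+ n) (Finₚ.toℕ-inject₁ b))
            (ℤS.solve 2 (λ x y → x ℤS.:+ y ℤS.:= (x ℤS.:+ (ℤS.con ℤ.1ℤ ℤS.:+ y)) ℤS.:- ℤS.con ℤ.1ℤ) ≡.refl (β a) (ℤ.+ toℕ b))))))
          (solveᴸ 2 (λ u x → (:-ᴸ u) :*ᴸ x :=ᴸ :-ᴸ (u :*ᴸ x)) L.≈-refl (L.var true) _)))
        (LR.sym (σ-h (β a ℤ.+ ℤ.+ suc (toℕ b))))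

  extended : ℤ → Fin (suc l) → Fin (suc l) → Λ
  extended r zero    b = h (r ℤ.+ ℤ.+ toℕ b)
  extended r (suc a) b = h (β a ℤ.+ ℤ.+ toℕ b)

  -- 𝐁_r F is σ F acting on h at r. Once σ F is written as the bordered determinant, expansion along
  -- the border replaces each u^b by h_{r+b}, the new first row.
  𝐁-det : ∀ r → 𝐁 r (DΛ.det (λ a b → h (β a ℤ.+ ℤ.+ suc (toℕ b)))) ≈ DΛ.det (extended r)
  𝐁-det r = trans (𝐁-act (LR.trans (LR.sym reduced-det) (DL.det-addColumns reduced bordered (L.- L.var true) (λ _ → L.≈-refl) (λ _ _ → L.≈-refl))) r)
    (trans (act-sum (DL.cofactor bordered) h r) (DΛ.sum-cong {f = λ j → LA.act (DL.cofactor bordered j) h r} {DΛ.cofactor (extended r)} (λ j → begin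
      LA.act (DL.cofactor bordered j) h r
        ≈⟨ LA.act-congˡ (LR.*-cong (LR.trans (LR.reflexive ≡.refl) (LR.sym (con-det.φ-sign (toℕ j))))
             (LR.*-congˡ {x = pow true (toℕ j)} (LR.sym (con-det.φ-det (λ a b → h (β a ℤ.+ ℤ.+ toℕ (punchIn j b))))))) h r ⟩
      (- 1#) ^ toℕ j * LA.act (pow true (toℕ j)) (λ z → minor j * h z) r
        ≈⟨ *-congˡ (trans (act-up (toℕ j) (λ z → minor j * h z) r) (*-comm _ _)) ⟩
      DΛ.cofactor (extended r) j ∎)))
    where
    minor : Fin (suc l) → Λ
    minor j = DΛ.det (λ a b → h (β a ℤ.+ ℤ.+ toℕ (punchIn j b)))

jacobiTrudi : (ms : List ℕ) → Fin (length ms) → Fin (length ms) → Λ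
jacobiTrudi ms i j = h ((ℤ.+ lookup ms i ℤ.- ℤ.+ toℕ i) ℤ.+ ℤ.+ toℕ j)

bern-det : ∀ ms → bern ms ≈ DΛ.det (jacobiTrudi ms)
bern-det []       = refl
bern-det (m ∷ ms) = begin
  𝐁 (ℤ.+ m) (bern ms)
    -- Row and column numbers of the tail both grow by one, which leaves its entries unchanged.
    ≈⟨ 𝐁.cong _ (trans (bern-det ms) (DΛ.det-cong {M = jacobiTrudi ms} (λ a b → reflexive (≡.cong h
         (ℤS.solve 3 (λ x i j → (x ℤS.:- i) ℤS.:+ j ℤS.:= (x ℤS.:- (ℤS.con ℤ.1ℤ ℤS.:+ i)) ℤS.:+ (ℤS.con ℤ.1ℤ ℤS.:+ j)) ≡.refl (ℤ.+ lookup ms a) (ℤ.+ toℕ a) (ℤ.+ toℕ b)))))) ⟩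
  𝐁 (ℤ.+ m) (DΛ.det (λ a b → h (β a ℤ.+ ℤ.+ suc (toℕ b))))
    ≈⟨ 𝐁-det β (ℤ.+ m) ⟩
  DΛ.det (extended β (ℤ.+ m))
    ≈⟨ DΛ.det-cong {M = extended β (ℤ.+ m)} {jacobiTrudi (m ∷ ms)} entries ⟩
  DΛ.det (jacobiTrudi (m ∷ ms)) ∎
  where
  β : Fin (length ms) → ℤ
  β a = ℤ.+ lookup ms a ℤ.- ℤ.+ suc (toℕ a)
  entries : ∀ a b → extended β (ℤ.+ m) a b ≈ jacobiTrudi (m ∷ ms) a b
  entries zero    b = reflexive (≡.cong (λ z → h (z ℤ.+ ℤ.+ toℕ b)) (≡.sym (ℤₚ.+-identityʳ (ℤ.+ m))))
  entries (suc a) b = refl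

s≈bern : ∀ λ′ → s λ′ ≈ bern (parts λ′)
s≈bern λ′ = trans (det≈ (jacobiTrudi (parts λ′))) (sym (bern-det (parts λ′)))

-- Decidability is what allows `recompute` to turn the irrelevant fields of a `Partition` into
-- relevant evidence.
isPartition? : ∀ ms → Dec (IsPartition ms)
isPartition? []       = yes []
isPartition? (m ∷ ms) = map′ (λ { (0<m , ≤m , pm) → cons 0<m ≤m pm }) (λ { (cons 0<m ≤m pm) → 0<m , ≤m , pm })
  ((0 ℕₚ.<? m) ×-dec (All.all? (ℕₚ._≤? m) ms ×-dec isPartition? ms))

parts-isPartition : ∀ λ′ → IsPartition (parts λ′)
parts-isPartition (partition ms dec pos) = recompute (isPartition? ms) (convert (Linked⇒AllPairs (λ i≥j j≥k → ℕₚ.≤-trans j≥k i≥j) dec) pos)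
  where
  convert : ∀ {ms} → AllPairs ℕ._≥_ ms → All (ℕ._> 0) ms → IsPartition ms
  convert []       []         = []
  convert (≥s ∷ d) (0<m ∷ ps) = cons 0<m ≥s (convert d ps)

toPartition : ∀ {ms} → IsPartition ms → ∃[ λ′ ] parts λ′ ≡ ms
toPartition {ms} pm = partition ms (decreasing′ pm) (positive′ pm) , ≡.refl
  where
  decreasing′ : ∀ {ms} → IsPartition ms → Linked ℕ._≥_ ms
  decreasing′ []                                   = []
  decreasing′ (cons {ms = []}    _ _         _)    = [-]
  decreasing′ (cons {ms = _ ∷ _} _ (≤m ∷ _)  pm)   = ≤m ∷ decreasing′ pm
  positive′ : ∀ {ms} → IsPartition ms → All (ℕ._> 0) ms
  positive′ []              = []
  positive′ (cons 0<m _ pm) = 0<m ∷ positive′ pm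

s-toPartition : ∀ {ms} (pm : IsPartition ms) → s (proj₁ (toPartition pm)) ≈ bern ms
s-toPartition pm = trans (s≈bern (proj₁ (toPartition pm))) (reflexive (≡.cong bern (proj₂ (toPartition pm))))

parts-injective : ∀ {λ′ ν} → parts λ′ ≡ parts ν → λ′ ≡ ν
parts-injective {partition _ _ _} {partition _ _ _} ≡.refl = ≡.refl

infix 4 _≟ᵖ_
_≟ᵖ_ : DecidableEquality Partition
λ′ ≟ᵖ ν = map′ parts-injective (≡.cong parts) (Listₚ.≡-dec ℕₚ._≟_ (parts λ′) (parts ν))

s-normal : ∀ λ′ → ⟦ s λ′ ∣ s λ′ ⟧ K.≈ K.con ℚ.1ℚ
s-normal λ′ = K.≈-trans (hall-cong (s≈bern λ′) (s≈bern λ′)) (bern-normal (parts-isPartition λ′))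

s-orthogonal : ∀ {λ′ ν} → ¬ λ′ ≡ ν → ⟦ s λ′ ∣ s ν ⟧ K.≈ K.con ℚ.0ℚ
s-orthogonal {λ′} {ν} λ≢ν = K.≈-trans (hall-cong (s≈bern λ′) (s≈bern ν))
  (bern-orthogonal (parts-isPartition λ′) (parts-isPartition ν) (λ e → λ≢ν (parts-injective e)))

open import Data.List.Relation.Unary.Unique.DecPropositional.Properties _≟ᵖ_ using (deduplicate-!)

-- Uniqueness of the scalar product and of P^⊥

foldr-zero : ∀ {A : Set} (g : A → Λ) ls → All (λ y → g y ≈ 0#) ls → foldr (λ y G → g y + G) 0# ls ≈ 0#
foldr-zero g []       []       = refl
foldr-zero g (y ∷ ls) (e ∷ es) = trans (+-cong e (foldr-zero g ls es)) (+-identityˡ 0#)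

foldr-single : ∀ {A : Set} (g : A → Λ) {x ls} → (∀ y → ¬ y ≡ x → g y ≈ 0#) → Unique ls → x ∈ ls →
  foldr (λ y G → g y + G) 0# ls ≈ g x
foldr-single g {ls = x ∷ ls} e (x≢ ∷ _) (here ≡.refl) =
  trans (+-congˡ (foldr-zero g ls (All.map (λ x≢y → e _ (λ y≡x → x≢y (≡.sym y≡x))) x≢))) (+-identityʳ _)
foldr-single g {ls = y ∷ ls} e (y≢ ∷ u) (there x∈) =
  trans (+-cong (e y (All.lookup y≢ x∈)) (foldr-single g e u x∈)) (+-identityˡ _)

foldr-cong : ∀ {A : Set} {g g′ : A → Λ} ls → (∀ y → g y ≈ g′ y) → foldr (λ y G → g y + G) 0# ls ≈ foldr (λ y G → g′ y + G) 0# ls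
foldr-cong []       e = refl
foldr-cong (y ∷ ls) e = +-cong (e y) (foldr-cong ls e)

foldr-+ : ∀ {A : Set} (g g′ : A → Λ) ls → foldr (λ y G → (g y + g′ y) + G) 0# ls ≈ foldr (λ y G → g y + G) 0# ls + foldr (λ y G → g′ y + G) 0# ls
foldr-+ g g′ []       = sym (+-identityˡ 0#)
foldr-+ g g′ (y ∷ ls) = trans (+-congˡ (foldr-+ g g′ ls))
  (solve 4 (λ a b c d → (a :+ b) :+ (c :+ d) := (a :+ c) :+ (b :+ d)) refl (g y) (g′ y) (foldr (λ y G → g y + G) 0# ls) (foldr (λ y G → g′ y + G) 0# ls))

foldr-* : ∀ {A : Set} (g : A → Λ) c ls → foldr (λ y G → c * g y + G) 0# ls ≈ c * foldr (λ y G → g y + G) 0# ls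
foldr-* g c []       = sym (zeroʳ c)
foldr-* g c (y ∷ ls) = trans (+-congˡ (foldr-* g c ls)) (sym (distribˡ _ _ _))

component : Λ → Partition → Λ
component F λ′ = con ⟦ F ∣ s λ′ ⟧ * s λ′

projection : List Partition → Op
projection ls F = foldr (λ λ′ G → component F λ′ + G) 0# ls

-- Asking for every repetition-free list that contains `ls`, not for `ls` alone, makes the property
-- closed under addition: two expansions share a larger list.
IsExpanded : Λ → Set
IsExpanded F = ∃[ ls ] (∀ {ls′} → Unique ls′ → (∀ {λ′} → λ′ ∈ ls → λ′ ∈ ls′) → projection ls′ F ≈ F)

expanded-s : ∀ λ′ → IsExpanded (s λ′)
expanded-s λ′ = λ′ ∷ [] , λ {ls′} u ⊆ls′ → trans
  (foldr-single (component (s λ′)) (λ ν ν≢λ → trans (*-congʳ (Λ′.con-cong (s-orthogonal (λ e → ν≢λ (≡.sym e))))) (zeroˡ _)) u (⊆ls′ (here ≡.refl)))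
  (trans (*-congʳ (Λ′.con-cong (s-normal λ′))) (*-identityˡ _))

expanded-+ : ∀ {F G} → IsExpanded F → IsExpanded G → IsExpanded (F + G)
expanded-+ {F} {G} (ls , e) (ls′ , e′) = ls ++ ls′ , λ {ls″} u ⊆ls″ → trans
  (foldr-cong ls″ (λ λ′ → trans (*-congʳ (trans (Λ′.con-cong (hall-+ˡ F G (s λ′))) (Λ′.con-+ _ _))) (distribʳ _ _ _)))
  (trans (foldr-+ (component F) (component G) ls″) (+-cong (e u (λ λ∈ → ⊆ls″ (∈-++⁺ˡ λ∈))) (e′ u (λ λ∈ → ⊆ls″ (∈-++⁺ʳ ls λ∈)))))

expanded-scale : ∀ a {F} → IsExpanded F → IsExpanded (con a * F)
expanded-scale a {F} (ls , e) = ls , λ {ls′} u ⊆ls′ → trans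
  (foldr-cong ls′ (λ λ′ → trans (*-congʳ (trans (Λ′.con-cong (hall-scaleˡ a F (s λ′))) (Λ′.con-* _ _))) (*-assoc _ _ _)))
  (trans (foldr-* (component F) (con a) ls′) (*-congˡ (e u ⊆ls′)))

expanded-resp : ∀ {F G} → F ≈ G → IsExpanded F → IsExpanded G
expanded-resp F≈G (ls , e) = ls , λ {ls′} u ⊆ls′ →
  trans (foldr-cong ls′ (λ λ′ → *-congʳ (Λ′.con-cong (hall-cong (sym F≈G) refl)))) (trans (e u ⊆ls′) F≈G)

expand : ∀ {b F} → Span b F → IsExpanded F
expand (basis pm _)  = expanded-resp (s-toPartition pm) (expanded-s (proj₁ (toPartition pm)))
expand (addˢ SF SG)  = expanded-+ (expand SF) (expand SG)
expand (scaleˢ a SF) = expanded-scale a (expand SF)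
expand (respˢ e SF)  = expanded-resp e (expand SF)

-- F equals its own projection, whose coefficients are the pairings of F with Schur functions.
hall-nondegenerate : ∀ {F} → (∀ G → ⟦ F ∣ G ⟧ K.≈ K.con ℚ.0ℚ) → F ≈ 0#
hall-nondegenerate {F} F⊥ = vanish (expand (proj₂ (spanning F)))
  where
  vanish : IsExpanded F → F ≈ 0#
  vanish (ls , e) = trans (sym (e (deduplicate-! ls) (∈-deduplicate⁺ _≟ᵖ_)))
    (foldr-zero (component F) (deduplicate _≟ᵖ_ ls) (All.universal (λ λ′ → trans (*-congʳ (Λ′.con-cong (F⊥ (s λ′)))) (zeroˡ _)) _))

module Pairing (S : ScalarProduct) where

  open ScalarProduct S renaming (cong to ⟨⟩-cong)

  ⟨⟩-s : ∀ {λ′ ν} → Dec (λ′ ≡ ν) → ⟨ s λ′ , s ν ⟩ K.≈ ⟦ s λ′ ∣ s ν ⟧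
  ⟨⟩-s {λ′} (yes ≡.refl) = KR.trans (normal λ′) (KR.sym (s-normal λ′))
  ⟨⟩-s      (no λ≢ν)     = KR.trans (orthogonal λ≢ν) (KR.sym (s-orthogonal λ≢ν))

  ⟨⟩-bern : ∀ {ms ns} → IsPartition ms → IsPartition ns → ⟨ bern ms , bern ns ⟩ K.≈ ⟦ bern ms ∣ bern ns ⟧
  ⟨⟩-bern pm pn = KR.trans (⟨⟩-cong (sym (s-toPartition pm)) (sym (s-toPartition pn)))
    (KR.trans (⟨⟩-s (proj₁ (toPartition pm) ≟ᵖ proj₁ (toPartition pn))) (hall-cong (s-toPartition pm) (s-toPartition pn)))

  ⟨⟩≈hall : ∀ F G → ⟨ F , G ⟩ K.≈ ⟦ F ∣ G ⟧
  ⟨⟩≈hall F G = on-span (proj₂ (spanning F)) (proj₂ (spanning G))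
    where
    on-basis : ∀ {ms c G} → IsPartition ms → Span c G → ⟨ bern ms , G ⟩ K.≈ ⟦ bern ms ∣ G ⟧
    on-basis pm (basis pn _)  = ⟨⟩-bern pm pn
    on-basis pm (addˢ SG SG′)  = KR.trans (additiveʳ _ _ _) (KR.trans (KR.+-cong (on-basis pm SG) (on-basis pm SG′)) (KR.sym (hall-+ʳ _ _ _)))
    on-basis pm (scaleˢ a SG)  = KR.trans (scalarʳ a _ _) (KR.trans (KR.*-congˡ (on-basis pm SG)) (KR.sym (hall-scaleʳ a _ _)))
    on-basis pm (respˢ e SG)   = KR.trans (⟨⟩-cong refl (sym e)) (KR.trans (on-basis pm SG) (hall-cong refl e))
    on-span : ∀ {b c F G} → Span b F → Span c G → ⟨ F , G ⟩ K.≈ ⟦ F ∣ G ⟧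
    on-span (basis pm _)  SG = on-basis pm SG
    on-span (addˢ SF SF′)  SG = KR.trans (additiveˡ _ _ _) (KR.trans (KR.+-cong (on-span SF SG) (on-span SF′ SG)) (KR.sym (hall-+ˡ _ _ _)))
    on-span (scaleˢ a SF)  SG = KR.trans (scalarˡ a _ _) (KR.trans (KR.*-congˡ (on-span SF SG)) (KR.sym (hall-scaleˡ a _ _)))
    on-span (respˢ e SF)   SG = KR.trans (⟨⟩-cong (sym e) refl) (KR.trans (on-span SF SG) (hall-cong e refl))

  module _ (adj : Adjoints S) where

    open Adjoints adj

    ⊥≈∙ : ∀ P F → (P ⊥) F ≈ P ∙ F
    ⊥≈∙ P F = trans (inverseˡ-unique _ _ (hall-nondegenerate (λ G → begin′ G))) (solve 1 (λ x → :- (:- x) := x) refl (P ∙ F))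
      where
      begin′ : ∀ G → ⟦ (P ⊥) F + - (P ∙ F) ∣ G ⟧ K.≈ K.con ℚ.0ℚ
      begin′ G = KR.trans (hall-+ˡ _ _ G) (KR.trans (KR.+-congʳ (KR.trans (KR.sym (⟨⟩≈hall _ G)) (KR.trans (adjoint P F G)
        (KR.trans (⟨⟩≈hall F (P * G)) (KR.sym (hall-∙ P F G))))))
        (KR.trans (KR.sym (hall-+ˡ _ _ G)) (KR.trans (hall-cong (-‿inverseʳ _) refl) (hall-0ˡ G))))

-- The operators Ω[A]^⊥

∙-additive : ∀ P → IsAdditive (P ∙_)
∙-additive P = record { cong = ∙-cong (refl {P}) ; homo-+ = ∙-+ P }

∑-∙ : ∀ N g F → ∑ N g ∙ F ≈ ∑ N (λ i → g i ∙ F)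
∑-∙ zero    g F = trans (∙-cong (∑-zero′ g) refl) (trans (zeroˡ F) (sym (∑-zero′ _)))
∑-∙ (suc N) g F = trans (∙-cong (∑-suc N g) refl) (trans (+-congˡ (∑-∙ N (g ∘ suc) F)) (sym (∑-suc N _)))

-- By Newton's identity, (n + 1) Ω A (n + 1) is a sum of products with a factor p_k[A] (or 0), and
-- that factor can be applied to F before the other one.
Ω-kills : ∀ {A F} → (∀ i → ψ (suc i) A ∙ F ≈ 0#) → ∀ n → Ω A (suc n) ∙ F ≈ 0#
Ω-kills {A} {F} ψ-kills n = nat-cancel n (begin
  nat (suc n) * (Ω A (suc n) ∙ F)
    ≈⟨ ∙-cong (trans (Ω-newton A (suc n)) (trans (⋆-comm (powers A) (Ω A) (suc n)) (⋆-∑ (Ω A) (powers A) (suc n)))) refl ⟩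
  ∑ (suc (suc n)) (λ i → Ω A i * powers A (suc n ∸ i)) ∙ F
    ≈⟨ ∑-∙ (suc (suc n)) _ F ⟩
  ∑ (suc (suc n)) (λ i → Ω A i ∙ (powers A (suc n ∸ i) ∙ F))
    ≈⟨ ∑-zero (suc (suc n)) (λ i _ → trans (∙-cong (refl {Ω A i}) (powers-kill (suc n ∸ i))) (∙-0 (Ω A i))) ⟩
  0#
    ≈⟨ zeroʳ _ ⟨
  nat (suc n) * 0# ∎)
  where
  powers-kill : ∀ j → powers A j ∙ F ≈ 0#
  powers-kill zero    = zeroˡ F
  powers-kill (suc i) = ψ-kills i

Ω-0-∙ : ∀ A F → Ω A 0 ∙ F ≈ F
Ω-0-∙ A F = trans (∙-cong (Ω-0 A) refl) (*-identityˡ F)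

⋆-∙-vanish : ∀ {F d} b → (∀ m → d < m → b m ∙ F ≈ 0#) → ∀ k {w} n → (∀ j → k ≤ j → w j ≈ 0#) → k ℕ.+ d ≤ n → (w ⋆ b) n ∙ F ≈ 0#
⋆-∙-vanish {F} b bF zero    {w} n       w₀ _         = trans (∙-cong (trans (⋆-comm w b n) (⋆-zeroʳ b w n (λ i → w₀ i z≤n))) refl) (zeroˡ F)
⋆-∙-vanish {F} {d} b bF (suc k) {w} (suc n) w₀ (s≤s k+d≤n) = trans (∙-cong (⋆-suc w b n) refl) (trans (+-cong
  (trans (∙-cong (refl {w 0}) (bF (suc n) (s≤s (ℕₚ.≤-trans (ℕₚ.m≤n+m d k) k+d≤n)))) (∙-0 (w 0)))
  (⋆-∙-vanish b bF k n (λ j k≤j → w₀ (suc j) (s≤s k≤j)) k+d≤n)) (+-identityˡ 0#))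

-- Evaluation of a product of series at u = 1, with truncations: w is supported below k, the sums
-- for b have reached G beyond d, and those for the product have reached their limit from k + d on.
∑-⋆-∙ : ∀ {F G d} b → (∀ N → d < N → ∑ N (λ n → b n ∙ F) ≈ G) →
  ∀ k {w} N → (∀ j → k ≤ j → w j ≈ 0#) → k ℕ.+ d ≤ N → ∑ N (λ n → (w ⋆ b) n ∙ F) ≈ ∑ k w ∙ G
∑-⋆-∙ {F} b bF zero    {w} N w₀ _ = trans
  (∑-zero N (λ n _ → trans (∙-cong (trans (⋆-comm w b n) (⋆-zeroʳ b w n (λ i → w₀ i z≤n))) refl) (zeroˡ F)))
  (sym (trans (∙-cong (∑-zero′ w) refl) (zeroˡ _)))
∑-⋆-∙ {F} {G} {d} b bF (suc k) {w} (suc N) w₀ (s≤s k+d≤N) = begin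
  ∑ (suc N) (λ n → (w ⋆ b) n ∙ F)
    ≈⟨ trans (∑-suc N _) (+-cong (∙-cong (⋆-zero w b) refl) (trans (∑-cong N (λ n _ → ∙-cong (⋆-suc w b n) refl)) (∑-+ N _ _))) ⟩
  w 0 ∙ b 0 ∙ F + (∑ N (λ n → w 0 ∙ b (suc n) ∙ F) + ∑ N (λ n → (w ∘ suc ⋆ b) n ∙ F))
    ≈⟨ +-assoc _ _ _ ⟨
  (w 0 ∙ b 0 ∙ F + ∑ N (λ n → w 0 ∙ b (suc n) ∙ F)) + ∑ N (λ n → (w ∘ suc ⋆ b) n ∙ F)
    ≈⟨ +-cong (trans (sym (∑-suc N (λ n → w 0 ∙ b n ∙ F))) (trans (sym (IsAdditive.homo-∑ (∙-additive (w 0)) (suc N) _))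
         (∙-cong (refl {w 0}) (bF (suc N) (s≤s (ℕₚ.≤-trans (ℕₚ.m≤n+m d k) k+d≤N))))))
         (∑-⋆-∙ b bF k N (λ j k≤j → w₀ (suc j) (s≤s k≤j)) k+d≤N) ⟩
  w 0 ∙ G + ∑ k (w ∘ suc) ∙ G
    ≈⟨ ∙-cong (∑-suc k w) refl ⟨
  ∑ (suc k) w ∙ G ∎

-- The concrete form of Ω[A]^⊥.
opaque
  skewΩ : Λ → Op
  skewΩ A F = ∑ (suc (deg F)) (λ n → Ω A n ∙ F)

  skewΩ-∑ : ∀ A F → skewΩ A F ≈ ∑ (suc (deg F)) (λ n → Ω A n ∙ F)
  skewΩ-∑ A F = refl

-- By `bounded`, the derivative of log Ω[uA] under `D i` is a polynomial in u of degree at most i +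
-- 1, so its value at u = 1 is the finite sum `κ i`.
module ΩOperator (A : Λ) (bounded : ∀ i j → suc i < j → D i (logΩ A j) ≈ 0#)
  (Ω-∙-1 : ∀ n → Ω A (suc n) ∙ 1# ≈ 0#) where

  E : Op
  E = skewΩ A

  κ : ℕ → Λ
  κ i = ∑ (suc (suc i)) (λ j → D i (logΩ A j))

  Ω-∙-var : ∀ i n F → Ω A n ∙ (var i * F) ≈ var i * (Ω A n ∙ F) + ((λ j → D i (logΩ A j)) ⋆ Ω A) n ∙ F
  Ω-∙-var i n F = trans (∙-var (Ω A n) i F) (+-congˡ (∙-cong (D-Ω i A n) refl))

  vanish : ∀ F n → deg F < n → Ω A n ∙ F ≈ 0#
  vanish = degree-induction (λ d F → ∀ n → d < n → Ω A n ∙ F ≈ 0#)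
    (λ e PF n d<n → trans (∙-cong (refl {Ω A n}) (sym e)) (PF n d<n))
    (λ d≤d′ PF n d′<n → PF n (ℕₚ.≤-<-trans d≤d′ d′<n))
    (λ { (suc n) _ → Ω-∙-1 n })
    (λ PF PG n d<n → trans (∙-+ (Ω A n) _ _) (trans (+-cong (PF n d<n) (PG n d<n)) (+-identityˡ 0#)))
    (λ a PF n d<n → trans (∙-scale (Ω A n) a _) (trans (*-congˡ (PF n d<n)) (zeroʳ _)))
    (λ i {d} {F} PF n i+d<n → trans (Ω-∙-var i n F) (trans (+-cong
      (trans (*-congˡ (PF n (ℕₚ.≤-<-trans (ℕₚ.m≤n+m d (suc i)) i+d<n))) (zeroʳ _))
      (⋆-∙-vanish (Ω A) PF (suc (suc i)) n (bounded i) i+d<n)) (+-identityˡ 0#)))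

  -- Equal elements may have different `deg`. With the cut-off free, both sides of an equation can
  -- be truncated at a common N.
  E-∑ : ∀ F N → deg F < N → ∑ N (λ n → Ω A n ∙ F) ≈ E F
  E-∑ F N d<N = trans (∑-extend _ d<N (vanish F)) (sym (skewΩ-∑ A F))

  E-cong : ∀ {F G} → F ≈ G → E F ≈ E G
  E-cong {F} {G} e = trans (sym (E-∑ F N (s≤s (ℕₚ.m≤m⊔n (deg F) (deg G)))))
    (trans (∑-cong N (λ n _ → ∙-cong (refl {Ω A n}) e)) (E-∑ G N (s≤s (ℕₚ.m≤n⊔m (deg F) (deg G)))))
    where N = suc (deg F ℕ.⊔ deg G)

  E-+ : ∀ F G → E (F + G) ≈ E F + E G
  E-+ F G = trans (skewΩ-∑ A (F + G)) (trans (∑-cong (suc (deg (F + G))) (λ n _ → ∙-+ (Ω A n) F G)) (trans (∑-+ (suc (deg (F + G))) _ _)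
    (+-cong (E-∑ F _ (s≤s (ℕₚ.m≤m⊔n (deg F) (deg G)))) (E-∑ G _ (s≤s (ℕₚ.m≤n⊔m (deg F) (deg G)))))))

  E-scale : ∀ a F → E (con a * F) ≈ con a * E F
  E-scale a F = trans (skewΩ-∑ A _) (trans (∑-cong (suc (deg F)) (λ n _ → ∙-scale (Ω A n) a F)) (trans (∑-* (suc (deg F)) (con a) _) (*-congˡ (sym (skewΩ-∑ A F)))))

  E-neg : ∀ F → E (- F) ≈ - E F
  E-neg = IsAdditive.homo-neg (record { cong = E-cong ; homo-+ = E-+ })

  E-∙ : ∀ P F → E (P ∙ F) ≈ P ∙ E F
  E-∙ P F = trans (sym (E-∑ (P ∙ F) N (s≤s (ℕₚ.m≤m⊔n (deg (P ∙ F)) (deg F)))))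
    (trans (∑-cong N (λ n _ → ∙-comm (Ω A n) P F)) (trans (sym (IsAdditive.homo-∑ (∙-additive P) N _))
      (∙-cong (refl {P}) (E-∑ F N (s≤s (ℕₚ.m≤n⊔m (deg (P ∙ F)) (deg F)))))))
    where N = suc (deg (P ∙ F) ℕ.⊔ deg F)

  -- The rule exp(φ(D)) p_k = (p_k + φ′(D)) exp(φ(D)), in which `κ i` is the derivative of the
  -- exponent.
  E-var : ∀ i F → E (var i * F) ≈ var i * E F + κ i ∙ E F
  E-var i F = trans (skewΩ-∑ A (var i * F)) (trans (∑-cong N (λ n _ → Ω-∙-var i n F)) (trans (∑-+ N _ _) (+-cong
    (trans (∑-* N (var i) _) (*-congˡ (E-∑ F N (s≤s (ℕₚ.m≤n+m (deg F) (suc i))))))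
    (∑-⋆-∙ (Ω A) (E-∑ F) (suc (suc i)) N (bounded i) ℕₚ.≤-refl))))
    where N = suc (deg (var i * F))

  E-fixes : ∀ {F} → (∀ n → Ω A (suc n) ∙ F ≈ 0#) → E F ≈ F
  E-fixes {F} e = trans (skewΩ-∑ A F) (trans (∑-suc (deg F) _) (trans (+-cong (Ω-0-∙ A F) (∑-zero (deg F) (λ n _ → e n))) (+-identityʳ F)))

-- Agreement of the truncated Bernstein sums with 𝐁

module BernsteinSum where

  partial : ℕ → ℤ → Op
  partial N r F = ∑ N (λ n → h (r ℤ.+ ℤ.+ n) * (Ω (- X) n ∙ F))

  Ω-negX-var : ∀ i n F → Ω (- X) n ∙ (var i * F) ≈ var i * (Ω (- X) n ∙ F) - e (ℤ.+ n ℤ.- ℤ.+ suc i) ∙ F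
  Ω-negX-var i n F = trans (∙-var (Ω (- X) n) i F) (+-congˡ (∙-cong (D-e i (ℤ.+ n)) refl))

  partial≈𝐁 : ∀ F N r → deg F < N → partial N r F ≈ 𝐁 r F
  partial≈𝐁 = degree-induction (λ d F → ∀ N r → d < N → partial N r F ≈ 𝐁 r F)
    (λ e PF N r d<N → trans (∑-cong N (λ n _ → *-congˡ (∙-cong (refl {Ω (- X) n}) (sym e)))) (trans (PF N r d<N) (𝐁.cong r e)))
    (λ d≤d′ PF N r d′<N → PF N r (ℕₚ.≤-<-trans d≤d′ d′<N))
    (λ { (suc N) r _ → trans (∑-suc N _) (trans (+-cong
      (trans (*-cong (reflexive (≡.cong h (ℤₚ.+-identityʳ r))) (Ω-0-∙ (- X) 1#)) (*-identityʳ _))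
      (∑-zero N (λ n _ → trans (*-congˡ (Ω-kills (λ i → ψ-kills i) n)) (zeroʳ _)))) (trans (+-identityʳ _) (sym (𝐁.base r)))) })
    (λ {d} {F} {G} PF PG N r d<N → trans (∑-cong N (λ n _ → trans (*-congˡ (∙-+ (Ω (- X) n) F G)) (distribˡ _ _ _)))
      (trans (∑-+ N _ _) (trans (+-cong (PF N r d<N) (PG N r d<N)) (sym (𝐁.homo-+ r F G)))))
    (λ a {d} {F} PF N r d<N → trans (∑-cong N (λ n _ → trans (*-congˡ (∙-scale (Ω (- X) n) a F))
        (solve 3 (λ h a x → h :* (a :* x) := a :* (h :* x)) refl (h (r ℤ.+ ℤ.+ n)) (con a) (Ω (- X) n ∙ F))))
      (trans (∑-* N (con a) _) (trans (*-congˡ (PF N r d<N)) (sym (𝐁.scale r a F)))))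
    var-case
    where
    ψ-kills : ∀ i → ψ (suc i) (- X) ∙ 1# ≈ 0#
    ψ-kills i = trans (∙-cong (ψ-negX i) (refl {1#})) (zeroʳ _)
    var-case : ∀ i {d F} → (∀ N r → d < N → partial N r F ≈ 𝐁 r F) → ∀ N r → suc i ℕ.+ d < N → partial N r (var i * F) ≈ 𝐁 r (var i * F)
    var-case i {d} {F} PF N r i+d<N = begin
      partial N r (var i * F)
        ≈⟨ ∑-cong N (λ n _ → trans (*-congˡ (Ω-negX-var i n F))
             (solve 4 (λ h p x y → h :* (p :* x :- y) := p :* (h :* x) :+ :con (ℚ.- ℚ.1ℚ) :* (h :* y)) refl
               (h (r ℤ.+ ℤ.+ n)) (var i) (Ω (- X) n ∙ F) (e (ℤ.+ n ℤ.- ℤ.+ suc i) ∙ F))) ⟩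
      ∑ N (λ n → var i * (h (r ℤ.+ ℤ.+ n) * (Ω (- X) n ∙ F)) + con -1ₜ * g n)
        ≈⟨ trans (∑-+ N _ _) (+-cong (trans (∑-* N (var i) _) (*-congˡ (PF N r (ℕₚ.≤-<-trans (ℕₚ.m≤n+m d (suc i)) i+d<N))))
             (trans (∑-* N (con -1ₜ) g) (trans (sym (con-1 _)) (-‿cong tail)))) ⟩
      var i * 𝐁 r F - 𝐁 (r ℤ.+ ℤ.+ suc i) F
        ≈⟨ 𝐁-var r i F ⟨
      𝐁 r (var i * F) ∎
      where
      g : ℕ → Λ
      g n = h (r ℤ.+ ℤ.+ n) * (e (ℤ.+ n ℤ.- ℤ.+ suc i) ∙ F)
      M = N ∸ suc i
      -- The terms n < k = i + 1 vanish because e has a negative index there. Writing n = k + m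
      -- turns the rest into the truncation of 𝐁_{r+k} with N - k terms, still more than d.
      tail : ∑ N g ≈ 𝐁 (r ℤ.+ ℤ.+ suc i) F
      tail = begin
        ∑ N g
          ≡⟨ ≡.cong (λ z → ∑ z g) (≡.sym (ℕₚ.m+[n∸m]≡n (ℕₚ.≤-trans (ℕₚ.m≤m+n (suc i) d) (ℕₚ.<⇒≤ i+d<N)))) ⟩
        ∑ (suc i ℕ.+ M) g
          ≈⟨ ∑-++ (suc i) M g ⟩
        ∑ (suc i) g + ∑ M (λ m → g (suc i ℕ.+ m))
          ≈⟨ +-cong (∑-zero (suc i) (λ n n<i → trans (*-congˡ (trans (∙-cong (coefficient-neg (Ω (- X)) (pos-neg n<i)) refl) (zeroˡ F))) (zeroʳ _)))
               (∑-cong M (λ m _ → *-cong (reflexive (≡.cong h (≡.sym (ℤₚ.+-assoc r (ℤ.+ suc i) (ℤ.+ m)))))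
                 (∙-cong (reflexive (≡.cong e (ℤS.solve 2 (λ k m → (k ℤS.:+ m) ℤS.:- k ℤS.:= m) ≡.refl (ℤ.+ suc i) (ℤ.+ m)))) refl))) ⟩
        0# + partial M (r ℤ.+ ℤ.+ suc i) F
          ≈⟨ trans (+-identityˡ _) (PF M _ (ℕₚ.+-cancelˡ-< (suc i) d M (≡.subst (λ z → suc i ℕ.+ d < z)
               (≡.sym (ℕₚ.m+[n∸m]≡n (ℕₚ.≤-trans (ℕₚ.m≤m+n (suc i) d) (ℕₚ.<⇒≤ i+d<N)))) i+d<N))) ⟩
        𝐁 (r ℤ.+ ℤ.+ suc i) F ∎

-- The vertical domino under plethysm, and conjugation by Ω[A]^⊥

K-evaluate : ∀ v → IsHomomorphism ℚₚ.+-*-commutativeRing ⊤ ℚ[t]-commutativeRing (K.evaluate K.con v)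
K-evaluate v = record
  { homo-+ = λ _ _ → K.≈-refl ; homo-* = λ _ _ → K.≈-refl ; homo-neg = λ _ → K.≈-refl
  ; con-cong = K.con-cong ; con-+ = K.con-+ ; con-* = K.con-* ; con-0 = K.≈-refl ; con-1 = K.≈-refl }

Λ-evaluate-isHomomorphism : ∀ {c} → (∀ {a b} → a K.≈ b → c a K.≈ c b) →
  (∀ a b → c (a K.+ b) K.≈ c a K.+ c b) → (∀ a b → c (a K.* b) K.≈ c a K.* c b) →
  c (K.con ℚ.0ℚ) K.≈ K.con ℚ.0ℚ → c (K.con ℚ.1ℚ) K.≈ K.con ℚ.1ℚ →
  ∀ v → IsHomomorphism ℚ[t]-commutativeRing ℕ Λ-commutativeRing (Λ-evaluate (con ∘ c) v)
Λ-evaluate-isHomomorphism c-cong c-+ c-* c-0 c-1 v = record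
  { homo-+ = λ _ _ → refl ; homo-* = λ _ _ → refl ; homo-neg = λ _ → refl
  ; con-cong = λ e → Λ′.con-cong (c-cong e)
  ; con-+ = λ a b → trans (Λ′.con-cong (c-+ a b)) (Λ′.con-+ _ _)
  ; con-* = λ a b → trans (Λ′.con-cong (c-* a b)) (Λ′.con-* _ _)
  ; con-0 = Λ′.con-cong c-0 ; con-1 = Λ′.con-cong c-1 }

ψ-cong : ∀ k {F G} → F ≈ G → ψ (suc k) F ≈ ψ (suc k) G
ψ-cong k = IsHomomorphism.cong (Λ-evaluate-isHomomorphism (IsHomomorphism.cong (K-evaluate _)) (λ _ _ → K.≈-refl) (λ _ _ → K.≈-refl) K.≈-refl K.≈-refl _)

[]-cong : ∀ A {F G} → F ≈ G → F [ A ] ≈ G [ A ]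
[]-cong A = IsHomomorphism.cong (Λ-evaluate-isHomomorphism (λ e → e) (λ _ _ → K.≈-refl) (λ _ _ → K.≈-refl) K.≈-refl K.≈-refl _)

-- p_k[f] for k = suc i.
p[f] : ℕ → Λ
p[f] i = ratio 1 2 * (var i * var i - var (suc (i ℕ.* 2)))

f≈ : f ≈ p[f] 0
f≈ = begin
  f
    ≈⟨ s≈bern ⟪1,1⟫ ⟩
  𝐁 ℤ.1ℤ (𝐁 ℤ.1ℤ 1#)
    ≈⟨ trans (𝐁.cong _ (𝐁.base _)) (𝐁-h ℤ.1ℤ ℤ.1ℤ) ⟩
  Ω X 1 * Ω X 1 - Ω X 0 * Ω X 2
    ≈⟨ +-cong (*-cong Ω₁ Ω₁) (-‿cong (*-cong (Ω-0 X) Ω₂)) ⟩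
  var 0 * var 0 - 1# * (ratio 1 2 * (var 0 * var 0 + var 1))
    ≈⟨ solve 2 (λ p q → p :* p :- :con ℚ.1ℚ :* (:con ℚ.½ :* (p :* p :+ q)) := :con ℚ.½ :* (p :* p :- q)) refl (var 0) (var 1) ⟩
  ratio 1 2 * (var 0 * var 0 - var 1) ∎
  where
  newton : ∀ n → nat (suc n) * Ω X (suc n) ≈ (powers X ∘ suc ⋆ Ω X) n
  newton n = trans (Ω-newton X (suc n)) (trans (⋆-suc (powers X) (Ω X) n) (trans (+-congʳ (zeroˡ _)) (+-identityˡ _)))
  Ω₁ : Ω X 1 ≈ var 0
  Ω₁ = trans (sym (*-identityˡ _)) (trans (newton 0) (trans (⋆-zero _ (Ω X)) (trans (*-congˡ (Ω-0 X)) (*-identityʳ _))))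
  Ω₂ : Ω X 2 ≈ ratio 1 2 * (var 0 * var 0 + var 1)
  Ω₂ = trans (sym (trans (sym (*-assoc _ _ _)) (trans (*-congʳ (nat-inverse 1)) (*-identityˡ _)))) (*-congˡ {ratio 1 2} (begin
    nat 2 * Ω X 2                 ≈⟨ trans (newton 1) (⋆-suc _ (Ω X) 0) ⟩
    var 0 * Ω X 1 + _             ≈⟨ +-cong (*-congˡ Ω₁) (trans (⋆-zero _ (Ω X)) (trans (*-congˡ (Ω-0 X)) (*-identityʳ _))) ⟩
    var 0 * var 0 + var 1         ∎))

ψ-f : ∀ k → ψ (suc k) f ≈ p[f] k
ψ-f k = trans (ψ-cong k f≈) (reflexive (≡.cong (λ z → ratio 1 2 * (var z * var z - var (suc (k ℕ.* 2)))) (ℕₚ.*-identityʳ k)))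

D-p[f] : ∀ i j → D i (p[f] j) ≈ var j * D i (var j) - ratio 1 2 * D i (var (suc (j ℕ.* 2)))
D-p[f] i j = trans (D-scale i _ _) (solve 3 (λ p d d′ → :con ℚ.½ :* (d :* p :+ p :* d :- d′) := p :* d :- :con ℚ.½ :* d′) refl (var j) (D i (var j)) (D i (var (suc (j ℕ.* 2)))))

-- Applying the operator of p_{k+1} twice and that of p_{2(k+1)} once both lower the index of h by
-- 2(k + 1); this is f[z] = 0 for a single variable z.
p[f]-∙-h : ∀ k r → p[f] k ∙ h r ≈ 0#
p[f]-∙-h k r = begin
  ratio 1 2 * (D k (D k (h r)) + - D (suc (k ℕ.* 2)) (h r))
    ≈⟨ *-congˡ (+-cong (trans (D-cong k (D-h k r)) (D-h k (r ℤ.- ℤ.+ suc k)))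
         (-‿cong (trans (D-h (suc (k ℕ.* 2)) r) (reflexive (≡.cong h index))))) ⟩
  ratio 1 2 * (h r″ + - h r″)
    ≈⟨ trans (*-congˡ (-‿inverseʳ (h r″))) (zeroʳ _) ⟩
  0# ∎
  where
  r″ = (r ℤ.- ℤ.+ suc k) ℤ.- ℤ.+ suc k
  index : r ℤ.- ℤ.+ suc (suc (k ℕ.* 2)) ≡ r″
  index = ≡.trans (≡.cong (λ z → r ℤ.- z) (ℤₚ.pos-* (suc k) 2))
    (ℤS.solve 2 (λ r k → r ℤS.:- k ℤS.:* ℤS.con (ℤ.+ 2) ℤS.:= (r ℤS.:- k) ℤS.:- k) ≡.refl r (ℤ.+ suc k))

δ-var-≢ : ∀ {i j} → ¬ i ≡ j → D i (var j) ≈ 0#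
δ-var-≢ {i} {j} i≢j = reflexive (δ-≢ (i ℕₚ.≟ j) i≢j)

IsScalar : Λ → Set
IsScalar F = ∃[ c ] F ≈ con c

∑-scalar : ∀ N {g} → (∀ j → IsScalar (g j)) → IsScalar (∑ N g)
∑-scalar zero    e = _ , ∑-zero′ _
∑-scalar (suc N) e with e 0 | ∑-scalar N (λ j → e (suc j))
... | c , eq | c′ , eq′ = c K.+ c′ , trans (∑-suc N _) (trans (+-cong eq eq′) (sym (Λ′.con-+ c c′)))

-- One treatment of f, -f and ±(f[tX] - f): they differ only in the scalars a_k.
module ScaledDomino (a : ℕ → ℚ[t]) (A : Λ) (ψ-A : ∀ k → ψ (suc k) A ≈ con (a k) * p[f] k) where

  D-log : ∀ i j → D i (logΩ A (suc j)) ≈ ratio 1 (suc j) * (con (a j) * (var j * D i (var j) - ratio 1 2 * D i (var (suc (j ℕ.* 2)))))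
  D-log i j = trans (D-scale i _ _) (*-congˡ (trans (D-cong i (ψ-A j)) (trans (D-scale i (a j) _) (*-congˡ (D-p[f] i j)))))

  j≤2j+1 : ∀ j → j ≤ suc (j ℕ.* 2)
  j≤2j+1 j = ℕₚ.≤-trans (ℕₚ.m≤m*n j 2) (ℕₚ.n≤1+n _)

  bounded : ∀ i j → suc i < j → D i (logΩ A j) ≈ 0#
  bounded i (suc j) (s≤s i<j) = trans (D-log i j) (trans (*-congˡ (*-congˡ (+-cong
    (*-congˡ (δ-var-≢ (ℕₚ.<⇒≢ i<j))) (-‿cong (*-congˡ (δ-var-≢ (ℕₚ.<⇒≢ (ℕₚ.<-≤-trans i<j (j≤2j+1 j)))))))))
    (solve 3 (λ r a p → r :* (a :* (p :* :con ℚ.0ℚ :- :con ℚ.½ :* :con ℚ.0ℚ)) := :con ℚ.0ℚ) refl (ratio 1 (suc j)) (con (a j)) (var j)))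

  Ω-∙-h : ∀ r n → Ω A (suc n) ∙ h r ≈ 0#
  Ω-∙-h r = Ω-kills (λ k → trans (∙-cong (ψ-A k) refl) (trans (*-congˡ (p[f]-∙-h k r)) (zeroʳ _)))

  Ω-∙-1 : ∀ n → Ω A (suc n) ∙ 1# ≈ 0#
  Ω-∙-1 n = trans (∙-cong (refl {Ω A (suc n)}) (sym h-0)) (Ω-∙-h ℤ.0ℤ n)

  open ΩOperator A bounded Ω-∙-1 public

  E-h : ∀ r → E (h r) ≈ h r
  E-h r = E-fixes (Ω-∙-h r)

  E-1 : E 1# ≈ 1#
  E-1 = trans (E-cong (sym h-0)) (trans (E-h ℤ.0ℤ) h-0)

  -- Among the power sums of A, the quadratic part of p_k[f] depends on p_{i+1} only for k = i + 1,
  -- and the part linear in p_{2k} contributes at most a scalar. That scalar commutes with the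
  -- linear operators considered, so only a_i p_{i+1} affects a conjugation.
  κ-scalar : ∀ i → ∃[ c ] κ i ≈ con (a i) * var i + con c
  κ-scalar i = proj₁ scalar , (begin
    κ i
      ≈⟨ trans (∑-suc (suc i) _) (+-identityˡ _) ⟩
    ∑ (suc i) (λ j → D i (logΩ A (suc j)))
      ≈⟨ trans (∑-cong (suc i) (λ j _ → trans (D-log i j) (solve 5 (λ r a p d d′ → r :* (a :* (p :* d :- :con ℚ.½ :* d′)) := r :* (a :* (p :* d)) :+ :con (ℚ.- ℚ.½) :* (r :* (a :* d′))) refl
           (ratio 1 (suc j)) (con (a j)) (var j) (D i (var j)) (D i (var (suc (j ℕ.* 2))))))) (∑-+ (suc i) _ _) ⟩
    ∑ (suc i) linear + ∑ (suc i) constant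
      ≈⟨ +-cong diagonal (proj₂ scalar) ⟩
    con (a i) * var i + con (proj₁ scalar) ∎)
    where
    linear constant : ℕ → Λ
    linear j   = ratio 1 (suc j) * (con (a j) * (var j * D i (var j)))
    constant j = ν (ℚ.- ℚ.½) * (ratio 1 (suc j) * (con (a j) * D i (var (suc (j ℕ.* 2)))))
    scalar : IsScalar (∑ (suc i) constant)
    scalar = ∑-scalar (suc i) (λ j → constant-scalar j (δ-scalar i (i ℕₚ.≟ suc (j ℕ.* 2))))
      where
      constant-scalar : ∀ j → ∃[ c ] D i (var (suc (j ℕ.* 2))) ≡ con c → IsScalar (constant j)
      constant-scalar j (c , eq) = _ , trans (*-congˡ (trans (*-congˡ (trans (*-congˡ (reflexive eq)) (sym (Λ′.con-* _ _)))) (sym (Λ′.con-* _ _)))) (sym (Λ′.con-* _ _))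
    diagonal : ∑ (suc i) linear ≈ con (a i) * var i
    diagonal = begin
      ∑ (suc i) linear
        ≡⟨ ≡.cong (λ z → ∑ z linear) (ℕₚ.+-comm 1 i) ⟩
      ∑ (i ℕ.+ 1) linear
        ≈⟨ trans (∑-++ i 1 linear) (+-cong
             (∑-zero i (λ j j<i → trans (*-congˡ (trans (*-congˡ (trans (*-congˡ (δ-var-≢ (λ e → ℕₚ.<⇒≢ j<i (≡.sym e)))) (zeroʳ _))) (zeroʳ _))) (zeroʳ _)))
             (trans (∑-suc 0 _) (trans (+-congˡ (∑-zero′ _)) (+-identityʳ _)))) ⟩
      0# + linear (i ℕ.+ 0)
        ≈⟨ trans (+-identityˡ _) (reflexive (≡.cong linear (ℕₚ.+-identityʳ i))) ⟩
      linear i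
        ≈⟨ trans (*-congˡ (*-congˡ (*-congˡ (reflexive (δ-≡ i (i ℕₚ.≟ i))))))
             (solve 4 (λ r a p n → r :* (a :* (p :* n)) := (r :* n) :* (a :* p)) refl (ratio 1 (suc i)) (con (a i)) (var i) (nat (suc i))) ⟩
      ratio 1 (suc i) * nat (suc i) * (con (a i) * var i)
        ≈⟨ trans (*-congʳ (nat-inverse i)) (*-identityˡ _) ⟩
      con (a i) * var i ∎

module DominoConjugation (a : ℕ → ℚ[t]) (A A′ : Λ)
  (ψ-A : ∀ k → ψ (suc k) A ≈ con (a k) * p[f] k) (ψ-A′ : ∀ k → ψ (suc k) A′ ≈ - (con (a k) * p[f] k)) where

  -a : ℕ → ℚ[t]
  -a k = K.- a k

  ψ-A′-scaled : ∀ k → ψ (suc k) A′ ≈ con (-a k) * p[f] k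
  ψ-A′-scaled k = trans (ψ-A′ k) (trans (-‿distribˡ-* _ _) (*-congʳ (sym (con-neg (a k)))))

  module Ω⁺ = ScaledDomino a A ψ-A
  module Ω⁻ = ScaledDomino -a A′ ψ-A′-scaled

  κ⁻ : ∀ i → Ω⁻.κ i ≈ - Ω⁺.κ i
  κ⁻ i = trans (∑-cong (suc (suc i)) (λ j _ → trans (D-log-neg j) (con-1 _))) (trans (∑-* (suc (suc i)) (con -1ₜ) _) (sym (con-1 _)))
    where
    D-log-neg : ∀ j → D i (logΩ A′ j) ≈ - D i (logΩ A j)
    D-log-neg zero    = sym -0#≈0#
    D-log-neg (suc j) = trans (D-scale i _ _) (trans (*-congˡ (D-cong i (trans (ψ-A′ j) (-‿cong (sym (ψ-A j)))))) (trans (sym (-‿distribʳ-* _ _)) (-‿cong (sym (D-scale i _ _)))))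

  Ω⁻-var : ∀ i F → Ω⁻.E (var i * F) ≈ var i * Ω⁻.E F - Ω⁺.κ i ∙ Ω⁻.E F
  Ω⁻-var i F = trans (Ω⁻.E-var i F) (+-congˡ (∙-cong (κ⁻ i) refl))

  -- The two operators correct p_k by opposite multiples of the same κ(D), with which they commute;
  -- so the composite commutes with every p_k and fixes 1.
  inverse : ∀ F → Ω⁺.E (Ω⁻.E F) ≈ F
  inverse = Λ-induction (λ F → Ω⁺.E (Ω⁻.E F) ≈ F)
    (λ e PF → trans (Ω⁺.E-cong (Ω⁻.E-cong (sym e))) (trans PF e))
    (trans (Ω⁺.E-cong Ω⁻.E-1) Ω⁺.E-1)
    (λ {F} {G} PF PG → trans (Ω⁺.E-cong (Ω⁻.E-+ F G)) (trans (Ω⁺.E-+ _ _) (+-cong PF PG)))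
    (λ c {F} PF → trans (Ω⁺.E-cong (Ω⁻.E-scale c F)) (trans (Ω⁺.E-scale c _) (*-congˡ PF)))
    (λ i {F} PF → begin
      Ω⁺.E (Ω⁻.E (var i * F))
        ≈⟨ trans (Ω⁺.E-cong (Ω⁻-var i F)) (trans (Ω⁺.E-+ _ _) (+-cong (Ω⁺.E-var i _) (trans (Ω⁺.E-neg _) (-‿cong (Ω⁺.E-∙ (Ω⁺.κ i) _))))) ⟩
      var i * Ω⁺.E (Ω⁻.E F) + Ω⁺.κ i ∙ Ω⁺.E (Ω⁻.E F) - Ω⁺.κ i ∙ Ω⁺.E (Ω⁻.E F)
        ≈⟨ solve 2 (λ x y → x :+ y :- y := x) refl (var i * Ω⁺.E (Ω⁻.E F)) (Ω⁺.κ i ∙ Ω⁺.E (Ω⁻.E F)) ⟩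
      var i * Ω⁺.E (Ω⁻.E F)
        ≈⟨ *-congˡ PF ⟩
      var i * F ∎)

  -- Moving p_k through Ω[-A]^⊥ leaves -κ(D) to the right of V. Since D_k V_r = V_r D_k + V_{r-k},
  -- taking it to the left of V costs a_k V_{r-k}; there it cancels the κ(D) produced by Ω[A]^⊥. The
  -- values on 1 persist because both operators fix 1 and Ω[A]^⊥ fixes every h_r.
  conjugate : ∀ {x y V} → IsVertex h x y V → (∀ i → y i K.≈ K.con ℚ.0ℚ) → IsVertex h x a (λ r F → Ω⁺.E (V r (Ω⁻.E F)))
  conjugate {x} {y} {V} v y≈0 = record
    { cong   = λ r e → Ω⁺.E-cong (v.cong r (Ω⁻.E-cong e))
    ; homo-+ = λ r F G → trans (Ω⁺.E-cong (trans (v.cong r (Ω⁻.E-+ F G)) (v.homo-+ r _ _))) (Ω⁺.E-+ _ _)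
    ; scale  = λ r c F → trans (Ω⁺.E-cong (trans (v.cong r (Ω⁻.E-scale c F)) (v.scale r c _))) (Ω⁺.E-scale c _)
    ; base   = λ r → trans (Ω⁺.E-cong (trans (v.cong r Ω⁻.E-1) (v.base r))) (Ω⁺.E-h r)
    ; step   = step }
    where
    module v = IsVertex v
    step : ∀ r i F → Ω⁺.E (V r (Ω⁻.E (var i * F))) ≈ var i * Ω⁺.E (V r (Ω⁻.E F)) +
      (con (x i) * Ω⁺.E (V (r ℤ.+ ℤ.+ suc i) (Ω⁻.E F)) + con (a i) * Ω⁺.E (V (r ℤ.- ℤ.+ suc i) (Ω⁻.E F)))
    step r i F = begin
      Ω⁺.E (V r (Ω⁻.E (var i * F)))
        ≈⟨ Ω⁺.E-cong (trans (v.cong r (Ω⁻-var i F)) inner) ⟩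
      Ω⁺.E (var i * M + (con (x i) * M⁺ + con (a i) * M⁻) - Ω⁺.κ i ∙ M)
        ≈⟨ trans (Ω⁺.E-+ _ _) (+-cong (trans (Ω⁺.E-+ _ _) (+-cong (Ω⁺.E-var i M) (trans (Ω⁺.E-+ _ _) (+-cong (Ω⁺.E-scale _ _) (Ω⁺.E-scale _ _)))))
             (trans (Ω⁺.E-neg _) (-‿cong (Ω⁺.E-∙ (Ω⁺.κ i) M)))) ⟩
      (var i * Ω⁺.E M + Ω⁺.κ i ∙ Ω⁺.E M) + (con (x i) * Ω⁺.E M⁺ + con (a i) * Ω⁺.E M⁻) - Ω⁺.κ i ∙ Ω⁺.E M
        ≈⟨ solve 3 (λ p k q → (p :+ k) :+ q :- k := p :+ q) refl (var i * Ω⁺.E M) (Ω⁺.κ i ∙ Ω⁺.E M) (con (x i) * Ω⁺.E M⁺ + con (a i) * Ω⁺.E M⁻) ⟩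
      var i * Ω⁺.E M + (con (x i) * Ω⁺.E M⁺ + con (a i) * Ω⁺.E M⁻) ∎
      where
      G = Ω⁻.E F
      M = V r G
      M⁺ = V (r ℤ.+ ℤ.+ suc i) G
      M⁻ = V (r ℤ.- ℤ.+ suc i) G
      c = proj₁ (Ω⁺.κ-scalar i)
      κ≈ : Ω⁺.κ i ≈ con (a i) * var i + con c
      κ≈ = proj₂ (Ω⁺.κ-scalar i)
      V-D : D i M ≈ V r (D i G) + con 1ₜ * M⁻
      V-D = D-vertex v i 1ₜ (ℤ.- ℤ.+ suc i) (λ r → trans (D-h i r) (sym (*-identityˡ _))) G r
      inner : V r (var i * G - Ω⁺.κ i ∙ G) ≈ var i * M + (con (x i) * M⁺ + con (a i) * M⁻) - Ω⁺.κ i ∙ M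
      inner = begin
        V r (var i * G - Ω⁺.κ i ∙ G)
          ≈⟨ trans (v.cong r (+-congˡ (-‿cong (∙-cong κ≈ (refl {G}))))) (trans (v.homo-+ r _ _) (+-cong (v.step r i G)
               (trans (v.homo-neg r _) (-‿cong (trans (v.homo-+ r _ _) (+-cong (v.scale r (a i) _) (v.scale r c G))))))) ⟩
        (var i * M + (con (x i) * M⁺ + con (y i) * M⁻)) - (con (a i) * V r (D i G) + con c * M)
          ≈⟨ +-congʳ (+-congˡ (+-congˡ (trans (*-congʳ (Λ′.con-cong (y≈0 i))) (zeroˡ _)))) ⟩
        (var i * M + (con (x i) * M⁺ + 0#)) - (con (a i) * V r (D i G) + con c * M)
          ≈⟨ solve 6 (λ pM xM a V M⁻ cM → (pM :+ (xM :+ :con ℚ.0ℚ)) :- (a :* V :+ cM) := pM :+ (xM :+ a :* M⁻) :- (a :* (V :+ :con ℚ.1ℚ :* M⁻) :+ cM)) refl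
               (var i * M) (con (x i) * M⁺) (con (a i)) (V r (D i G)) M⁻ (con c * M) ⟩
        var i * M + (con (x i) * M⁺ + con (a i) * M⁻) - (con (a i) * (V r (D i G) + con 1ₜ * M⁻) + con c * M)
          ≈⟨ +-congˡ (-‿cong (+-congʳ (*-congˡ (sym V-D)))) ⟩
        var i * M + (con (x i) * M⁺ + con (a i) * M⁻) - (con (a i) * D i M + con c * M)
          ≈⟨ +-congˡ (-‿cong (∙-cong κ≈ (refl {M}))) ⟨
        var i * M + (con (x i) * M⁺ + con (a i) * M⁻) - Ω⁺.κ i ∙ M ∎

-- The t-analogue

IsVertex-resp : ∀ {g x y V V′} → (∀ r F → V′ r F ≈ V r F) → IsVertex g x y V → IsVertex g x y V′
IsVertex-resp V′≈V v = record
  { cong   = λ r e → trans (V′≈V r _) (trans (cong r e) (sym (V′≈V r _)))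
  ; homo-+ = λ r F G → trans (V′≈V r _) (trans (homo-+ r F G) (sym (+-cong (V′≈V r F) (V′≈V r G))))
  ; scale  = λ r c F → trans (V′≈V r _) (trans (scale r c F) (sym (*-congˡ (V′≈V r F))))
  ; base   = λ r → trans (V′≈V r _) (base r)
  ; step   = λ r i F → trans (V′≈V r _) (trans (step r i F) (sym (+-cong (*-congˡ (V′≈V r F))
      (+-cong (*-congˡ (V′≈V _ F)) (*-congˡ (V′≈V _ F)))))) }
  where open IsVertex v

-- `applyY` with an extra factor G in the Y variables, which the recursion through products in
-- `split` has to keep arbitrary.
applyTo : Op → Λ⊗Λ → Op
applyTo V []             G = 0#
applyTo V ((a , b) ∷ ts) G = a * V (b * G) + applyTo V ts G

applyTo-++ : ∀ V ts us G → applyTo V (ts ++ us) G ≈ applyTo V ts G + applyTo V us G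
applyTo-++ V []             us G = sym (+-identityˡ _)
applyTo-++ V ((a , b) ∷ ts) us G = trans (+-congˡ (applyTo-++ V ts us G)) (sym (+-assoc _ _ _))

applyTo-neg : ∀ V ts G → applyTo V (map -ᵖ_ ts) G ≈ - applyTo V ts G
applyTo-neg V []             G = sym -0#≈0#
applyTo-neg V ((a , b) ∷ ts) G = trans (+-congˡ (applyTo-neg V ts G))
  (solve 3 (λ a v s → (:- a) :* v :+ :- s := :- (a :* v :+ s)) refl a (V (b * G)) (applyTo V ts G))

module Analogue {g x y V} (v : IsVertex g x y V) (q : ℚ[t]) where

  private
    module v = IsVertex v
    x′ y′ : ℕ → ℚ[t]
    x′ i = (1ₜ K.+ K.- ψₜ (suc i) q) K.* x i
    y′ i = (1ₜ K.+ K.- ψₜ (suc i) q) K.* y i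
    module W = Canonical x′ y′

  applyTo-map : ∀ r a b us G → applyTo (V r) (map ((a , b) *ᵖ_) us) G ≈ a * applyTo (V r) us (b * G)
  applyTo-map r a b []               G = sym (zeroʳ a)
  applyTo-map r a b ((a′ , b′) ∷ us) G = trans (+-cong
      (trans (*-assoc a a′ _) (*-congˡ (*-congˡ (v.cong r (solve 3 (λ b b′ G → b :* b′ :* G := b′ :* (b :* G)) refl b b′ G)))))
      (applyTo-map r a b us G)) (sym (distribˡ a _ _))

  act-applyTo : ∀ P ts G r → LA.act P (λ s → applyTo (V s) ts G) r ≈ applyTo (λ F → LA.act P (λ s → V s F) r) ts G
  act-applyTo P []             G r = LA.act-0 P r
  act-applyTo P ((a , b) ∷ ts) G r = trans (LA.act-+ P _ _ r) (+-cong (LA.act-step P (inj₁ a) (λ s → V s (b * G)) r) (act-applyTo P ts G r))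

  -- `split` sends p_k to q^k p_k[X] + (1 - q^k) p_k[Y], and V turns p_k[Y] into p_k + x_k u^k + y_k
  -- d^k. After Y ↦ X the total is p_k + (1 - q^k)(x_k u^k + y_k d^k).
  applyTo-split : ∀ F G r → applyTo (V r) (split q F) G ≈ LA.act (W.σ F) (λ s → V s G) r
  applyTo-split (con a) G r = trans (+-identityʳ _) (*-congˡ (v.cong r (*-identityˡ G)))
  applyTo-split (var i) G r = begin
    con qᵏ * var i * V r (1# * G) + ((1# - con qᵏ) * V r (var i * G) + 0#)
      ≈⟨ +-cong (*-congˡ (v.cong r (*-identityˡ G))) (+-congʳ (*-congˡ (v.step r i G))) ⟩
    con qᵏ * var i * V r G + ((1# - con qᵏ) * (var i * V r G + (con (x i) * V⁺ + con (y i) * V⁻)) + 0#)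
      ≈⟨ solve 7 (λ q p v x v⁺ y v⁻ → q :* p :* v :+ ((:con ℚ.1ℚ :- q) :* (p :* v :+ (x :* v⁺ :+ y :* v⁻)) :+ :con ℚ.0ℚ)
           := p :* v :+ ((:con ℚ.1ℚ :+ :- q) :* x :* v⁺ :+ (:con ℚ.1ℚ :+ :- q) :* y :* v⁻)) refl (con qᵏ) (var i) (V r G) (con (x i)) V⁺ (con (y i)) V⁻ ⟩
    var i * V r G + ((1# + - con qᵏ) * con (x i) * V⁺ + (1# + - con qᵏ) * con (y i) * V⁻)
      ≈⟨ +-congˡ (+-cong (*-cong (coefficient≈ (x i)) (act-up (suc i) _ r)) (*-cong (coefficient≈ (y i)) (act-down (suc i) _ r))) ⟨
    LA.act (W.σ (var i)) (λ s → V s G) r ∎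
    where
    qᵏ = ψₜ (suc i) q
    V⁺ = V (r ℤ.+ ℤ.+ suc i) G
    V⁻ = V (r ℤ.- ℤ.+ suc i) G
    coefficient≈ : ∀ c → con ((1ₜ K.+ K.- qᵏ) K.* c) ≈ (1# + - con qᵏ) * con c
    coefficient≈ c = trans (Λ′.con-* _ _) (*-congʳ (trans (Λ′.con-+ _ _) (+-congˡ (con-neg qᵏ))))
  applyTo-split (F + F′) G r = trans (applyTo-++ (V r) (split q F) (split q F′) G) (+-cong (applyTo-split F G r) (applyTo-split F′ G r))
  applyTo-split (F * F′) G r = begin
    applyTo (V r) (cartesianProductWith _*ᵖ_ (split q F) (split q F′)) G
      ≈⟨ product (split q F) ⟩
    applyTo (λ H → LA.act (W.σ F′) (λ s → V s H) r) (split q F) G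
      ≈⟨ act-applyTo (W.σ F′) (split q F) G r ⟨
    LA.act (W.σ F′) (λ s → applyTo (V s) (split q F) G) r
      ≈⟨ LA.act-congʳ (W.σ F′) (λ s → applyTo-split F G s) r ⟩
    LA.act (W.σ F′) (LA.act (W.σ F) (λ s → V s G)) r
      -- Resolving the terms of F′ inside those of F brings the two substitutions out in reverse
      -- order.
      ≈⟨ LA.act-comm (W.σ F′) (W.σ F) _ r ⟩
    LA.act (W.σ F) (LA.act (W.σ F′) (λ s → V s G)) r ∎
    where
    product : ∀ ts → applyTo (V r) (cartesianProductWith _*ᵖ_ ts (split q F′)) G ≈ applyTo (λ H → LA.act (W.σ F′) (λ s → V s H) r) ts G
    product []             = refl
    product ((a , b) ∷ ts) = trans (applyTo-++ (V r) (map ((a , b) *ᵖ_) (split q F′)) _ G)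
      (+-cong (trans (applyTo-map r a b (split q F′) G) (*-congˡ (applyTo-split F′ (b * G) r))) (product ts))
  applyTo-split (- F) G r = trans (applyTo-neg (V r) (split q F) G) (-‿cong (applyTo-split F G r))

  applyY≈ : ∀ r ts → applyY (V r) ts ≈ applyTo (V r) ts 1#
  applyY≈ r []             = refl
  applyY≈ r ((a , b) ∷ ts) = +-cong (*-congˡ (v.cong r (sym (*-identityʳ b)))) (applyY≈ r ts)

  analogue-vertex : IsVertex g x′ y′ (λ r → analogue q (V r))
  analogue-vertex = IsVertex-resp
    (λ r F → trans (applyY≈ r (split q F)) (trans (applyTo-split F 1# r) (LA.act-congʳ (W.σ F) v.base r)))
    (W.vertex-isVertex g)

open import Data.List.Membership.DecPropositional _≟ᵖ_ using (_∈?_)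
open Algebra.Properties.Semiring.Exp (CommutativeRing.semiring ℚ[t]-commutativeRing) using () renaming (_^_ to _^ₜ_)

-- The substitution t ↦ t²

τ : Op
τ = _[t↦t²]

τₜ : ℚ[t] → ℚ[t]
τₜ = _[t↦t²]ₜ

τₜ-cong : ∀ {a b} → a K.≈ b → τₜ a K.≈ τₜ b
τₜ-cong = IsHomomorphism.cong (K-evaluate _)

τ-ringMap : RingMap Λ-commutativeRing Λ-commutativeRing
τ-ringMap = ringMap _ _ _ (Λ-evaluate-isHomomorphism τₜ-cong (λ _ _ → K.≈-refl) (λ _ _ → K.≈-refl) K.≈-refl K.≈-refl var)

τ-cong : ∀ {F G} → F ≈ G → τ F ≈ τ G
τ-cong = RingMap.φ-cong τ-ringMap

module Λ-τ = SequenceHomomorphism Λℚ Λℚ τ-ringMap (λ _ → refl)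

τ-Ω : ∀ {A} → (∀ i → τ (ψ (suc i) A) ≈ ψ (suc i) A) → ∀ n → τ (Ω A n) ≈ Ω A n
τ-Ω {A} τ-ψ = newton-unique {τ ∘ powers A} {powers A} refl (λ { zero → refl ; (suc i) → τ-ψ i })
  (trans (τ-cong (Ω-0 A)) (sym (Ω-0 A))) (Λ-τ.φ-newton {powers A} (Ω-newton A)) (Ω-newton A)

τ-h : ∀ r → τ (h r) ≈ h r
τ-h (ℤ.+ n)  = τ-Ω {X} (λ i → refl) n
τ-h -[1+ n ] = refl

τ-δ : ∀ i {j} (d : Dec (i ≡ j)) → τ (δ i d) ≈ δ i d
τ-δ i (yes _) = refl
τ-δ i (no _)  = refl

τ-D : ∀ i F → τ (D i F) ≈ D i (τ F)
τ-D i (con a) = refl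
τ-D i (var j) = τ-δ i (i ℕₚ.≟ j)
τ-D i (F + G) = +-cong (τ-D i F) (τ-D i G)
τ-D i (F * G) = +-cong (*-congʳ (τ-D i F)) (*-congˡ (τ-D i G))
τ-D i (- F)   = -‿cong (τ-D i F)

τ-∙ : ∀ P F → τ (P ∙ F) ≈ τ P ∙ τ F
τ-∙ (con a) F = refl
τ-∙ (var i) F = τ-D i F
τ-∙ (P + Q) F = +-cong (τ-∙ P F) (τ-∙ Q F)
τ-∙ (P * Q) F = trans (τ-∙ P (Q ∙ F)) (∙-cong (refl {τ P}) (τ-∙ Q F))
τ-∙ (- P)   F = -‿cong (τ-∙ P F)

τ-s : ∀ λ′ → τ (s λ′) ≈ s λ′
τ-s λ′ = trans (τ-cong (det≈ (jacobiTrudi (parts λ′)))) (trans (τ-det.φ-det (jacobiTrudi (parts λ′)))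
  (trans (DΛ.det-cong {N = jacobiTrudi (parts λ′)} (λ a b → τ-h ((ℤ.+ lookup (parts λ′) a ℤ.- ℤ.+ toℕ a) ℤ.+ ℤ.+ toℕ b))) (sym (det≈ (jacobiTrudi (parts λ′))))))
  where module τ-det = DeterminantHomomorphism τ-ringMap

-- Uniqueness of vertex operators, twisted by t ↦ t²: the commutators with p_k correspond under τ,
-- and the values h_r on 1 do not involve t.
τ-vertex : ∀ {x y x′ y′ V V′} → IsVertex h x y V → IsVertex h x′ y′ V′ →
  (∀ i → x′ i K.≈ τₜ (x i)) → (∀ i → y′ i K.≈ τₜ (y i)) → ∀ F r → τ (V r F) ≈ V′ r (τ F)
τ-vertex {V = V} {V′} v v′ ex ey = Λ-induction (λ F → ∀ r → τ (V r F) ≈ V′ r (τ F))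
  (λ e PF r → trans (τ-cong (v.cong r (sym e))) (trans (PF r) (v′.cong r (τ-cong e))))
  (λ r → trans (τ-cong (v.base r)) (trans (τ-h r) (sym (v′.base r))))
  (λ PF PG r → trans (τ-cong (v.homo-+ r _ _)) (trans (+-cong (PF r) (PG r)) (sym (v′.homo-+ r _ _))))
  (λ a PF r → trans (τ-cong (v.scale r a _)) (trans (*-congˡ (PF r)) (sym (v′.scale r (τₜ a) _))))
  (λ i {F} PF r → trans (τ-cong (v.step r i F)) (trans
    (+-cong (*-congˡ (PF r)) (+-cong (*-cong (Λ′.con-cong (KR.sym (ex i))) (PF _)) (*-cong (Λ′.con-cong (KR.sym (ey i))) (PF _))))
    (sym (v′.step r i (τ F)))))
  where
  module v = IsVertex v
  module v′ = IsVertex v′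

τ-foldr : ∀ {V V′ : ℤ → Op} → (∀ r {F G} → F ≈ G → V′ r F ≈ V′ r G) → (∀ F r → τ (V r F) ≈ V′ r (τ F)) →
  ∀ ms → foldr (λ m → V′ (ℤ.+ m)) 1# ms ≈ τ (foldr (λ m → V (ℤ.+ m)) 1# ms)
τ-foldr V′-cong τ-V []       = refl
τ-foldr {V} V′-cong τ-V (m ∷ ms) = trans (V′-cong (ℤ.+ m) (τ-foldr {V} V′-cong τ-V ms)) (sym (τ-V _ (ℤ.+ m)))

-- Replacing t by t² in t^n and t by t^n in t² both give t^{2n}; so the substitution agrees with
-- taking the analogue at q = t².
τₜ-power : ∀ n → τₜ (t ^ₜ n) K.≈ ψₜ n t²
τₜ-power zero    = KR.sym (KR.trans (KR.*-identityˡ _) (KR.*-identityˡ _))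
τₜ-power (suc n) = KR.trans (KR.*-congˡ (τₜ-power n))
  (KP.Solver.solve 2 (λ t p → t ⊗ (t ⊗ I) ⊗ (p ⊗ (p ⊗ I)) ⊜ t ⊗ p ⊗ (t ⊗ p ⊗ I)) K.≈-refl t (t ^ₜ n))
  where
  open KP.Solver using () renaming (_:*_ to _⊗_; _:=_ to _⊜_)
  I : ∀ {n} → KP.Solver.Polynomial n
  I = KP.Solver.con ℚ.1ℚ

f[tX]≈ : f[tX] ≈ con t² * f
f[tX]≈ = begin
  f [ con t * X ]
    ≈⟨ []-cong (con t * X) f≈ ⟩
  ratio 1 2 * (con (t K.* 1ₜ) * var 0 * (con (t K.* 1ₜ) * var 0) - con t² * var 1)
    ≈⟨ *-congˡ (+-cong (*-cong (*-congʳ t*1) (*-congʳ t*1)) (-‿cong (*-congʳ t²≈))) ⟩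
  ratio 1 2 * (con t * var 0 * (con t * var 0) - con t * con t * var 1)
    ≈⟨ solve 3 (λ t p q → :con ℚ.½ :* (t :* p :* (t :* p) :- t :* t :* q) := t :* t :* (:con ℚ.½ :* (p :* p :- q))) refl (con t) (var 0) (var 1) ⟩
  con t * con t * p[f] 0
    ≈⟨ *-cong t²≈ f≈ ⟨
  con t² * f ∎
  where
  t*1 : con (t K.* 1ₜ) ≈ con t
  t*1 = Λ′.con-cong (KR.*-identityʳ t)
  t²≈ : con t² ≈ con t * con t
  t²≈ = trans (Λ′.con-* _ _) (*-congˡ t*1)

-- This is q^k - 1 for k = i + 1, kept as a product because `analogue` multiplies the parameter -1
-- by 1 - q^k. At q = t² it is also the ratio of p_k[f[tX] - f] to p_k[f], which is why the two
-- constructions meet.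
tᵏ-factor : ℚ[t] → ℕ → ℚ[t]
tᵏ-factor q i = (1ₜ K.+ K.- ψₜ (suc i) q) K.* -1ₜ

-1ᶜ 1ᶜ : ℕ → ℚ[t]
-1ᶜ _ = -1ₜ
1ᶜ _ = 1ₜ

ψ-f-scaled : ∀ k → ψ (suc k) f ≈ con (1ᶜ k) * p[f] k
ψ-f-scaled k = trans (ψ-f k) (sym (*-identityˡ _))

ψ-negf : ∀ k → ψ (suc k) (- f) ≈ - (con (1ᶜ k) * p[f] k)
ψ-negf k = -‿cong (ψ-f-scaled k)

ψ-negf-scaled : ∀ k → ψ (suc k) (- f) ≈ con (-1ᶜ k) * p[f] k
ψ-negf-scaled k = trans (-‿cong (ψ-f k)) (con-1 _)

ψ-f-neg : ∀ k → ψ (suc k) f ≈ - (con (-1ᶜ k) * p[f] k)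
ψ-f-neg k = trans (ψ-f k) (solve 1 (λ p → p := :- (:con (ℚ.- ℚ.1ℚ) :* p)) refl (p[f] k))

ψ-f[tX]-f : ∀ k → ψ (suc k) (f[tX] - f) ≈ con (tᵏ-factor t² k) * p[f] k
ψ-f[tX]-f k = trans (+-cong (trans (ψ-cong k f[tX]≈) (*-congˡ (ψ-f k))) (-‿cong (ψ-f k)))
  (trans (solve 2 (λ q p → q :* p :- p := (:con ℚ.1ℚ :+ :- q) :* :con (ℚ.- ℚ.1ℚ) :* p) refl (con (ψₜ (suc k) t²)) (p[f] k))
    (*-congʳ (sym (trans (Λ′.con-* _ _) (*-congʳ (trans (Λ′.con-+ _ _) (+-congˡ (con-neg _))))))))

ψ-f-f[tX] : ∀ k → ψ (suc k) (f - f[tX]) ≈ - (con (tᵏ-factor t² k) * p[f] k)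
ψ-f-f[tX] k = trans (solve 2 (λ x y → x :- y := :- (y :- x)) refl (ψ (suc k) f) (ψ (suc k) f[tX])) (-‿cong (ψ-f[tX]-f k))

module Conj⁺ = DominoConjugation 1ᶜ f (- f) ψ-f-scaled ψ-negf
module Conj⁻ = DominoConjugation -1ᶜ (- f) f ψ-negf-scaled ψ-f-neg
module Conjᵗ = DominoConjugation (tᵏ-factor t²) (f[tX] - f) (f - f[tX]) ψ-f[tX]-f ψ-f-f[tX]

τ-Ω[f] : ∀ F → τ (skewΩ f F) ≈ skewΩ f (τ F)
τ-Ω[f] F = begin
  τ (skewΩ f F)
    ≈⟨ τ-cong (Conj⁺.Ω⁺.E-∑ F N (s≤s (ℕₚ.m≤m⊔n (deg F) (deg (τ F))))) ⟨
  τ (∑ N (λ n → Ω f n ∙ F))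
    ≈⟨ Λ-τ.φ-∑ N _ ⟩
  ∑ N (λ n → τ (Ω f n ∙ F))
    ≈⟨ ∑-cong N (λ n _ → trans (τ-∙ (Ω f n) F) (∙-cong (τ-Ω {f} (λ i → trans (τ-cong (ψ-f i)) (sym (ψ-f i))) n) refl)) ⟩
  ∑ N (λ n → Ω f n ∙ τ F)
    ≈⟨ Conj⁺.Ω⁺.E-∑ (τ F) N (s≤s (ℕₚ.m≤n⊔m (deg F) (deg (τ F)))) ⟩
  skewΩ f (τ F) ∎
  where N = suc (deg F ℕ.⊔ deg (τ F))

-- Coefficients of a Schur expansion

combination : (Partition → Λ) → (Partition → ℚ[t]) → List Partition → Λ
combination b c = foldr (λ λ′ G → con (c λ′) * b λ′ + G) 0#

coefficient-unique : ∀ c {ls} → Unique ls → (∀ λ′ → λ′ ∉ ls → c λ′ K.≈ K.con ℚ.0ℚ) →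
  ∀ λ′ → ⟦ combination s c ls ∣ s λ′ ⟧ K.≈ c λ′
coefficient-unique c {ls} u c₀ λ′ = con-injective (trans (distribute ls) (extract (λ′ ∈? ls)))
  where
  g : Partition → Λ
  g ν = con (c ν) * con ⟦ s ν ∣ s λ′ ⟧
  distribute : ∀ ls → con ⟦ combination s c ls ∣ s λ′ ⟧ ≈ foldr (λ ν G → g ν + G) 0# ls
  distribute []       = Λ′.con-cong (hall-0ˡ _)
  distribute (ν ∷ ls) = trans (Λ′.con-cong (hall-+ˡ _ _ _)) (trans (Λ′.con-+ _ _)
    (+-cong (trans (Λ′.con-cong (hall-scaleˡ _ _ _)) (Λ′.con-* _ _)) (distribute ls)))
  off : ∀ ν → ¬ ν ≡ λ′ → g ν ≈ 0#
  off ν ν≢λ = trans (*-congˡ (Λ′.con-cong (s-orthogonal ν≢λ))) (zeroʳ _)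
  extract : Dec (λ′ ∈ ls) → foldr (λ ν G → g ν + G) 0# ls ≈ con (c λ′)
  extract (yes λ∈) = trans (foldr-single g off u λ∈) (trans (*-congˡ (Λ′.con-cong (s-normal λ′))) (*-identityʳ _))
  extract (no λ∉)  = trans (foldr-zero g ls (All.tabulate (λ {ν} ν∈ → off ν (λ { ≡.refl → λ∉ ν∈ })))) (sym (Λ′.con-cong (c₀ λ′ λ∉)))

-- The operators of the statement as vertex operators, and their comparison

module _ {S : ScalarProduct} (adj : Adjoints S) where

  open Domino adj
  open Adjoints adj
  open Pairing S using (⊥≈∙)

  Ω⊥-∑ : ∀ A F → Ω[ A ]⊥ F ≈ ∑ (suc (deg F)) (λ n → Ω A n ∙ F)
  Ω⊥-∑ A F = trans (DΛ.sum-cong {n = suc (deg F)} {λ n → (Ω A (toℕ n) ⊥) F} {λ n → Ω A (toℕ n) ∙ F} (λ n → ⊥≈∙ adj (Ω A (toℕ n)) F)) (sym (∑≈sum (suc (deg F)) (λ n → Ω A n ∙ F)))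

  B≈𝐁 : ∀ r F → B r F ≈ 𝐁 r F
  B≈𝐁 r F = begin
    B r F
      ≈⟨ DΛ.sum-cong {n = suc (deg F)} {λ n → h (r ℤ.+ ℤ.+ toℕ n) * (Ω (- X) (toℕ n) ⊥) F} {λ n → h (r ℤ.+ ℤ.+ toℕ n) * (Ω (- X) (toℕ n) ∙ F)}
           (λ n → *-congˡ {h (r ℤ.+ ℤ.+ toℕ n)} (⊥≈∙ adj (Ω (- X) (toℕ n)) F)) ⟩
    _
      ≈⟨ ∑≈sum (suc (deg F)) (λ n → h (r ℤ.+ ℤ.+ n) * (Ω (- X) n ∙ F)) ⟨
    BernsteinSum.partial (suc (deg F)) r F
      ≈⟨ BernsteinSum.partial≈𝐁 F _ r (ℕₚ.n<1+n _) ⟩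
    𝐁 r F ∎

  B-vertex : IsVertex h (λ _ → -1ₜ) (λ _ → 0ₜ) B
  B-vertex = IsVertex-resp B≈𝐁 𝐁-vertex

  Bᵛ≈ : ∀ r F → Bᵛ r F ≈ skewΩ (- f) (𝐁 r (skewΩ f F))
  Bᵛ≈ r F = begin
    Ω[ - f ]⊥ (B r (Ω[ f ]⊥ F))           ≈⟨ Ω⊥-∑ (- f) (B r (Ω[ f ]⊥ F)) ⟩
    _                                     ≈⟨ skewΩ-∑ (- f) (B r (Ω[ f ]⊥ F)) ⟨
    skewΩ (- f) (B r (Ω[ f ]⊥ F))          ≈⟨ Conj⁻.Ω⁺.E-cong (B≈𝐁 r (Ω[ f ]⊥ F)) ⟩
    skewΩ (- f) (𝐁 r (Ω[ f ]⊥ F))          ≈⟨ Conj⁻.Ω⁺.E-cong (𝐁.cong r (trans (Ω⊥-∑ f F) (sym (skewΩ-∑ f F)))) ⟩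
    skewΩ (- f) (𝐁 r (skewΩ f F))       ∎

  Bᵛ-vertex : IsVertex h (λ _ → -1ₜ) (λ _ → -1ₜ) Bᵛ
  Bᵛ-vertex = IsVertex-resp Bᵛ≈ (Conj⁻.conjugate 𝐁-vertex (λ _ → K.≈-refl))

  B̃ᵛ-vertex : IsVertex h (tᵏ-factor t) (tᵏ-factor t) B̃ᵛ
  B̃ᵛ-vertex = Analogue.analogue-vertex Bᵛ-vertex t

  opaque
    B̃ : ℤ → Op
    B̃ r = analogue t² (B r)

    B̃-vertex : IsVertex h (tᵏ-factor t²) (λ i → (1ₜ K.+ K.- ψₜ (suc i) t²) K.* 0ₜ) B̃
    B̃-vertex = Analogue.analogue-vertex B-vertex t²

    B̃-def : ∀ r F → analogue t² (B r) F ≈ B̃ r F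
    B̃-def r F = refl

  Hᵛ≈ : ∀ r F → Hᵛ r F ≈ skewΩ (f[tX] - f) (B̃ r (skewΩ (f - f[tX]) F))
  Hᵛ≈ r F = begin
    Ω[ f[tX] - f ]⊥ (analogue t² (B r) G) ≈⟨ Ω⊥-∑ (f[tX] - f) (analogue t² (B r) G) ⟩
    _                                     ≈⟨ skewΩ-∑ (f[tX] - f) (analogue t² (B r) G) ⟨
    skewΩ (f[tX] - f) (analogue t² (B r) G)      ≈⟨ Conjᵗ.Ω⁺.E-cong (B̃-def r G) ⟩
    skewΩ (f[tX] - f) (B̃ r G)                    ≈⟨ Conjᵗ.Ω⁺.E-cong (IsVertex.cong B̃-vertex r (trans (Ω⊥-∑ (f - f[tX]) F) (sym (skewΩ-∑ (f - f[tX]) F)))) ⟩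
    skewΩ (f[tX] - f) (B̃ r (skewΩ (f - f[tX]) F))       ∎
    where G = Ω[ f - f[tX] ]⊥ F

  Hᵛ-vertex : IsVertex h (tᵏ-factor t²) (tᵏ-factor t²) Hᵛ
  Hᵛ-vertex = IsVertex-resp Hᵛ≈ (Conjᵗ.conjugate B̃-vertex (λ _ → KR.zeroʳ _))

  Hᵛ≈B̃ᵛ : ∀ F r → τ (B̃ᵛ r F) ≈ Hᵛ r (τ F)
  Hᵛ≈B̃ᵛ = τ-vertex {V = B̃ᵛ} {Hᵛ} B̃ᵛ-vertex Hᵛ-vertex factor factor
    where
    factor : ∀ i → tᵏ-factor t² i K.≈ τₜ (tᵏ-factor t i)
    factor i = KR.*-congʳ (KR.+-congˡ (KR.-‿cong (KR.sym (τₜ-power (suc i)))))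

  ℍᵛ≈𝔹ᵛ : ∀ μ → ℍᵛ μ ≈ τ (𝔹ᵛ μ)
  ℍᵛ≈𝔹ᵛ μ = τ-foldr {B̃ᵛ} {Hᵛ} (λ r → IsVertex.cong Hᵛ-vertex r) Hᵛ≈B̃ᵛ (parts μ)

  Ω[f]-sᵛ : ∀ λ′ → skewΩ f (sᵛ λ′) ≈ s λ′
  Ω[f]-sᵛ λ′ = trans (Conj⁺.Ω⁺.E-cong (trans (Ω⊥-∑ (- f) (s λ′)) (sym (skewΩ-∑ (- f) (s λ′))))) (Conj⁺.inverse (s λ′))

  Ω[f]-combination : ∀ c ls → skewΩ f (combination sᵛ c ls) ≈ combination s c ls
  Ω[f]-combination c []       = trans (Conj⁺.Ω⁺.E-cong (sym (zeroˡ 0#))) (trans (Conj⁺.Ω⁺.E-scale _ 0#) (zeroˡ _))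
  Ω[f]-combination c (ν ∷ ls) = trans (Conj⁺.Ω⁺.E-+ _ _) (+-cong (trans (Conj⁺.Ω⁺.E-scale _ _) (*-congˡ (Ω[f]-sᵛ ν))) (Ω[f]-combination c ls))

  τ-combination : ∀ c ls → τ (combination s c ls) ≈ combination s (τₜ ∘ c) ls
  τ-combination c []       = refl
  τ-combination c (ν ∷ ls) = +-cong (*-congˡ (τ-s ν)) (τ-combination c ls)

  -- Ω[f]^⊥ turns the sᵛ into Schur functions and commutes with t ↦ t², which fixes Schur functions.
  -- Both expansions thus become Schur expansions of one element, and pairing with s_λ isolates the
  -- coefficients even though the two lists of partitions may differ.
  expansions : ∀ μ (κ d : Partition → ℚ[t]) → (ℍᵛ μ) HasExpansion κ → (𝔹ᵛ μ) HasExpansion d → ∀ λ′ → κ λ′ K.≈ τₜ (d λ′)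
  expansions μ κ d (ls , u , κ₀ , ℍ≈) (ls′ , u′ , d₀ , 𝔹≈) λ′ = KR.trans (KR.sym (coefficient-unique κ u κ₀ λ′))
    (KR.trans (hall-cong agree refl) (coefficient-unique (τₜ ∘ d) u′ (λ ν ν∉ → τₜ-cong (d₀ ν ν∉)) λ′))
    where
    agree : combination s κ ls ≈ combination s (τₜ ∘ d) ls′
    agree = begin
      combination s κ ls                       ≈⟨ Ω[f]-combination κ ls ⟨
      skewΩ f (combination sᵛ κ ls)         ≈⟨ Conj⁺.Ω⁺.E-cong ℍ≈ ⟨
      skewΩ f (ℍᵛ μ)                        ≈⟨ Conj⁺.Ω⁺.E-cong (ℍᵛ≈𝔹ᵛ μ) ⟩
      skewΩ f (τ (𝔹ᵛ μ))                    ≈⟨ τ-Ω[f] (𝔹ᵛ μ) ⟨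
      τ (skewΩ f (𝔹ᵛ μ))                    ≈⟨ τ-cong (trans (Conj⁺.Ω⁺.E-cong 𝔹≈) (Ω[f]-combination d ls′)) ⟩
      τ (combination s d ls′)                  ≈⟨ τ-combination d ls′ ⟩
      combination s (τₜ ∘ d) ls′               ∎

proposition31 : (S : ScalarProduct) (adj : Adjoints S) (μ : Partition) →
    let open Domino adj in
    (ℍᵛ μ ≈ (𝔹ᵛ μ) [t↦t²]) ×
    ((κ d : Partition → ℚ[t]) → (ℍᵛ μ) HasExpansion κ → (𝔹ᵛ μ) HasExpansion d →
    ∀ λ′ → κ λ′ K.≈ (d λ′) [t↦t²]ₜ)
proposition31 S adj μ = ℍᵛ≈𝔹ᵛ adj μ , expansions adj μ
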